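{- Let $\Bbbk$ be a field of characteristic different from $2$ and $n$ a positive integer. Then $$\varphi(e_{(n)})=\begin{cases}\rho_{(n)}&n\text{ even},\\0&n\text{ odd},\end{cases}\qquad \varphi(e_{(0,n)})=\begin{cases}0&n\text{ even},\\2\rho_{(0,n)}&n\text{ odd}.\end{cases}$$ In particular, $\rho_{(n)}$ is idempotent for each even $n$, and $\rho_{(0,n)}$ is idempotent for each odd $n$.
   Context: $B_n$ is the group of signed permutations (bijections $\sigma$ of $\{\pm1,\dots,\pm n\}$ with $\sigma(-i)=-\sigma(i)$); set $\sigma(0)=0$ and $\mathrm{Des}(\sigma)=\{i\in\{0,\dots,n-1\}:\sigma(i)>\sigma(i+1)\}$. $\varphi:\Bbbk B_n\to\Bbbk S_n$ is the linear extension of the map forgetting signs, $\varphi(\sigma)(i)=|\sigma(i)|$. For $\sigma\in S_n$, $\sigma(0)=0$ and $\mathrm{Peak}(\sigma)=\{i\in\{1,\dots,n-1\}:\sigma(i-1)<\sigma(i)>\sigma(i+1)\}$. Define $y_j=\sum\{\sigma\in B_n:\#\mathrm{Des}(\sigma)=j\}$ ($0\le j\le n$), $y^0_j=\sum\{\sigma\in B_n:\#(\mathrm{Des}(\sigma)\setminus\{0\})=j-1\}$ ($1\le j\le n$), $p_j=\sum\{\sigma\in S_n:\#\mathrm{Peak}(\sigma)=j\}$ ($0\le j\le\lfloor n/2\rfloor$), $p^0_j=\sum\{\sigma\in S_n:\#(\mathrm{Peak}(\sigma)\setminus\{1\})=j-1\}$ ($1\le j\le\lfloor(n+1)/2\rfloor$).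 Let $m!!=m(m-2)(m-4)\cdots$ (ending in $2$ or $1$), $0!!=(-1)!!=1$. Define $e_{(n)}=\sum_{j=0}^n(-1)^j\frac{(2j-1)!!(2n-2j-1)!!}{(2n)!!}y_j$, $e_{(0,n)}=\sum_{j=1}^n(-1)^{j-1}\frac{(j-1)!(n-j)!}{n!}y^0_j$, $\rho_{(n)}=\sum_{j=0}^{\lfloor n/2\rfloor}(-1)^j\frac{(2j-1)!!(n-2j-1)!!}{n!!}p_j$, $\rho_{(0,n)}=\sum_{j=1}^{\lfloor(n+1)/2\rfloor}(-1)^{j-1}\frac{(2j-2)!!(n-2j)!!}{n!!}p^0_j$ (rational coefficients interpreted in $\Bbbk$). Products in $\Bbbk S_n$ are the group algebra products.
   Formalization: Each identity is stated under the hypothesis that the rational coefficients of the elements involved have reduced denominators nonzero in the field; characteristic different from 2 alone does not ensure this (e.g. the coefficient 1/3 of e_(0,3) and ρ_(0,3) in characteristic 3). -}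

module Defs where

open import Level using (_⊔_) renaming (suc to lsuc)
open import Data.Bool using (Bool; true; false; if_then_else_; _∧_)
open import Data.Nat as ℕ using (ℕ; zero; suc; _∸_; NonZero; _!)
open import Data.Nat.Properties using (_!≢0; m*n≢0)
open import Data.Integer as ℤ using (ℤ; +_; -[1+_])
open import Data.Rational as ℚ using (ℚ; ↥_; ↧ₙ_)
open import Data.List using (List; []; _∷_; map; foldr; concatMap)
open import Data.List.Properties using (≡-dec)
open import Data.List.Membership.Propositional using (_∈_)
open import Relation.Nullary using (¬_; Dec; yes; no)
open import Relation.Nullary.Decidable using (⌊_⌋)
open import Relation.Binary.PropositionalEquality using (_≡_)
open import Algebra.Bundles using (CommutativeRing)

-- Fields: a commutative ring with 1 ≠ 0 in which every nonzero element
-- has a multiplicative inverse.  The inverse is a total operation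
-- (its value at 0 is unconstrained and never used).

record Field (c ℓ : Level.Level) : Set (lsuc (c ⊔ ℓ)) where
  field
    commutativeRing : CommutativeRing c ℓ
  open CommutativeRing commutativeRing public
  field
    _⁻¹       : Carrier → Carrier
    1≉0       : ¬ (1# ≈ 0#)
    ⁻¹-inverse : ∀ x → ¬ (x ≈ 0#) → x * (x ⁻¹) ≈ 1#

module FieldOps {c ℓ} (F : Field c ℓ) where
  open Field F

  ℕ→k : ℕ → Carrier
  ℕ→k zero    = 0#
  ℕ→k (suc m) = 1# + ℕ→k m

  ℤ→k : ℤ → Carrier
  ℤ→k (+ m)     = ℕ→k m
  ℤ→k -[1+ m ]  = - ℕ→k (suc m)

  CharNot2 : Set ℓ
  CharNot2 = ¬ (1# + 1# ≈ 0#)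

  Interpretable : ℚ → Set ℓ
  Interpretable q = ¬ (ℕ→k (↧ₙ q) ≈ 0#)

  ⟦_⟧ : ℚ → Carrier
  ⟦ q ⟧ = ℤ→k (↥ q) * (ℕ→k (↧ₙ q) ⁻¹)

  Σ[_]_ : ∀ {a} {A : Set a} → List A → (A → Carrier) → Carrier
  Σ[ xs ] f = foldr (λ x acc → f x + acc) 0# xs

_!! : ℕ → ℕ
zero !!          = 1
suc zero !!      = 1
suc (suc m) !!   = suc (suc m) ℕ.* (m !!)

!!≢0 : ∀ m → NonZero (m !!)
!!≢0 zero = _
!!≢0 (suc zero) = _
!!≢0 (suc (suc m)) = m*n≢0 (suc (suc m)) (m !!) {{ _ }} {{ !!≢0 m }}

-- dfm m = (m - 1) !!, with (-1) !! = 1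
dfm : ℕ → ℕ
dfm zero    = 1
dfm (suc m) = m !!

sgn : ℕ → ℤ
sgn zero    = + 1
sgn (suc j) = ℤ.- sgn j

insertions : ℕ → List ℕ → List (List ℕ)
insertions x []       = (x ∷ []) ∷ []
insertions x (y ∷ ys) = (x ∷ y ∷ ys) ∷ map (y ∷_) (insertions x ys)

-- S_n : all permutations of {1,…,n}, as lists [σ(1),…,σ(n)]
perms : ℕ → List (List ℕ)
perms zero    = [] ∷ []
perms (suc n) = concatMap (insertions (suc n)) (perms n)

signings : List ℕ → List (List ℤ)
signings []       = [] ∷ []
signings (x ∷ xs) = concatMap (λ t → (+ x ∷ t) ∷ (ℤ.- (+ x) ∷ t) ∷ []) (signings xs)

-- B_n : all signed permutations, as lists [σ(1),…,σ(n)]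
sperms : ℕ → List (List ℤ)
sperms n = concatMap signings (perms n)

-- one-line value σ(i) (1-indexed; 0 outside range)
at : List ℕ → ℕ → ℕ
at []       _             = 0
at (x ∷ xs) zero          = 0
at (x ∷ xs) (suc zero)    = x
at (x ∷ xs) (suc (suc i)) = at xs (suc i)

_∘ₚ_ : List ℕ → List ℕ → List ℕ
σ ∘ₚ τ = map (at σ) τ

descents : List ℤ → ℕ
descents (a ∷ b ∷ rest) =
  (if ⌊ b ℤ.<? a ⌋ then 1 else 0) ℕ.+ descents (b ∷ rest)
descents _ = 0

-- #Des(σ) for σ ∈ B_n, with σ(0) = 0 : Des ⊆ {0,…,n-1}
#Des : List ℤ → ℕ
#Des σ = descents (+ 0 ∷ σ)

-- #(Des(σ) ∖ {0})
#Des⁺ : List ℤ → ℕ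
#Des⁺ σ = descents σ

peaks : List ℕ → ℕ
peaks (a ∷ b ∷ c ∷ rest) =
  (if ⌊ a ℕ.<? b ⌋ ∧ ⌊ c ℕ.<? b ⌋ then 1 else 0) ℕ.+ peaks (b ∷ c ∷ rest)
peaks _ = 0

-- #Peak(σ) for σ ∈ S_n with σ(0) = 0 : Peak ⊆ {1,…,n-1}
#Peak : List ℕ → ℕ
#Peak σ = peaks (0 ∷ σ)

-- #(Peak(σ) ∖ {1})
#Peak⁺ : List ℕ → ℕ
#Peak⁺ σ = peaks σ

-- e_(n): (-1)^j (2j-1)!! (2n-2j-1)!! / (2n)!!      (0 ≤ j ≤ n)
eCoef : ℕ → ℕ → ℚ
eCoef n j = ((sgn j) ℤ.* (+ (dfm (2 ℕ.* j) ℕ.* dfm (2 ℕ.* n ∸ 2 ℕ.* j))))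
              ℚ./ ((2 ℕ.* n) !!)
            where instance _ = !!≢0 (2 ℕ.* n)

-- e_(0,n): (-1)^(j-1) (j-1)! (n-j)! / n!            (1 ≤ j ≤ n)
e0Coef : ℕ → ℕ → ℚ
e0Coef n j = ((sgn (j ∸ 1)) ℤ.* (+ ((j ∸ 1) ! ℕ.* (n ∸ j) !)))
               ℚ./ (n !)
             where instance _ = n !≢0

-- ρ_(n): (-1)^j (2j-1)!! (n-2j-1)!! / n!!            (0 ≤ j ≤ ⌊n/2⌋)
ρCoef : ℕ → ℕ → ℚ
ρCoef n j = ((sgn j) ℤ.* (+ (dfm (2 ℕ.* j) ℕ.* dfm (n ∸ 2 ℕ.* j))))
              ℚ./ (n !!)
            where instance _ = !!≢0 n

-- ρ_(0,n): (-1)^(j-1) (2j-2)!! (n-2j)!! / n!!      (1 ≤ j ≤ ⌊(n+1)/2⌋)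
-- (2j-2)!! = dfm (2j-1) and (n-2j)!! = dfm (n+1-2j) in this range
ρ0Coef : ℕ → ℕ → ℚ
ρ0Coef n j = ((sgn (j ∸ 1)) ℤ.* (+ (dfm (2 ℕ.* j ∸ 1) ℕ.* dfm (suc n ∸ 2 ℕ.* j))))
               ℚ./ (n !!)
             where instance _ = !!≢0 n

-- Group algebras kB_n and kS_n, as coefficient functions.
-- An element of kB_n is a function List ℤ → k (only values on sperms n
-- matter); an element of kS_n is a function List ℕ → k (only values on
-- perms n matter).

module GroupAlgebra {c ℓ} (F : Field c ℓ) (n : ℕ) where
  open Field F
  open FieldOps F

  kB : Set c
  kB = List ℤ → Carrier

  kS : Set c
  kS = List ℕ → Carrier

  _≋_ : kS → kS → Set ℓ
  f ≋ g = ∀ σ → σ ∈ perms n → f σ ≈ g σ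

  0ₛ : kS
  0ₛ _ = 0#

  _·_ : Carrier → kS → kS
  (a · f) σ = a * f σ

  _⋆_ : kS → kS → kS
  (f ⋆ g) π = Σ[ perms n ] λ σ → Σ[ perms n ] λ τ →
                if ⌊ ≡-dec ℕ._≟_ (σ ∘ₚ τ) π ⌋ then f σ * g τ else 0#

  -- φ : kB_n → kS_n, linear extension of forgetting signs
  φ : kB → kS
  φ E π = Σ[ sperms n ] λ σ →
            if ⌊ ≡-dec ℕ._≟_ (map ℤ.∣_∣ σ) π ⌋ then E σ else 0#

  e : kB
  e σ = ⟦ eCoef n (#Des σ) ⟧

  e0 : kB
  e0 σ = ⟦ e0Coef n (suc (#Des⁺ σ)) ⟧

  ρ : kS
  ρ σ = ⟦ ρCoef n (#Peak σ) ⟧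

  ρ0 : kS
  ρ0 σ = ⟦ ρ0Coef n (suc (#Peak⁺ σ)) ⟧

  e-ok : Set ℓ
  e-ok = ∀ j → j ℕ.≤ n → Interpretable (eCoef n j)

  e0-ok : Set ℓ
  e0-ok = ∀ j → 1 ℕ.≤ j → j ℕ.≤ n → Interpretable (e0Coef n j)

  ρ-ok : Set ℓ
  ρ-ok = ∀ j → j ℕ.≤ n ℕ./ 2 → Interpretable (ρCoef n j)

  ρ0-ok : Set ℓ
  ρ0-ok = ∀ j → 1 ℕ.≤ j → j ℕ.≤ suc n ℕ./ 2 → Interpretable (ρ0Coef n j)

{-# OPTIONS --safe #-}
-- Take an alphabet of m letters, alternately signed, and call a labeling of a list by letters
-- sorted when the letters are monotone along the list and a run of a positive (negative) letter is
-- increasing (decreasing).  The number of sorted labelings of σ defines an element P_m of ℤS_n.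
-- Sorting a pair of labelings lexicographically, with the inner order reversed under negative
-- letters, gives P_M P_N = P_{MN}.
--
-- For m odd, and for m even, 2ⁿ n! P_m is a polynomial in m, namely a sum over all signings of σ of a
-- product depending on the number of descents only.  The value at 0 of the first polynomial is a
-- multiple of φ(e_(n)), and the linear coefficient of the second is a multiple of φ(e_(0,n)); reducing
-- P_m P_m = P_{m²} modulo m for large m shows that both satisfy the idempotent law.
--
-- The sums over signings are Σ t^#Des = (4t)^p (1+t)^{n-2p} and Σ t^#Des⁺ = 2 (4t)^p (1+t)^{n-1-2p},
-- where p counts peaks, so that φ(e_(n)) and φ(e_(0,n)) become Beta integrals of
-- (u(1-u))^{p+s/2-1} (1-2u)^m, with s = 1 and s = 2 respectively, evaluated by integration by parts.
--
-- These are identities of rational numbers; they pass to the field because the coefficients in them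
-- have reduced denominators that are nonzero there.

module Submission where

open import Defs
open import Data.Nat using (ℕ; _≤_)
open import Data.Nat.Divisibility using (_∣_)
open import Data.Product using (_×_)
open import Relation.Nullary using (¬_)
open import Data.Nat using (suc)
open import Data.Product using (_,_)

-- The obstacle is that the coefficients are rational while the field may have positive
-- characteristic, where `n !` or `n !!` can vanish. All identities are therefore proved between
-- integers, after multiplication by 2ⁿ n! or by half of it; only reduced denominators and their
-- products are inverted in the field.
--
-- Odd and even alphabet sizes give two different polynomials, because a further letter obeys a rule
-- that depends on its sign. Each parity class is closed under squaring, so each polynomial has a
-- relation of its own. No polynomial ring is built: the only property used is that f(x) - f(0) is
-- divisible by x, together with the fact that a multiple of m smaller than m in absolute value is
-- zero. Over an empty alphabet a nonempty list has no labeling, so the even polynomial vanishes at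
-- 0 and is divided by its argument before the reduction.
--
-- Descents enter because the generating functions of the numbers of sorted labelings are descent
-- enumerators of signings over a power of 1 - t. The proof works with the coefficients of these
-- series, written with falling factorials of step 2 in order to stay among the integers.

module IntegerIdentities where

  open import Data.Bool using (Bool; _∧_; _∨_; false; if_then_else_; not; true)
  open import Data.Bool.ListAction using (all)
  open import Data.Bool.Properties using (not-involutive)
  open import Data.Empty using (⊥-elim)
  open import Data.Integer as ℤ using (+_; -1ℤ; -_; 0ℤ; 1ℤ; _*_; _+_; _-_; ℤ; ∣_∣)
  import Data.Integer.Properties as ℤₚ
  open import Data.Integer.Tactic.RingSolver using (solve-∀)
  open import Data.List using (List; []; _++_; _∷_; concatMap; downFrom; length; map)
  open import Data.List.Membership.Propositional using (_∈_)
  open import Data.List.Membership.Propositional.Properties using (∈-concatMap⁻; ∈-downFrom⁻; ∈-map⁺; ∈-map⁻)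
  open import Data.List.Properties using (concatMap-cong; length-map; map-∘; ∷-injectiveʳ; ∷-injectiveˡ; ≡-dec)
  open import Data.List.Relation.Binary.Permutation.Propositional using (_↭_; prep; refl; swap; trans; ↭-refl; ↭-reflexive; ↭-sym)
  open import Data.List.Relation.Binary.Permutation.Propositional.Properties using (All-resp-↭; map⁺; ↭-length; ∈-resp-↭)
  import Data.List.Relation.Unary.All as All
  open import Data.List.Relation.Unary.All using (All; []; _∷_)
  import Data.List.Relation.Unary.All.Properties as Allₚ
  import Data.List.Relation.Unary.AllPairs as AllPairs
  open import Data.List.Relation.Unary.AllPairs using (AllPairs; []; _∷_)
  import Data.List.Relation.Unary.AllPairs.Properties as AllPairsₚ
  import Data.List.Relation.Unary.Any as Any
  open import Data.List.Relation.Unary.Any using (here; there)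
  open import Data.List.Relation.Unary.Linked using (Linked; []; _∷_)
  open import Data.List.Relation.Unary.Linked.Properties using (AllPairs⇒Linked)
  open import Data.List.Relation.Unary.Unique.Propositional using (Unique)
  open import Data.Nat as ℕ using (_!; _<_; _∸_; _≤_; suc; s≤s; zero; z≤n; ℕ)
  import Data.Nat.DivMod as DivMod
  open import Data.Nat.Divisibility using (_∣_; divides)
  import Data.Nat.Properties as ℕₚ
  open import Data.Product using (_,_; _×_; proj₁; proj₂; ∃)
  open import Data.Sum using (_⊎_; inj₁; inj₂)
  open import Function using (_∘_)
  open import Relation.Binary.Definitions using (tri<; tri>; tri≈)
  open import Relation.Binary.PropositionalEquality as ≡ using (_≡_; _≢_; cong; cong₂; module ≡-Reasoning; refl; subst; sym)
  open import Relation.Nullary using (Dec; no; yes; ¬_)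
  open import Relation.Nullary.Decidable using (⌊_⌋)

  private variable
    A B : Set

  -- Finite sums of integers and Boolean conditions

  ∑ : List A → (A → ℤ) → ℤ
  ∑ []       f = 0ℤ
  ∑ (x ∷ xs) f = f x + ∑ xs f

  when : Bool → ℤ → ℤ
  when b z = if b then z else 0ℤ

  ∑-cong : ∀ (xs : List A) {f g : A → ℤ} → (∀ x → x ∈ xs → f x ≡ g x) → ∑ xs f ≡ ∑ xs g
  ∑-cong []       f≡g = refl
  ∑-cong (x ∷ xs) f≡g = cong₂ _+_ (f≡g x (here refl)) (∑-cong xs λ y y∈ → f≡g y (there y∈))

  ∑-ext : ∀ (xs : List A) {f g : A → ℤ} → (∀ x → f x ≡ g x) → ∑ xs f ≡ ∑ xs g
  ∑-ext xs f≡g = ∑-cong xs λ x _ → f≡g x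

  ∑-zero : ∀ (xs : List A) → ∑ xs (λ _ → 0ℤ) ≡ 0ℤ
  ∑-zero []       = refl
  ∑-zero (x ∷ xs) = ≡.trans (ℤₚ.+-identityˡ _) (∑-zero xs)

  ∑-++ : ∀ (xs ys : List A) f → ∑ (xs ++ ys) f ≡ ∑ xs f + ∑ ys f
  ∑-++ []       ys f = sym (ℤₚ.+-identityˡ _)
  ∑-++ (x ∷ xs) ys f = ≡.trans (cong (_+_ (f x)) (∑-++ xs ys f)) (sym (ℤₚ.+-assoc (f x) _ _))

  ∑-map : ∀ (h : A → B) xs f → ∑ (map h xs) f ≡ ∑ xs (f ∘ h)
  ∑-map h []       f = refl
  ∑-map h (x ∷ xs) f = cong (_+_ (f (h x))) (∑-map h xs f)

  ∑-concatMap : ∀ (h : A → List B) xs f → ∑ (concatMap h xs) f ≡ ∑ xs λ x → ∑ (h x) f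
  ∑-concatMap h []       f = refl
  ∑-concatMap h (x ∷ xs) f =
    ≡.trans (∑-++ (h x) (concatMap h xs) f) (cong (_+_ (∑ (h x) f)) (∑-concatMap h xs f))

  ∑-+ : ∀ (xs : List A) f g → ∑ xs (λ x → f x + g x) ≡ ∑ xs f + ∑ xs g
  ∑-+ []       f g = refl
  ∑-+ (x ∷ xs) f g = ≡.trans (cong (_+_ (f x + g x)) (∑-+ xs f g)) (lemma (f x) (g x) _ _)
    where
    lemma : ∀ a b c d → (a + b) + (c + d) ≡ (a + c) + (b + d)
    lemma = solve-∀

  ∑-*ˡ : ∀ (xs : List A) c f → ∑ xs (λ x → c * f x) ≡ c * ∑ xs f
  ∑-*ˡ []       c f = sym (ℤₚ.*-zeroʳ c)
  ∑-*ˡ (x ∷ xs) c f =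
    ≡.trans (cong (_+_ (c * f x)) (∑-*ˡ xs c f)) (sym (ℤₚ.*-distribˡ-+ c (f x) _))

  ∑-*ʳ : ∀ (xs : List A) c f → ∑ xs (λ x → f x * c) ≡ ∑ xs f * c
  ∑-*ʳ xs c f = begin
    ∑ xs (λ x → f x * c) ≡⟨ ∑-ext xs (λ x → ℤₚ.*-comm (f x) c) ⟩
    ∑ xs (λ x → c * f x) ≡⟨ ∑-*ˡ xs c f ⟩
    c * ∑ xs f           ≡⟨ ℤₚ.*-comm c _ ⟩
    ∑ xs f * c           ∎
    where open ≡-Reasoning

  ∑-swap : ∀ (xs : List A) (ys : List B) (f : A → B → ℤ) →
           ∑ xs (λ x → ∑ ys (f x)) ≡ ∑ ys (λ y → ∑ xs (λ x → f x y))
  ∑-swap []       ys f = sym (∑-zero ys)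
  ∑-swap (x ∷ xs) ys f =
    ≡.trans (cong (_+_ (∑ ys (f x))) (∑-swap xs ys f)) (sym (∑-+ ys (f x) (λ y → ∑ xs (λ x′ → f x′ y))))

  when-zero : ∀ b → when b 0ℤ ≡ 0ℤ
  when-zero true  = refl
  when-zero false = refl

  when-∧ : ∀ a b z → when (a ∧ b) z ≡ when a (when b z)
  when-∧ true  b z = refl
  when-∧ false b z = refl

  when-*ˡ : ∀ b x y → when b (x * y) ≡ x * when b y
  when-*ˡ true  x y = refl
  when-*ˡ false x y = sym (ℤₚ.*-zeroʳ x)

  ∑-when : ∀ (xs : List A) b f → ∑ xs (λ x → when b (f x)) ≡ when b (∑ xs f)
  ∑-when xs true  f = refl
  ∑-when xs false f = ∑-zero xs

  ⌊⌋-cong : ∀ {P Q : Set} (p? : Dec P) (q? : Dec Q) → (P → Q) → (Q → P) → ⌊ p? ⌋ ≡ ⌊ q? ⌋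
  ⌊⌋-cong (yes p) (yes q) f g = refl
  ⌊⌋-cong (yes p) (no ¬q) f g = ⊥-elim (¬q (f p))
  ⌊⌋-cong (no ¬p) (yes q) f g = ⊥-elim (¬p (g q))
  ⌊⌋-cong (no ¬p) (no ¬q) f g = refl

  ⌊⌋-false : ∀ {P : Set} (p? : Dec P) → ¬ P → ⌊ p? ⌋ ≡ false
  ⌊⌋-false (yes p) ¬p = ⊥-elim (¬p p)
  ⌊⌋-false (no _)  ¬p = refl

  ⌊⌋-true : ∀ {P : Set} (p? : Dec P) → P → ⌊ p? ⌋ ≡ true
  ⌊⌋-true (yes _) p = refl
  ⌊⌋-true (no ¬p) p = ⊥-elim (¬p p)

  -- Arrangements of a list

  ins : A → List A → List (List A)
  ins x []       = (x ∷ []) ∷ []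
  ins x (y ∷ ys) = (x ∷ y ∷ ys) ∷ map (y ∷_) (ins x ys)

  arrangements : List A → List (List A)
  arrangements []       = [] ∷ []
  arrangements (x ∷ xs) = concatMap (ins x) (arrangements xs)

  ∑-ins-∷ : ∀ (x y : A) ys F → ∑ (ins x (y ∷ ys)) F ≡ F (x ∷ y ∷ ys) + ∑ (ins x ys) (λ l → F (y ∷ l))
  ∑-ins-∷ x y ys F = cong (_+_ (F (x ∷ y ∷ ys))) (∑-map (y ∷_) (ins x ys) F)

  ∑-arrangements-∷ : ∀ (x : A) xs F →
    ∑ (arrangements (x ∷ xs)) F ≡ ∑ (arrangements xs) (λ σ → ∑ (ins x σ) F)
  ∑-arrangements-∷ x xs F = ∑-concatMap (ins x) (arrangements xs) F

  ∈-ins⇒↭ : ∀ {x : A} ys {zs} → zs ∈ ins x ys → zs ↭ x ∷ ys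
  ∈-ins⇒↭ []       (here refl) = ↭-refl
  ∈-ins⇒↭ (y ∷ ys) (here refl) = ↭-refl
  ∈-ins⇒↭ (y ∷ ys) (there zs∈) with ∈-map⁻ (y ∷_) zs∈
  ... | l , l∈ , refl = trans (prep y (∈-ins⇒↭ ys l∈)) (swap y _ ↭-refl)

  ∈-arrangements⇒↭ : ∀ (xs : List A) {zs} → zs ∈ arrangements xs → zs ↭ xs
  ∈-arrangements⇒↭ []       (here refl) = ↭-refl
  ∈-arrangements⇒↭ (x ∷ xs) zs∈ with Any.satisfied (∈-concat zs∈)
    where
    ∈-concat : ∀ {zs} → zs ∈ concatMap (ins x) (arrangements xs) →
               Any.Any (λ σ → zs ↭ x ∷ xs) (arrangements xs)
    ∈-concat zs∈ = go (arrangements xs) (λ σ∈ → ∈-arrangements⇒↭ xs σ∈) (∈-concatMap⁻ (ins x) zs∈)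
      where
      go : ∀ {zs} σs → (∀ {σ} → σ ∈ σs → σ ↭ xs) → Any.Any (λ σ → zs ∈ ins x σ) σs →
           Any.Any (λ σ → zs ↭ x ∷ xs) σs
      go (σ ∷ σs) h (here p)  = here (trans (∈-ins⇒↭ σ p) (prep x (h (here refl))))
      go (σ ∷ σs) h (there p) = there (go σs (λ σ∈ → h (there σ∈)) p)
  ... | _ , p = p

  -- Relative to the head `z`, the entries `x` and `y` are both in front in either order, or one is
  -- behind, or both are behind, which is the inductive case. The lists arise in different orders,
  -- so the agreement is expressed through sums of an arbitrary `F`.
  ins-comm : ∀ (x y : A) zs F →
    ∑ (ins y zs) (λ σ → ∑ (ins x σ) F) ≡ ∑ (ins x zs) (λ σ → ∑ (ins y σ) F)
  ins-comm x y []       F = lemma (F (x ∷ y ∷ [])) (F (y ∷ x ∷ []))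
    where
    lemma : ∀ a b → (a + (b + 0ℤ)) + 0ℤ ≡ (b + (a + 0ℤ)) + 0ℤ
    lemma = solve-∀
  ins-comm x y (z ∷ zs) F = begin
    ∑ (ins y (z ∷ zs)) (λ σ → ∑ (ins x σ) F)
      ≡⟨ expand x y ⟩
    (F (x ∷ y ∷ z ∷ zs) + (F (y ∷ x ∷ z ∷ zs) + ∑ (ins x zs) (λ l → F (y ∷ z ∷ l))))
      + (∑ (ins y zs) (λ l → F (x ∷ z ∷ l)) + ∑ (ins y zs) (λ l → ∑ (ins x l) (λ l′ → F (z ∷ l′))))
      ≡⟨ cong (λ w → (F (x ∷ y ∷ z ∷ zs) + (F (y ∷ x ∷ z ∷ zs) + ∑ (ins x zs) (λ l → F (y ∷ z ∷ l))))
                     + (∑ (ins y zs) (λ l → F (x ∷ z ∷ l)) + w)) (ins-comm x y zs (λ l → F (z ∷ l))) ⟩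
    (F (x ∷ y ∷ z ∷ zs) + (F (y ∷ x ∷ z ∷ zs) + ∑ (ins x zs) (λ l → F (y ∷ z ∷ l))))
      + (∑ (ins y zs) (λ l → F (x ∷ z ∷ l)) + ∑ (ins x zs) (λ l → ∑ (ins y l) (λ l′ → F (z ∷ l′))))
      ≡⟨ lemma (F (x ∷ y ∷ z ∷ zs)) (F (y ∷ x ∷ z ∷ zs)) (∑ (ins x zs) (λ l → F (y ∷ z ∷ l)))
               (∑ (ins y zs) (λ l → F (x ∷ z ∷ l))) _ ⟩
    (F (y ∷ x ∷ z ∷ zs) + (F (x ∷ y ∷ z ∷ zs) + ∑ (ins y zs) (λ l → F (x ∷ z ∷ l))))
      + (∑ (ins x zs) (λ l → F (y ∷ z ∷ l)) + ∑ (ins x zs) (λ l → ∑ (ins y l) (λ l′ → F (z ∷ l′))))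
      ≡⟨ expand y x ⟨
    ∑ (ins x (z ∷ zs)) (λ σ → ∑ (ins y σ) F) ∎
    where
    open ≡-Reasoning
    lemma : ∀ a b c d e → (a + (b + c)) + (d + e) ≡ (b + (a + d)) + (c + e)
    lemma = solve-∀
    expand : ∀ x y → ∑ (ins y (z ∷ zs)) (λ σ → ∑ (ins x σ) F) ≡
      (F (x ∷ y ∷ z ∷ zs) + (F (y ∷ x ∷ z ∷ zs) + ∑ (ins x zs) (λ l → F (y ∷ z ∷ l))))
        + (∑ (ins y zs) (λ l → F (x ∷ z ∷ l)) + ∑ (ins y zs) (λ l → ∑ (ins x l) (λ l′ → F (z ∷ l′))))
    expand x y = begin
      ∑ (ins y (z ∷ zs)) (λ σ → ∑ (ins x σ) F)
        ≡⟨ ∑-ins-∷ y z zs (λ σ → ∑ (ins x σ) F) ⟩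
      ∑ (ins x (y ∷ z ∷ zs)) F + ∑ (ins y zs) (λ l → ∑ (ins x (z ∷ l)) F)
        ≡⟨ cong₂ _+_ (≡.trans (∑-ins-∷ x y (z ∷ zs) F) (cong (_+_ (F (x ∷ y ∷ z ∷ zs))) (∑-ins-∷ x z zs (λ l → F (y ∷ l)))))
                     (≡.trans (∑-ext (ins y zs) (λ l → ∑-ins-∷ x z l F)) (∑-+ (ins y zs) _ _)) ⟩
      _ ∎

  -- Allows the list `down n` underlying the permutations to be exchanged for the permutation `π` at
  -- which a convolution is evaluated, so that labelings of `π` itself can be used. The `swap` case
  -- rests on `ins-comm`.
  ∑-arrangements-↭ : ∀ {xs ys : List A} → xs ↭ ys → ∀ F → ∑ (arrangements xs) F ≡ ∑ (arrangements ys) F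
  ∑-arrangements-↭ refl F = refl
  ∑-arrangements-↭ {xs = _ ∷ xs} {ys = _ ∷ ys} (prep x p) F = begin
    ∑ (arrangements (x ∷ xs)) F                  ≡⟨ ∑-arrangements-∷ x xs F ⟩
    ∑ (arrangements xs) (λ σ → ∑ (ins x σ) F)    ≡⟨ ∑-arrangements-↭ p _ ⟩
    ∑ (arrangements ys) (λ σ → ∑ (ins x σ) F)    ≡⟨ ∑-arrangements-∷ x ys F ⟨
    ∑ (arrangements (x ∷ ys)) F                  ∎
    where open ≡-Reasoning
  ∑-arrangements-↭ {xs = _ ∷ _ ∷ xs} {ys = _ ∷ _ ∷ ys} (swap x y p) F = begin
    ∑ (arrangements (x ∷ y ∷ xs)) F
      ≡⟨ expand x y xs ⟩
    ∑ (arrangements xs) (λ τ → ∑ (ins y τ) (λ σ → ∑ (ins x σ) F))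
      ≡⟨ ∑-ext (arrangements xs) (λ τ → ins-comm x y τ F) ⟩
    ∑ (arrangements xs) (λ τ → ∑ (ins x τ) (λ σ → ∑ (ins y σ) F))
      ≡⟨ ∑-arrangements-↭ p _ ⟩
    ∑ (arrangements ys) (λ τ → ∑ (ins x τ) (λ σ → ∑ (ins y σ) F))
      ≡⟨ expand y x ys ⟨
    ∑ (arrangements (y ∷ x ∷ ys)) F ∎
    where
    open ≡-Reasoning
    expand : ∀ x y xs → ∑ (arrangements (x ∷ y ∷ xs)) F ≡
             ∑ (arrangements xs) (λ τ → ∑ (ins y τ) (λ σ → ∑ (ins x σ) F))
    expand x y xs = ≡.trans (∑-arrangements-∷ x (y ∷ xs) F) (∑-arrangements-∷ y xs _)
  ∑-arrangements-↭ (trans p q) F = ≡.trans (∑-arrangements-↭ p F) (∑-arrangements-↭ q F)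

  _==_ : List ℕ → List ℕ → Bool
  xs == ys = ⌊ ≡-dec ℕ._≟_ xs ys ⌋

  -- As `x` does not occur in `τ`, an insertion of `x` begins with `x` only if it is made in front.
  -- Hence every entry of `t` has exactly one admissible place.
  ∑-arrangements-self : ∀ {t} → Unique t → ∀ F →
    ∑ (arrangements t) (λ τ → when (τ == t) (F τ)) ≡ F t
  ∑-arrangements-self {[]}    []        F = ℤₚ.+-identityʳ (F [])
  ∑-arrangements-self {x ∷ t} (x∉ ∷ ut) F = begin
    ∑ (arrangements (x ∷ t)) (λ τ → when (τ == (x ∷ t)) (F τ))
      ≡⟨ ∑-arrangements-∷ x t _ ⟩
    ∑ (arrangements t) (λ τ → ∑ (ins x τ) (λ σ → when (σ == (x ∷ t)) (F σ)))
      ≡⟨ ∑-cong (arrangements t) (λ τ τ∈ →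
           only-head τ (All-resp-↭ (↭-sym (∈-arrangements⇒↭ t τ∈)) x∉)) ⟩
    ∑ (arrangements t) (λ τ → when (τ == t) (F (x ∷ τ)))
      ≡⟨ ∑-arrangements-self ut (λ τ → F (x ∷ τ)) ⟩
    F (x ∷ t) ∎
    where
    open ≡-Reasoning
    head : ∀ τ → when ((x ∷ τ) == (x ∷ t)) (F (x ∷ τ)) ≡ when (τ == t) (F (x ∷ τ))
    head τ = cong (λ b → when b (F (x ∷ τ)))
      (⌊⌋-cong (≡-dec ℕ._≟_ (x ∷ τ) (x ∷ t)) (≡-dec ℕ._≟_ τ t) ∷-injectiveʳ (cong (x ∷_)))
    only-head : ∀ τ → All (x ≢_) τ →
      ∑ (ins x τ) (λ σ → when (σ == (x ∷ t)) (F σ)) ≡ when (τ == t) (F (x ∷ τ))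
    only-head []       _         = ≡.trans (ℤₚ.+-identityʳ _) (head [])
    only-head (z ∷ zs) (x≢z ∷ _) = begin
      ∑ (ins x (z ∷ zs)) (λ σ → when (σ == (x ∷ t)) (F σ))
        ≡⟨ ∑-ins-∷ x z zs (λ σ → when (σ == (x ∷ t)) (F σ)) ⟩
      when ((x ∷ z ∷ zs) == (x ∷ t)) (F (x ∷ z ∷ zs))
        + ∑ (ins x zs) (λ l → when ((z ∷ l) == (x ∷ t)) (F (z ∷ l)))
        ≡⟨ cong₂ _+_ (head (z ∷ zs)) (≡.trans (∑-ext (ins x zs) (λ l → cong (λ b → when b (F (z ∷ l)))
             (⌊⌋-false (≡-dec ℕ._≟_ (z ∷ l) (x ∷ t)) (λ e → x≢z (sym (∷-injectiveˡ e))))))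
             (∑-zero (ins x zs))) ⟩
      when ((z ∷ zs) == t) (F (x ∷ z ∷ zs)) + 0ℤ
        ≡⟨ ℤₚ.+-identityʳ _ ⟩
      when ((z ∷ zs) == t) (F (x ∷ z ∷ zs)) ∎

  -- Labeled lists

  labelings : ℕ → List A → List (List (ℕ × A))
  labelings m []       = [] ∷ []
  labelings m (x ∷ xs) = concatMap (λ a → map ((a , x) ∷_) (labelings m xs)) (downFrom m)

  ∑-labelings-∷ : ∀ m (x : A) xs F →
    ∑ (labelings m (x ∷ xs)) F ≡ ∑ (downFrom m) (λ a → ∑ (labelings m xs) (λ l → F ((a , x) ∷ l)))
  ∑-labelings-∷ m x xs F = ≡.trans (∑-concatMap _ (downFrom m) F)
    (∑-ext (downFrom m) λ a → ∑-map ((a , x) ∷_) (labelings m xs) F)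

  labelings-ins : ∀ m (x : A) σ F →
    ∑ (ins x σ) (λ σ′ → ∑ (labelings m σ′) F) ≡
    ∑ (downFrom m) (λ a → ∑ (labelings m σ) (λ l → ∑ (ins (a , x) l) F))
  labelings-ins m x []       F = ≡.trans (ℤₚ.+-identityʳ _) (≡.trans (∑-labelings-∷ m x [] F)
    (∑-ext (downFrom m) λ a → cong (_+ 0ℤ) (sym (ℤₚ.+-identityʳ (F ((a , x) ∷ []))))))
  labelings-ins m x (y ∷ ys) F = begin
    ∑ (ins x (y ∷ ys)) (λ σ′ → ∑ (labelings m σ′) F)
      ≡⟨ ∑-ins-∷ x y ys (λ σ′ → ∑ (labelings m σ′) F) ⟩
    ∑ (labelings m (x ∷ y ∷ ys)) F + ∑ (ins x ys) (λ l → ∑ (labelings m (y ∷ l)) F)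
      ≡⟨ cong₂ _+_ (∑-labelings-∷ m x (y ∷ ys) F) lemma ⟩
    ∑ D (λ a → ∑ (labelings m (y ∷ ys)) (λ l → F ((a , x) ∷ l)))
      + ∑ D (λ a → ∑ D (λ b → ∑ (labelings m ys) (λ l → ∑ (ins (a , x) l) (λ l′ → F ((b , y) ∷ l′)))))
      ≡⟨ ∑-+ D _ _ ⟨
    ∑ D (λ a → ∑ (labelings m (y ∷ ys)) (λ l → F ((a , x) ∷ l))
      + ∑ D (λ b → ∑ (labelings m ys) (λ l → ∑ (ins (a , x) l) (λ l′ → F ((b , y) ∷ l′)))))
      ≡⟨ ∑-ext D merge ⟩
    ∑ D (λ a → ∑ (labelings m (y ∷ ys)) (λ l → ∑ (ins (a , x) l) F)) ∎
    where
    open ≡-Reasoning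
    D = downFrom m
    lemma : ∑ (ins x ys) (λ l → ∑ (labelings m (y ∷ l)) F) ≡
      ∑ D (λ a → ∑ D (λ b → ∑ (labelings m ys) (λ l → ∑ (ins (a , x) l) (λ l′ → F ((b , y) ∷ l′)))))
    lemma = begin
      ∑ (ins x ys) (λ l → ∑ (labelings m (y ∷ l)) F)
        ≡⟨ ∑-ext (ins x ys) (λ l → ∑-labelings-∷ m y l F) ⟩
      ∑ (ins x ys) (λ l → ∑ D (λ b → ∑ (labelings m l) (λ l′ → F ((b , y) ∷ l′))))
        ≡⟨ ∑-swap (ins x ys) D _ ⟩
      ∑ D (λ b → ∑ (ins x ys) (λ l → ∑ (labelings m l) (λ l′ → F ((b , y) ∷ l′))))
        ≡⟨ ∑-ext D (λ b → labelings-ins m x ys (λ l′ → F ((b , y) ∷ l′))) ⟩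
      ∑ D (λ b → ∑ D (λ a → ∑ (labelings m ys) (λ l → ∑ (ins (a , x) l) (λ l′ → F ((b , y) ∷ l′)))))
        ≡⟨ ∑-swap D D _ ⟩
      _ ∎
    merge : ∀ a → ∑ (labelings m (y ∷ ys)) (λ l → F ((a , x) ∷ l))
        + ∑ D (λ b → ∑ (labelings m ys) (λ l → ∑ (ins (a , x) l) (λ l′ → F ((b , y) ∷ l′))))
      ≡ ∑ (labelings m (y ∷ ys)) (λ l → ∑ (ins (a , x) l) F)
    merge a = begin
      _ ≡⟨ cong (_+ ∑ D (λ b → ∑ (labelings m ys) (λ l → ∑ (ins (a , x) l) (λ l′ → F ((b , y) ∷ l′)))))
                (∑-labelings-∷ m y ys (λ l → F ((a , x) ∷ l))) ⟩
      _ ≡⟨ ∑-+ D (λ b → ∑ (labelings m ys) (λ l → F ((a , x) ∷ (b , y) ∷ l))) _ ⟨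
      ∑ D (λ b → ∑ (labelings m ys) (λ l → F ((a , x) ∷ (b , y) ∷ l))
        + ∑ (labelings m ys) (λ l → ∑ (ins (a , x) l) (λ l′ → F ((b , y) ∷ l′))))
        ≡⟨ ∑-ext D (λ b → sym (∑-+ (labelings m ys) _ _)) ⟩
      ∑ D (λ b → ∑ (labelings m ys) (λ l → F ((a , x) ∷ (b , y) ∷ l)
        + ∑ (ins (a , x) l) (λ l′ → F ((b , y) ∷ l′))))
        ≡⟨ ∑-ext D (λ b → ∑-ext (labelings m ys) (λ l → sym (∑-ins-∷ (a , x) (b , y) l F))) ⟩
      ∑ D (λ b → ∑ (labelings m ys) (λ l → ∑ (ins (a , x) ((b , y) ∷ l)) F))
        ≡⟨ ∑-labelings-∷ m y ys _ ⟨
      _ ∎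

  -- Labels travel with their entries. In the product of two counts this exchange fixes the labeled
  -- list first, after which the arrangement is determined by sorting.
  labelings-arrangements : ∀ m (xs : List A) F →
    ∑ (arrangements xs) (λ σ → ∑ (labelings m σ) F) ≡ ∑ (labelings m xs) (λ l → ∑ (arrangements l) F)
  labelings-arrangements m []       F = refl
  labelings-arrangements m (x ∷ xs) F = begin
    ∑ (arrangements (x ∷ xs)) (λ σ → ∑ (labelings m σ) F)
      ≡⟨ ∑-arrangements-∷ x xs _ ⟩
    ∑ (arrangements xs) (λ σ → ∑ (ins x σ) (λ σ′ → ∑ (labelings m σ′) F))
      ≡⟨ ∑-ext (arrangements xs) (λ σ → labelings-ins m x σ F) ⟩
    ∑ (arrangements xs) (λ σ → ∑ D (λ a → ∑ (labelings m σ) (λ l → ∑ (ins (a , x) l) F)))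
      ≡⟨ ∑-swap (arrangements xs) D _ ⟩
    ∑ D (λ a → ∑ (arrangements xs) (λ σ → ∑ (labelings m σ) (λ l → ∑ (ins (a , x) l) F)))
      ≡⟨ ∑-ext D (λ a → labelings-arrangements m xs (λ l → ∑ (ins (a , x) l) F)) ⟩
    ∑ D (λ a → ∑ (labelings m xs) (λ l → ∑ (arrangements l) (λ l′ → ∑ (ins (a , x) l′) F)))
      ≡⟨ ∑-ext D (λ a → ∑-ext (labelings m xs) (λ l → sym (∑-arrangements-∷ (a , x) l F))) ⟩
    ∑ D (λ a → ∑ (labelings m xs) (λ l → ∑ (arrangements ((a , x) ∷ l)) F))
      ≡⟨ ∑-labelings-∷ m x xs _ ⟨
    ∑ (labelings m (x ∷ xs)) (λ l → ∑ (arrangements l) F) ∎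
    where
    open ≡-Reasoning
    D = downFrom m

  -- Sorted arrangements

  Transitiveᵇ : (A → A → Bool) → Set
  Transitiveᵇ lt = ∀ x y z → lt x y ≡ true → lt y z ≡ true → lt x z ≡ true

  Comparable : (A → A → Bool) → A → A → Set
  Comparable lt x y = (lt x y ≡ true × lt y x ≡ false) ⊎ (lt x y ≡ false × lt y x ≡ true)

  -- Comparing the head with all later entries, rather than with the next one, makes the condition
  -- on the head invariant under rearrangement of the tail, as the insertion argument requires. For
  -- transitive orders `sorted-∷∷` recovers the comparison of neighbours.
  sorted : (A → A → Bool) → List A → Bool
  sorted lt []       = true
  sorted lt (x ∷ xs) = all (lt x) xs ∧ sorted lt xs

  ∧-true : ∀ a b → a ∧ b ≡ true → a ≡ true × b ≡ true
  ∧-true true b e = refl , e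

  all-↭ : ∀ (p : A → Bool) {xs ys} → xs ↭ ys → all p xs ≡ all p ys
  all-↭ p refl         = refl
  all-↭ p (prep x q)   = cong (p x ∧_) (all-↭ p q)
  all-↭ p (swap x y q) = ≡.trans (∧-swap (p x) (p y) _) (cong (λ b → p y ∧ (p x ∧ b)) (all-↭ p q))
    where
    ∧-swap : ∀ a b c → a ∧ (b ∧ c) ≡ b ∧ (a ∧ c)
    ∧-swap true  b     c = refl
    ∧-swap false true  c = refl
    ∧-swap false false c = refl
  all-↭ p (trans q r)  = ≡.trans (all-↭ p q) (all-↭ p r)

  all-trans : ∀ {lt : A → A → Bool} → Transitiveᵇ lt → ∀ {x y} → lt x y ≡ true →
              ∀ zs → all (lt y) zs ≡ true → all (lt x) zs ≡ true
  all-trans tr x<y []       _ = refl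
  all-trans {lt = lt} tr {x} {y} x<y (z ∷ zs) e with ∧-true (lt y z) _ e
  ... | y<z , e′ rewrite tr x y z x<y y<z = all-trans tr x<y zs e′

  -- If `x` is below `y`, all positions behind `y` are excluded and the front is valid by
  -- transitivity; otherwise the front is excluded and the tail decides. A sorted list thus has
  -- exactly one valid position, and an unsorted list has none.
  ∑-ins-sorted : ∀ {lt : A → A → Bool} → Transitiveᵇ lt → ∀ c x ys → All (Comparable lt x) ys →
    ∑ (ins x ys) (λ l → when (sorted lt l) c) ≡ when (sorted lt ys) c
  ∑-ins-sorted tr c x [] _ = ℤₚ.+-identityʳ c
  ∑-ins-sorted {lt = lt} tr c x (y ∷ ys) (xy ∷ xys) = begin
    ∑ (ins x (y ∷ ys)) (λ l → when (sorted lt l) c)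
      ≡⟨ ∑-ins-∷ x y ys (λ l → when (sorted lt l) c) ⟩
    first + ∑ (ins x ys) (λ l → when (all (lt y) l ∧ sorted lt l) c)
      ≡⟨ cong (_+_ first) (∑-cong (ins x ys) (λ l l∈ → ≡.trans (when-∧ (all (lt y) l) _ c)
           (cong (λ b → when b (when (sorted lt l) c)) (all-↭ (lt y) (∈-ins⇒↭ ys l∈))))) ⟩
    first + ∑ (ins x ys) (λ l → when (lt y x ∧ all (lt y) ys) (when (sorted lt l) c))
      ≡⟨ cong (_+_ first) (≡.trans (∑-when (ins x ys) (lt y x ∧ all (lt y) ys) _)
           (cong (when (lt y x ∧ all (lt y) ys)) (∑-ins-sorted tr c x ys xys))) ⟩
    first + when (lt y x ∧ all (lt y) ys) (when (sorted lt ys) c)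
      ≡⟨ cases xy ⟩
    when (all (lt y) ys ∧ sorted lt ys) c ∎
    where
    open ≡-Reasoning
    first = when ((lt x y ∧ all (lt x) ys) ∧ (all (lt y) ys ∧ sorted lt ys)) c
    cases : Comparable lt x y →
      first + when (lt y x ∧ all (lt y) ys) (when (sorted lt ys) c) ≡ when (all (lt y) ys ∧ sorted lt ys) c
    cases (inj₁ (x<y , y≮x)) rewrite x<y | y≮x with all (lt y) ys in e
    ... | true rewrite all-trans tr x<y ys e = ℤₚ.+-identityʳ _
    ... | false = ≡.trans (ℤₚ.+-identityʳ _) (≡.trans (when-∧ (all (lt x) ys) false c) (when-zero (all (lt x) ys)))
    cases (inj₂ (x≮y , y<x)) rewrite x≮y | y<x =
      ≡.trans (ℤₚ.+-identityˡ _) (sym (when-∧ (all (lt y) ys) (sorted lt ys) c))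

  ∑-arrangements-sorted : ∀ {lt : A → A → Bool} → Transitiveᵇ lt → ∀ c {l} → AllPairs (Comparable lt) l →
    ∑ (arrangements l) (λ l′ → when (sorted lt l′) c) ≡ c
  ∑-arrangements-sorted tr c {[]}    []       = ℤₚ.+-identityʳ c
  ∑-arrangements-sorted {lt = lt} tr c {x ∷ l} (x~ ∷ l~) = begin
    ∑ (arrangements (x ∷ l)) (λ l′ → when (sorted lt l′) c)
      ≡⟨ ∑-arrangements-∷ x l _ ⟩
    ∑ (arrangements l) (λ σ → ∑ (ins x σ) (λ l′ → when (sorted lt l′) c))
      ≡⟨ ∑-cong (arrangements l) (λ σ σ∈ →
           ∑-ins-sorted tr c x σ (All-resp-↭ (↭-sym (∈-arrangements⇒↭ l σ∈)) x~)) ⟩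
    ∑ (arrangements l) (λ σ → when (sorted lt σ) c)
      ≡⟨ ∑-arrangements-sorted tr c l~ ⟩
    c ∎
    where open ≡-Reasoning

  -- The order on labeled entries

  even : ℕ → Bool
  even zero    = true
  even (suc n) = not (even n)

  compatible : (A → A → Bool) → ℕ → A → A → Bool
  compatible lt i x y = if even i then lt x y else lt y x

  -- Labels decrease along a sorted labeled list.  A run of equal labels is increasing
  -- when the label is even and decreasing when it is odd.
  prec : (A → A → Bool) → ℕ × A → ℕ × A → Bool
  prec lt (i , x) (j , y) = ⌊ j ℕ.<? i ⌋ ∨ (⌊ i ℕ.≟ j ⌋ ∧ compatible lt i x y)

  module _ (lt : A → A → Bool) where

    prec-> : ∀ {i j} x y → j < i → prec lt (i , x) (j , y) ≡ true
    prec-> {i} {j} x y j<i rewrite ⌊⌋-true (j ℕ.<? i) j<i = refl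

    prec-≡ : ∀ i x y → prec lt (i , x) (i , y) ≡ compatible lt i x y
    prec-≡ i x y rewrite ⌊⌋-false (i ℕ.<? i) (ℕₚ.<-irrefl refl) | ⌊⌋-true (i ℕ.≟ i) refl = refl

    prec-< : ∀ {i j} x y → i < j → prec lt (i , x) (j , y) ≡ false
    prec-< {i} {j} x y i<j
      rewrite ⌊⌋-false (j ℕ.<? i) (ℕₚ.<-asym i<j) | ⌊⌋-false (i ℕ.≟ j) (ℕₚ.<⇒≢ i<j) = refl

    prec-true : ∀ i j x y → prec lt (i , x) (j , y) ≡ true →
                j < i ⊎ (i ≡ j × compatible lt i x y ≡ true)
    prec-true i j x y e with ℕₚ.<-cmp i j
    ... | tri< i<j _ _ with () ← ≡.trans (sym (prec-< x y i<j)) e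
    ... | tri≈ _ refl _ = inj₂ (refl , ≡.trans (sym (prec-≡ i x y)) e)
    ... | tri> _ _ j<i = inj₁ j<i

    compatible-trans : Transitiveᵇ lt → ∀ i → Transitiveᵇ (compatible lt i)
    compatible-trans tr i x y z p q with even i
    ... | true  = tr x y z p q
    ... | false = tr z y x q p

    prec-trans : Transitiveᵇ lt → Transitiveᵇ (prec lt)
    prec-trans tr (i , x) (j , y) (k , z) p q with prec-true i j x y p | prec-true j k y z q
    ... | inj₁ j<i        | inj₁ k<j        = prec-> x z (ℕₚ.<-trans k<j j<i)
    ... | inj₁ j<i        | inj₂ (refl , _) = prec-> x z j<i
    ... | inj₂ (refl , _) | inj₁ k<j        = prec-> x z k<j
    ... | inj₂ (refl , c) | inj₂ (refl , d) =
      ≡.trans (prec-≡ i x z) (compatible-trans tr i x y z c d)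

    prec-comparable : ∀ {x y} i j → Comparable lt x y → Comparable (prec lt) (i , x) (j , y)
    prec-comparable {x} {y} i j xy with ℕₚ.<-cmp i j
    ... | tri< i<j _ _ = inj₂ (prec-< x y i<j , prec-> y x i<j)
    ... | tri> _ _ j<i = inj₁ (prec-> x y j<i , prec-< y x j<i)
    ... | tri≈ _ refl _ rewrite prec-≡ i x y | prec-≡ i y x with even i | xy
    ...   | true  | _      = xy
    ...   | false | inj₁ (p , q) = inj₂ (q , p)
    ...   | false | inj₂ (p , q) = inj₁ (q , p)

    prec-irrefl : ∀ i x → lt x x ≡ false → prec lt (i , x) (i , x) ≡ false
    prec-irrefl i x e with even i | prec-≡ i x x
    ... | true  | p = ≡.trans p e
    ... | false | p = ≡.trans p e

  -- Counting sorted labelings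

  -- The number of sorted labelings in which the first entry `x` carries the label `i`. The next
  -- label is at most `i`, and equals `i` only if the run of that label may continue from `x` to
  -- `y`.
  firstLabel : (A → A → Bool) → A → List A → ℕ → ℤ
  firstLabel lt x []       i = 1ℤ
  firstLabel lt x (y ∷ ys) i =
    if compatible lt i x y then ∑ (downFrom (suc i)) (firstLabel lt y ys)
                           else ∑ (downFrom i) (firstLabel lt y ys)

  count : (A → A → Bool) → ℕ → List A → ℤ
  count lt m []       = 1ℤ
  count lt m (x ∷ xs) = ∑ (downFrom m) (firstLabel lt x xs)

  sorted-∷∷ : ∀ {lt : A → A → Bool} → Transitiveᵇ lt → ∀ x y l →
              sorted lt (x ∷ y ∷ l) ≡ lt x y ∧ sorted lt (y ∷ l)
  sorted-∷∷ {lt = lt} tr x y l with lt x y in x<y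
  ... | false = refl
  ... | true with all (lt y) l in e
  ...   | true rewrite all-trans tr x<y l e = refl
  ...   | false with all (lt x) l
  ...     | true  = refl
  ...     | false = refl

  -- Only the label `i` itself requires a comparison of entries: larger labels contribute nothing
  -- and smaller ones contribute fully.
  ∑-prec : ∀ (lt : A → A → Bool) {i m} → i < m → ∀ x y f →
    ∑ (downFrom m) (λ j → when (prec lt (i , x) (j , y)) (f j)) ≡
    (if compatible lt i x y then ∑ (downFrom (suc i)) f else ∑ (downFrom i) f)
  ∑-prec lt {i} {suc m} i<sm x y f with ℕₚ.<-cmp i m
  ... | tri< i<m _ _ rewrite prec-< lt x y i<m =
    ≡.trans (ℤₚ.+-identityˡ _) (∑-prec lt i<m x y f)
  ... | tri> _ _ m<i = ⊥-elim (ℕₚ.<-irrefl refl (ℕₚ.<-≤-trans m<i (ℕₚ.≤-pred i<sm)))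
  ... | tri≈ _ refl _ rewrite prec-≡ lt i x y = ≡.trans (cong (_+_ (when (compatible lt i x y) (f i))) below) cases
    where
    below : ∑ (downFrom i) (λ j → when (prec lt (i , x) (j , y)) (f j)) ≡ ∑ (downFrom i) f
    below = ∑-cong (downFrom i) λ j j∈ → cong (λ b → when b (f j)) (prec-> lt x y (∈-downFrom⁻ j∈))
    cases : when (compatible lt i x y) (f i) + ∑ (downFrom i) f ≡
            (if compatible lt i x y then ∑ (downFrom (suc i)) f else ∑ (downFrom i) f)
    cases with compatible lt i x y
    ... | true  = refl
    ... | false = ℤₚ.+-identityˡ _

  ∑-labelings-firstLabel : ∀ {lt : A → A → Bool} → Transitiveᵇ lt → ∀ m x ys {i} → i < m →
    ∑ (labelings m ys) (λ l → when (sorted (prec lt) ((i , x) ∷ l)) 1ℤ) ≡ firstLabel lt x ys i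
  ∑-labelings-firstLabel tr m x []       i<m = refl
  ∑-labelings-firstLabel {lt = lt} tr m x (y ∷ ys) {i} i<m = begin
    ∑ (labelings m (y ∷ ys)) (λ l → when (sorted (prec lt) ((i , x) ∷ l)) 1ℤ)
      ≡⟨ ∑-labelings-∷ m y ys _ ⟩
    ∑ (downFrom m) (λ j → ∑ (labelings m ys) (λ l → when (sorted (prec lt) ((i , x) ∷ (j , y) ∷ l)) 1ℤ))
      ≡⟨ ∑-cong (downFrom m) step ⟩
    ∑ (downFrom m) (λ j → when (prec lt (i , x) (j , y)) (firstLabel lt y ys j))
      ≡⟨ ∑-prec lt i<m x y (firstLabel lt y ys) ⟩
    firstLabel lt x (y ∷ ys) i ∎
    where
    open ≡-Reasoning
    step : ∀ j → j ∈ downFrom m →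
      ∑ (labelings m ys) (λ l → when (sorted (prec lt) ((i , x) ∷ (j , y) ∷ l)) 1ℤ) ≡
      when (prec lt (i , x) (j , y)) (firstLabel lt y ys j)
    step j j∈ = begin
      _ ≡⟨ ∑-ext (labelings m ys) (λ l → ≡.trans
             (cong (λ b → when b 1ℤ) (sorted-∷∷ (prec-trans lt tr) (i , x) (j , y) l))
             (when-∧ (prec lt (i , x) (j , y)) _ 1ℤ)) ⟩
      _ ≡⟨ ∑-when (labelings m ys) (prec lt (i , x) (j , y)) _ ⟩
      _ ≡⟨ cong (when (prec lt (i , x) (j , y))) (∑-labelings-firstLabel tr m y ys (∈-downFrom⁻ j∈)) ⟩
      _ ∎

  ∑-labelings-sorted : ∀ {lt : A → A → Bool} → Transitiveᵇ lt → ∀ m xs →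
    ∑ (labelings m xs) (λ l → when (sorted (prec lt) l) 1ℤ) ≡ count lt m xs
  ∑-labelings-sorted tr m []       = refl
  ∑-labelings-sorted {lt = lt} tr m (x ∷ xs) = ≡.trans (∑-labelings-∷ m x xs _)
    (∑-cong (downFrom m) λ i i∈ → ∑-labelings-firstLabel tr m x xs (∈-downFrom⁻ i∈))

  firstLabel-map : ∀ {lt : A → A → Bool} {lt′ : B → B → Bool} (f : A → B) x xs →
    (∀ a b → a ∈ x ∷ xs → b ∈ x ∷ xs → lt′ (f a) (f b) ≡ lt a b) →
    ∀ i → firstLabel lt′ (f x) (map f xs) i ≡ firstLabel lt x xs i
  firstLabel-map f x []       h i = refl
  firstLabel-map {lt = lt} {lt′} f x (y ∷ ys) h i
    rewrite h x y (here refl) (there (here refl)) | h y x (there (here refl)) (here refl)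
    with compatible lt i x y
  ... | true  = ∑-ext (downFrom (suc i)) (firstLabel-map f y ys λ a b a∈ b∈ → h a b (there a∈) (there b∈))
  ... | false = ∑-ext (downFrom i) (firstLabel-map f y ys λ a b a∈ b∈ → h a b (there a∈) (there b∈))

  -- Counts see entries only through comparisons. Together with `sorted-pos` this trades the
  -- positions of entries in a permutation for the labeled entries that the permutation sorts.
  count-map : ∀ {lt : A → A → Bool} {lt′ : B → B → Bool} (f : A → B) xs →
    (∀ a b → a ∈ xs → b ∈ xs → lt′ (f a) (f b) ≡ lt a b) →
    ∀ m → count lt′ m (map f xs) ≡ count lt m xs
  count-map f []       h m = refl
  count-map f (x ∷ xs) h m = ∑-ext (downFrom m) (firstLabel-map f x xs h)

  ∈-labelings-∷ : ∀ m (x : A) xs {l} → l ∈ labelings m (x ∷ xs) →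
    ∃ λ a → ∃ λ l′ → a < m × l′ ∈ labelings m xs × l ≡ (a , x) ∷ l′
  ∈-labelings-∷ m x xs l∈ =
    go (downFrom m) (λ a a∈ → ∈-downFrom⁻ a∈)
       (∈-concatMap⁻ (λ a → map ((a , x) ∷_) (labelings m xs)) l∈)
    where
    go : ∀ {l} as → (∀ a → a ∈ as → a < m) →
         Any.Any (λ a → l ∈ map ((a , x) ∷_) (labelings m xs)) as →
         ∃ λ a → ∃ λ l′ → a < m × l′ ∈ labelings m xs × l ≡ (a , x) ∷ l′
    go (a ∷ as) h (here p) with ∈-map⁻ ((a , x) ∷_) p
    ... | l′ , l′∈ , e = a , l′ , h a (here refl) , l′∈ , e
    go (a ∷ as) h (there p) = go as (λ a a∈ → h a (there a∈)) p

  labelings-proj₂ : ∀ m (xs : List A) {l} → l ∈ labelings m xs → map proj₂ l ≡ xs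
  labelings-proj₂ m []       (here refl) = refl
  labelings-proj₂ m (x ∷ xs) l∈ with ∈-labelings-∷ m x xs l∈
  ... | a , l′ , _ , l′∈ , refl = cong (x ∷_) (labelings-proj₂ m xs l′∈)

  labelings-bounded : ∀ m (xs : List A) {l} → l ∈ labelings m xs → All (λ p → proj₁ p < m) l
  labelings-bounded m []       (here refl) = []
  labelings-bounded m (x ∷ xs) l∈ with ∈-labelings-∷ m x xs l∈
  ... | a , l′ , a<m , l′∈ , refl = a<m ∷ labelings-bounded m xs l′∈

  -- Positions

  index : List ℕ → ℕ → ℕ
  index []       x = 0
  index (y ∷ ys) x = if ⌊ y ℕ.≟ x ⌋ then 0 else suc (index ys x)

  -- On a permutation this is the inverse σ⁻¹, counted from 1 to agree with `at`.
  pos : List ℕ → ℕ → ℕ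
  pos σ x = suc (index σ x)

  index-here : ∀ x xs → index (x ∷ xs) x ≡ 0
  index-here x xs rewrite ⌊⌋-true (x ℕ.≟ x) refl = refl

  index-there : ∀ {x y} ys → y ≢ x → index (y ∷ ys) x ≡ suc (index ys x)
  index-there {x} {y} ys y≢x rewrite ⌊⌋-false (y ℕ.≟ x) y≢x = refl

  at-pos : ∀ σ {x} → x ∈ σ → at σ (pos σ x) ≡ x
  at-pos (y ∷ ys) {x} x∈ with y ℕ.≟ x
  ... | yes y≡x = y≡x
  at-pos (y ∷ ys) {x} (here x≡y)  | no y≢x = ⊥-elim (y≢x (sym x≡y))
  at-pos (y ∷ ys) {x} (there x∈) | no y≢x = at-pos ys x∈

  at-∈ : ∀ σ {i} → i < length σ → at σ (suc i) ∈ σ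
  at-∈ (x ∷ xs) {zero}  _       = here refl
  at-∈ (x ∷ xs) {suc i} (s≤s p) = there (at-∈ xs p)

  index-at : ∀ {σ} → Unique σ → ∀ {i} → i < length σ → index σ (at σ (suc i)) ≡ i
  index-at {x ∷ xs} (x∉ ∷ u) {zero}  _       = index-here x xs
  index-at {x ∷ xs} (x∉ ∷ u) {suc i} (s≤s p) =
    ≡.trans (index-there xs (All.lookup x∉ (at-∈ xs p))) (cong suc (index-at u p))

  _<ᵇ_ : ℕ → ℕ → Bool
  x <ᵇ y = ⌊ x ℕ.<? y ⌋

  <ᵇ-true : ∀ {x y} → x < y → x <ᵇ y ≡ true
  <ᵇ-true {x} {y} = ⌊⌋-true (x ℕ.<? y)

  <ᵇ-false : ∀ {x y} → y ≤ x → x <ᵇ y ≡ false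
  <ᵇ-false {x} {y} y≤x = ⌊⌋-false (x ℕ.<? y) (ℕₚ.≤⇒≯ y≤x)

  <ᵇ-true⁻ : ∀ x y → x <ᵇ y ≡ true → x < y
  <ᵇ-true⁻ x y e with x ℕ.<? y
  ... | yes x<y = x<y

  <ᵇ-trans : Transitiveᵇ _<ᵇ_
  <ᵇ-trans x y z p q = <ᵇ-true (ℕₚ.<-trans (<ᵇ-true⁻ x y p) (<ᵇ-true⁻ y z q))

  <ᵇ-comparable : ∀ {x y} → x ≢ y → Comparable _<ᵇ_ x y
  <ᵇ-comparable {x} {y} x≢y with ℕₚ.<-cmp x y
  ... | tri< x<y _ _ = inj₁ (<ᵇ-true x<y , <ᵇ-false (ℕₚ.<⇒≤ x<y))
  ... | tri≈ _ x≡y _ = ⊥-elim (x≢y x≡y)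
  ... | tri> _ _ y<x = inj₂ (<ᵇ-false (ℕₚ.<⇒≤ y<x) , <ᵇ-true y<x)

  <ᵇ-irrefl : ∀ x → x <ᵇ x ≡ false
  <ᵇ-irrefl x = <ᵇ-false {x} {x} ℕₚ.≤-refl

  <ᵇ-suc : ∀ x y → suc x <ᵇ suc y ≡ x <ᵇ y
  <ᵇ-suc x y = ⌊⌋-cong (suc x ℕ.<? suc y) (x ℕ.<? y) ℕₚ.≤-pred s≤s

  all-∈ : ∀ (p : A → Bool) {xs x} → all p xs ≡ true → x ∈ xs → p x ≡ true
  all-∈ p {y ∷ ys} e (here refl) = proj₁ (∧-true (p y) _ e)
  all-∈ p {y ∷ ys} e (there x∈) = all-∈ p (proj₂ (∧-true (p y) _ e)) x∈

  -- In a sorted list earlier entries are below later ones, and transitivity with irreflexivity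
  -- excludes the converse relation. Distinct second components ensure that `index` finds the
  -- intended pair.
  sorted-pos : ∀ {≺ : ℕ × ℕ → ℕ × ℕ → Bool} → Transitiveᵇ ≺ → (∀ a → ≺ a a ≡ false) →
    ∀ l → Unique (map proj₂ l) → sorted ≺ l ≡ true → ∀ a b → a ∈ l → b ∈ l →
    pos (map proj₂ l) (proj₂ a) <ᵇ pos (map proj₂ l) (proj₂ b) ≡ ≺ a b
  sorted-pos {≺} tr irr (c ∷ l) (c∉ ∷ u) s a b a∈ b∈ with ∧-true (all (≺ c) l) _ s
  ... | c≺ , s′ = go a∈ b∈
    where
    x = proj₂ c
    xs = map proj₂ l
    there-pos : ∀ {d} → d ∈ l → index (x ∷ xs) (proj₂ d) ≡ suc (index xs (proj₂ d))
    there-pos d∈ = index-there xs (All.lookup c∉ (∈-map⁺ proj₂ d∈))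
    go : a ∈ c ∷ l → b ∈ c ∷ l → pos (x ∷ xs) (proj₂ a) <ᵇ pos (x ∷ xs) (proj₂ b) ≡ ≺ a b
    go (here refl) (here refl) = ≡.trans (<ᵇ-irrefl (pos (x ∷ xs) x)) (sym (irr c))
    go (here refl) (there b∈) =
      ≡.trans (cong₂ (λ i j → suc i <ᵇ suc j) (index-here x xs) (there-pos b∈))
              (≡.trans (<ᵇ-true {1} {suc (suc (index xs (proj₂ b)))} (s≤s (s≤s z≤n))) (sym (all-∈ (≺ c) c≺ b∈)))
    go (there a∈) (here refl) =
      ≡.trans (cong₂ (λ i j → suc i <ᵇ suc j) (there-pos a∈) (index-here x xs))
              (≡.trans (<ᵇ-false {suc (suc (index xs (proj₂ a)))} {1} (s≤s z≤n)) (sym a⊀c))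
      where
      a⊀c : ≺ a c ≡ false
      a⊀c with ≺ a c in e
      ... | false = refl
      ... | true with () ← ≡.trans (sym (tr c a c (all-∈ (≺ c) c≺ a∈) e)) (irr c)
    go (there a∈) (there b∈) =
      ≡.trans (cong₂ (λ i j → suc i <ᵇ suc j) (there-pos a∈) (there-pos b∈)) (≡.trans (<ᵇ-suc (pos xs (proj₂ a)) (pos xs (proj₂ b))) (sorted-pos tr irr l u s′ a b a∈ b∈))

  Unique-↭ : ∀ {xs ys : List A} → xs ↭ ys → Unique xs → Unique ys
  Unique-↭ refl         u                  = u
  Unique-↭ (prep x p)   (x∉ ∷ u)           = All-resp-↭ p x∉ ∷ Unique-↭ p u
  Unique-↭ (swap x y p) ((x≢y ∷ x∉) ∷ y∉ ∷ u) =
    ((λ y≡x → x≢y (sym y≡x)) ∷ All-resp-↭ p y∉) ∷ All-resp-↭ p x∉ ∷ Unique-↭ p u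
  Unique-↭ (trans p q)  u                  = Unique-↭ q (Unique-↭ p u)

  -- The heart of the product formula, where `map (pos σ) π` is σ⁻¹π. A labeling of `π` has exactly
  -- one sorted arrangement, whose entries form `σ`. Positions in this `σ` compare as the labeled
  -- entries do under `prec`, so the second factor counts the sorted labelings of an already labeled
  -- list.
  ∑-arrangements-count : ∀ M N {π} → Unique π →
    ∑ (arrangements π) (λ σ → count _<ᵇ_ M σ * count _<ᵇ_ N (map (pos σ) π)) ≡
    ∑ (labelings M π) (count (prec _<ᵇ_) N)
  ∑-arrangements-count M N {π} uπ = begin
    ∑ (arrangements π) (λ σ → count _<ᵇ_ M σ * count _<ᵇ_ N (map (pos σ) π))
      ≡⟨ ∑-ext (arrangements π) (λ σ → ≡.trans
           (cong (_* count _<ᵇ_ N (map (pos σ) π)) (sym (∑-labelings-sorted <ᵇ-trans M σ)))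
           (sym (∑-*ʳ (labelings M σ) _ _))) ⟩
    ∑ (arrangements π) (λ σ → ∑ (labelings M σ) (λ l → when (sorted ≺ l) 1ℤ * count _<ᵇ_ N (map (pos σ) π)))
      -- Replacing `σ` by the entries of its labeling makes the summand a function of the labeled
      -- list alone, as `labelings-arrangements` demands.
      ≡⟨ ∑-ext (arrangements π) (λ σ → ∑-cong (labelings M σ) (λ l l∈ →
           cong (λ τ → when (sorted ≺ l) 1ℤ * count _<ᵇ_ N (map (pos τ) π)) (sym (labelings-proj₂ M σ l∈)))) ⟩
    ∑ (arrangements π) (λ σ → ∑ (labelings M σ) F)
      ≡⟨ labelings-arrangements M π F ⟩
    ∑ (labelings M π) (λ l → ∑ (arrangements l) F)
      ≡⟨ ∑-cong (labelings M π) (λ l l∈ → ≡.trans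
           (∑-cong (arrangements l) (λ l′ l′∈ → F-sorted l (labelings-proj₂ M π l∈) l′ (∈-arrangements⇒↭ l l′∈)))
           (∑-arrangements-sorted ≺-trans (count ≺ N l) (comparable l (subst Unique (sym (labelings-proj₂ M π l∈)) uπ)))) ⟩
    ∑ (labelings M π) (count ≺ N) ∎
    where
    open ≡-Reasoning
    ≺ = prec _<ᵇ_
    ≺-trans = prec-trans _<ᵇ_ <ᵇ-trans
    F : List (ℕ × ℕ) → ℤ
    F l = when (sorted ≺ l) 1ℤ * count _<ᵇ_ N (map (pos (map proj₂ l)) π)
    comparable : ∀ l → Unique (map proj₂ l) → AllPairs (Comparable ≺) l
    comparable l u = AllPairs.map (λ {p} {q} x≢y → prec-comparable _<ᵇ_ (proj₁ p) (proj₁ q) (<ᵇ-comparable x≢y))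
                                  (AllPairsₚ.map⁻ u)
    F-sorted : ∀ l → map proj₂ l ≡ π → ∀ l′ → l′ ↭ l → F l′ ≡ when (sorted ≺ l′) (count ≺ N l)
    F-sorted l refl l′ p with sorted ≺ l′ in s
    ... | false = refl
    ... | true  = ≡.trans (ℤₚ.*-identityˡ _) (≡.trans (cong (count _<ᵇ_ N) (sym (map-∘ l)))
      (count-map (pos (map proj₂ l′) ∘ proj₂) l (λ a b a∈ b∈ →
        sorted-pos ≺-trans (λ { (i , x) → prec-irrefl _<ᵇ_ i x (<ᵇ-irrefl x) }) l′
          (Unique-↭ (map⁺ proj₂ (↭-sym p)) uπ) s a b (∈-resp-↭ (↭-sym p) a∈) (∈-resp-↭ (↭-sym p) b∈)) N))

  -- Products of alphabets

  -- The position of the pair (b , a), for a < M, when odd blocks are traversed backwards.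
  code : ℕ → ℕ → ℕ → ℕ
  code M b a = (if even b then a else M ∸ suc a) ℕ.+ b ℕ.* M

  even-+ : ∀ m n → even m ≡ true → even (m ℕ.+ n) ≡ even n
  even-+ zero          n e = refl
  even-+ (suc (suc m)) n e =
    ≡.trans (not-involutive _) (even-+ m n (≡.trans (sym (not-involutive (even m))) e))

  even-n+n : ∀ n → even (n ℕ.+ n) ≡ true
  even-n+n zero    = refl
  even-n+n (suc n) rewrite ℕₚ.+-suc n n = ≡.trans (not-involutive _) (even-n+n n)

  even-* : ∀ b M → even b ≡ true → even (b ℕ.* M) ≡ true
  even-* zero          M e = refl
  even-* (suc (suc b)) M e
    rewrite sym (ℕₚ.+-assoc M M (b ℕ.* M)) | even-+ (M ℕ.+ M) (b ℕ.* M) (even-n+n M) =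
    even-* b M (≡.trans (sym (not-involutive (even b))) e)

  even-code-even : ∀ M b a → even b ≡ true → even (a ℕ.+ b ℕ.* M) ≡ even a
  even-code-even M b a e rewrite ℕₚ.+-comm a (b ℕ.* M) = even-+ (b ℕ.* M) a (even-* b M e)

  -- Adding the even number `suc a + suc a` gives `suc b * M + suc a`, and `suc b` is even. Backward
  -- traversal of an odd block thus flips the parity of every label, for `M` of either parity.
  even-code-odd : ∀ M b a → a < M → even b ≡ false → even (M ∸ suc a ℕ.+ b ℕ.* M) ≡ not (even a)
  even-code-odd M b a a<M e = begin
    even c                            ≡⟨ even-+ (suc a ℕ.+ suc a) c (even-n+n (suc a)) ⟨
    even (suc a ℕ.+ suc a ℕ.+ c)      ≡⟨ cong even rearrange ⟩
    even (suc b ℕ.* M ℕ.+ suc a)      ≡⟨ even-+ (suc b ℕ.* M) (suc a) (even-* (suc b) M (cong not e)) ⟩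
    even (suc a)                      ∎
    where
    open ≡-Reasoning
    c = M ∸ suc a ℕ.+ b ℕ.* M
    rearrange : suc a ℕ.+ suc a ℕ.+ c ≡ suc b ℕ.* M ℕ.+ suc a
    rearrange = begin
      suc a ℕ.+ suc a ℕ.+ c                          ≡⟨ ℕₚ.+-assoc (suc a) (suc a) c ⟩
      suc a ℕ.+ (suc a ℕ.+ c)                        ≡⟨ ℕₚ.+-comm (suc a) _ ⟩
      suc a ℕ.+ c ℕ.+ suc a                          ≡⟨ cong (ℕ._+ suc a) (sym (ℕₚ.+-assoc (suc a) (M ∸ suc a) _)) ⟩
      suc a ℕ.+ (M ∸ suc a) ℕ.+ b ℕ.* M ℕ.+ suc a    ≡⟨ cong (λ z → z ℕ.+ b ℕ.* M ℕ.+ suc a) (ℕₚ.m+[n∸m]≡n a<M) ⟩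
      suc b ℕ.* M ℕ.+ suc a                          ∎

  code-< : ∀ M b a → a < M → code M b a < suc b ℕ.* M
  code-< M b a a<M = ℕₚ.+-monoˡ-< (b ℕ.* M) (digit (even b))
    where
    digit : ∀ t → (if t then a else M ∸ suc a) < M
    digit true  = a<M
    digit false = ℕₚ.∸-monoʳ-< {M} {suc a} {0} (s≤s z≤n) a<M

  code-mono-< : ∀ M {b b′} a a′ → b < b′ → a < M → code M b a < code M b′ a′
  code-mono-< M {b} {b′} a a′ b<b′ a<M = ℕₚ.<-≤-trans (code-< M b a a<M)
    (ℕₚ.≤-trans (ℕₚ.*-monoˡ-≤ M b<b′) (ℕₚ.m≤n+m (b′ ℕ.* M) _))

  -- In an odd block `code` reverses the order of the labels and, by `even-code-odd`, the direction
  -- of every run. These are precisely the two effects of exchanging the arguments of `prec`, so a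
  -- product of alternating alphabets is again alternating.
  prec-code : ∀ (lt : A → A → Bool) M b b′ {a a′} x x′ → a < M → a′ < M →
    prec lt (code M b a , x) (code M b′ a′ , x′) ≡ prec (prec lt) (b , a , x) (b′ , a′ , x′)
  prec-code lt M b b′ {a} {a′} x x′ a<M a′<M with ℕₚ.<-cmp b b′
  ... | tri< b<b′ _ _ = ≡.trans (prec-< lt x x′ (code-mono-< M a a′ b<b′ a<M))
                                (sym (prec-< (prec lt) (a , x) (a′ , x′) b<b′))
  ... | tri> _ _ b′<b = ≡.trans (prec-> lt x x′ (code-mono-< M a′ a b′<b a′<M))
                                (sym (prec-> (prec lt) (a , x) (a′ , x′) b′<b))
  ... | tri≈ _ refl _ = ≡.trans same (sym (prec-≡ (prec lt) b (a , x) (a′ , x′)))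
    where
    same : prec lt (code M b a , x) (code M b a′ , x′) ≡ compatible (prec lt) b (a , x) (a′ , x′)
    same with even b in eb | ℕₚ.<-cmp a a′
    ... | true | tri< a<a′ _ _ = ≡.trans (prec-< lt x x′ (ℕₚ.+-monoˡ-< (b ℕ.* M) a<a′)) (sym (prec-< lt x x′ a<a′))
    ... | true | tri> _ _ a′<a = ≡.trans (prec-> lt x x′ (ℕₚ.+-monoˡ-< (b ℕ.* M) a′<a)) (sym (prec-> lt x x′ a′<a))
    ... | true | tri≈ _ refl _ = begin
      prec lt (a ℕ.+ b ℕ.* M , x) (a ℕ.+ b ℕ.* M , x′) ≡⟨ prec-≡ lt (a ℕ.+ b ℕ.* M) x x′ ⟩
      compatible lt (a ℕ.+ b ℕ.* M) x x′
        ≡⟨ cong (λ t → if t then lt x x′ else lt x′ x) (even-code-even M b a eb) ⟩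
      compatible lt a x x′                             ≡⟨ prec-≡ lt a x x′ ⟨
      prec lt (a , x) (a , x′) ∎
      where open ≡-Reasoning
    same | false | tri< a<a′ _ _ =
      ≡.trans (prec-> lt x x′ (ℕₚ.+-monoˡ-< (b ℕ.* M) (ℕₚ.∸-monoʳ-< {M} (s≤s a<a′) a′<M))) (sym (prec-> lt x′ x a<a′))
    same | false | tri> _ _ a′<a =
      ≡.trans (prec-< lt x x′ (ℕₚ.+-monoˡ-< (b ℕ.* M) (ℕₚ.∸-monoʳ-< {M} (s≤s a′<a) a<M))) (sym (prec-< lt x′ x a′<a))
    same | false | tri≈ _ refl _ = begin
      prec lt (c , x) (c , x′)  ≡⟨ prec-≡ lt c x x′ ⟩
      compatible lt c x x′      ≡⟨ cong (λ t → if t then lt x x′ else lt x′ x) (even-code-odd M b a a<M eb) ⟩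
      (if not (even a) then lt x x′ else lt x′ x) ≡⟨ if-not (even a) ⟩
      compatible lt a x′ x      ≡⟨ prec-≡ lt a x′ x ⟨
      prec lt (a , x′) (a , x) ∎
      where
      open ≡-Reasoning
      c = M ∸ suc a ℕ.+ b ℕ.* M
      if-not : ∀ t → (if not t then lt x x′ else lt x′ x) ≡ (if t then lt x′ x else lt x x′)
      if-not true  = refl
      if-not false = refl

  ∑-downFrom-+ : ∀ m k (f : ℕ → ℤ) →
    ∑ (downFrom (m ℕ.+ k)) f ≡ ∑ (downFrom m) (λ a → f (a ℕ.+ k)) + ∑ (downFrom k) f
  ∑-downFrom-+ zero    k f = sym (ℤₚ.+-identityˡ _)
  ∑-downFrom-+ (suc m) k f =
    ≡.trans (cong (_+_ (f (m ℕ.+ k))) (∑-downFrom-+ m k f)) (sym (ℤₚ.+-assoc (f (m ℕ.+ k)) _ _))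

  ∑-downFrom-shift : ∀ m (f : ℕ → ℤ) → f 0 + ∑ (downFrom m) (λ a → f (suc a)) ≡ ∑ (downFrom (suc m)) f
  ∑-downFrom-shift zero    f = refl
  ∑-downFrom-shift (suc m) f = ≡.trans (swap-+ (f 0) (f (suc m)) _) (cong (_+_ (f (suc m))) (∑-downFrom-shift m f))
    where
    swap-+ : ∀ a b c → a + (b + c) ≡ b + (a + c)
    swap-+ = solve-∀

  ∑-downFrom-reverse : ∀ m (f : ℕ → ℤ) → ∑ (downFrom m) (λ a → f (m ∸ suc a)) ≡ ∑ (downFrom m) f
  ∑-downFrom-reverse zero    f = refl
  ∑-downFrom-reverse (suc m) f = begin
    f (m ∸ m) + ∑ (downFrom m) (λ a → f (m ∸ a))
      ≡⟨ cong₂ _+_ (cong f (ℕₚ.n∸n≡0 m))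
           (∑-cong (downFrom m) λ a a∈ → cong f (sym (ℕₚ.suc-pred (m ∸ a) {{ℕ.>-nonZero (ℕₚ.m<n⇒0<n∸m (∈-downFrom⁻ a∈))}}))) ⟩
    f 0 + ∑ (downFrom m) (λ a → f (suc (ℕ.pred (m ∸ a))))
      ≡⟨ cong (_+_ (f 0)) (∑-ext (downFrom m) λ a → cong (λ k → f (suc k)) (ℕₚ.pred[m∸n]≡m∸[1+n] m a)) ⟩
    f 0 + ∑ (downFrom m) (λ a → f (suc (m ∸ suc a)))
      ≡⟨ cong (_+_ (f 0)) (∑-downFrom-reverse m (λ a → f (suc a))) ⟩
    f 0 + ∑ (downFrom m) (λ a → f (suc a))
      ≡⟨ ∑-downFrom-shift m f ⟩
    ∑ (downFrom (suc m)) f ∎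
    where open ≡-Reasoning

  -- Each block of `M` codes is traversed completely, forwards or backwards, so the reversal of odd
  -- blocks is invisible to the sum.
  ∑-code : ∀ M N (f : ℕ → ℤ) →
    ∑ (downFrom N) (λ b → ∑ (downFrom M) (λ a → f (code M b a))) ≡ ∑ (downFrom (N ℕ.* M)) f
  ∑-code M zero    f = refl
  ∑-code M (suc N) f = ≡.trans (cong₂ _+_ block (∑-code M N f)) (sym (∑-downFrom-+ M (N ℕ.* M) f))
    where
    block : ∑ (downFrom M) (λ a → f (code M N a)) ≡ ∑ (downFrom M) (λ a → f (a ℕ.+ N ℕ.* M))
    block with even N
    ... | true  = refl
    ... | false = ∑-downFrom-reverse M (λ a → f (a ℕ.+ N ℕ.* M))

  recode : ℕ → ℕ × ℕ × A → ℕ × A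
  recode M (b , a , x) = code M b a , x

  ∑-recode : ∀ M N (xs : List A) F →
    ∑ (labelings M xs) (λ l → ∑ (labelings N l) (λ k → F (map (recode M) k))) ≡ ∑ (labelings (N ℕ.* M) xs) F
  ∑-recode M N []       F = ℤₚ.+-identityʳ _
  ∑-recode M N (x ∷ xs) F = begin
    ∑ (labelings M (x ∷ xs)) (λ l → ∑ (labelings N l) (λ k → F (map (recode M) k)))
      ≡⟨ ∑-labelings-∷ M x xs _ ⟩
    ∑ (downFrom M) (λ a → ∑ (labelings M xs) (λ l → ∑ (labelings N ((a , x) ∷ l)) (λ k → F (map (recode M) k))))
      ≡⟨ ∑-ext (downFrom M) (λ a → ∑-ext (labelings M xs) (λ l → ∑-labelings-∷ N (a , x) l _)) ⟩
    ∑ (downFrom M) (λ a → ∑ (labelings M xs) (λ l → ∑ (downFrom N) (λ b →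
      ∑ (labelings N l) (λ k → F ((code M b a , x) ∷ map (recode M) k)))))
      ≡⟨ ∑-ext (downFrom M) (λ a → ∑-swap (labelings M xs) (downFrom N) _) ⟩
    ∑ (downFrom M) (λ a → ∑ (downFrom N) (λ b → ∑ (labelings M xs) (λ l →
      ∑ (labelings N l) (λ k → F ((code M b a , x) ∷ map (recode M) k)))))
      ≡⟨ ∑-ext (downFrom M) (λ a → ∑-ext (downFrom N) (λ b → ∑-recode M N xs (λ k → F ((code M b a , x) ∷ k)))) ⟩
    ∑ (downFrom M) (λ a → ∑ (downFrom N) (λ b → ∑ (labelings (N ℕ.* M) xs) (λ k → F ((code M b a , x) ∷ k))))
      ≡⟨ ∑-swap (downFrom M) (downFrom N) _ ⟩
    ∑ (downFrom N) (λ b → ∑ (downFrom M) (λ a → ∑ (labelings (N ℕ.* M) xs) (λ k → F ((code M b a , x) ∷ k))))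
      ≡⟨ ∑-code M N (λ c → ∑ (labelings (N ℕ.* M) xs) (λ k → F ((c , x) ∷ k))) ⟩
    ∑ (downFrom (N ℕ.* M)) (λ c → ∑ (labelings (N ℕ.* M) xs) (λ k → F ((c , x) ∷ k)))
      ≡⟨ ∑-labelings-∷ (N ℕ.* M) x xs F ⟨
    ∑ (labelings (N ℕ.* M) (x ∷ xs)) F ∎
    where open ≡-Reasoning

  all-recode : ∀ (lt : A → A → Bool) M b {a} x k → a < M → All (λ p → proj₁ (proj₂ p) < M) k →
    all (prec lt (code M b a , x)) (map (recode M) k) ≡ all (prec (prec lt) (b , a , x)) k
  all-recode lt M b x []       a<M []         = refl
  all-recode lt M b x ((b′ , a′ , x′) ∷ k) a<M (a′<M ∷ k<) =
    cong₂ _∧_ (prec-code lt M b b′ x x′ a<M a′<M) (all-recode lt M b x k a<M k<)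

  sorted-recode : ∀ (lt : A → A → Bool) M k → All (λ p → proj₁ (proj₂ p) < M) k →
    sorted (prec lt) (map (recode M) k) ≡ sorted (prec (prec lt)) k
  sorted-recode lt M []       []         = refl
  sorted-recode lt M ((b , a , x) ∷ k) (a<M ∷ k<) =
    cong₂ _∧_ (all-recode lt M b x k a<M k<) (sorted-recode lt M k k<)

  -- A labeling of a labeled list gives every entry two labels; `recode` merges them into one label
  -- below `N * M` without changing which lists are sorted.
  ∑-labelings-count : ∀ {lt : A → A → Bool} → Transitiveᵇ lt → ∀ M N xs →
    ∑ (labelings M xs) (count (prec lt) N) ≡ count lt (N ℕ.* M) xs
  ∑-labelings-count {lt = lt} tr M N xs = begin
    ∑ (labelings M xs) (count (prec lt) N)
      ≡⟨ ∑-cong (labelings M xs) (λ l l∈ → ≡.trans (sym (∑-labelings-sorted (prec-trans lt tr) N l))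
           (∑-cong (labelings N l) (λ k k∈ → cong (λ b → when b 1ℤ) (sym (sorted-recode lt M k
             (Allₚ.map⁻ {f = proj₂} (subst (All _) (sym (labelings-proj₂ N l k∈)) (labelings-bounded M xs l∈)))))))) ⟩
    ∑ (labelings M xs) (λ l → ∑ (labelings N l) (λ k → when (sorted (prec lt) (map (recode M) k)) 1ℤ))
      ≡⟨ ∑-recode M N xs (λ k → when (sorted (prec lt) k) 1ℤ) ⟩
    ∑ (labelings (N ℕ.* M) xs) (λ k → when (sorted (prec lt) k) 1ℤ)
      ≡⟨ ∑-labelings-sorted tr (N ℕ.* M) xs ⟩
    count lt (N ℕ.* M) xs ∎
    where open ≡-Reasoning

  -- The group algebra of the symmetric group

  down : ℕ → List ℕ
  down zero    = []
  down (suc n) = suc n ∷ down n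

  insertions≡ins : ∀ x xs → insertions x xs ≡ ins x xs
  insertions≡ins x []       = refl
  insertions≡ins x (y ∷ ys) = cong (λ l → (x ∷ y ∷ ys) ∷ map (y ∷_) l) (insertions≡ins x ys)

  perms≡arrangements : ∀ n → perms n ≡ arrangements (down n)
  perms≡arrangements zero    = refl
  perms≡arrangements (suc n) = ≡.trans (cong (concatMap (insertions (suc n))) (perms≡arrangements n))
    (concatMap-cong (insertions≡ins (suc n)) (arrangements (down n)))

  ∈-perms⇒↭ : ∀ n {σ} → σ ∈ perms n → σ ↭ down n
  ∈-perms⇒↭ n σ∈ = ∈-arrangements⇒↭ (down n) (subst (_ ∈_) (perms≡arrangements n) σ∈)

  ∑-perms : ∀ n {π} → π ↭ down n → ∀ F → ∑ (perms n) F ≡ ∑ (arrangements π) F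
  ∑-perms n p F = ≡.trans (cong (λ l → ∑ l F) (perms≡arrangements n)) (∑-arrangements-↭ (↭-sym p) F)

  InRange : ℕ → ℕ → Set
  InRange n i = ∃ λ k → k < n × i ≡ suc k

  down-range : ∀ n → All (InRange n) (down n)
  down-range zero    = []
  down-range (suc n) = (n , ℕₚ.n<1+n n , refl) ∷ All.map (λ { (k , k<n , e) → k , ℕₚ.m<n⇒m<1+n k<n , e }) (down-range n)

  down-unique : ∀ n → Unique (down n)
  down-unique zero    = []
  down-unique (suc n) =
    All.map (λ { (k , k<n , refl) e → ℕₚ.<-irrefl (sym (ℕₚ.suc-injective e)) k<n }) (down-range n) ∷ down-unique n

  down-length : ∀ n → length (down n) ≡ n
  down-length zero    = refl
  down-length (suc n) = cong suc (down-length n)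

  ∈-perms-unique : ∀ n {σ} → σ ∈ perms n → Unique σ
  ∈-perms-unique n σ∈ = Unique-↭ (↭-sym (∈-perms⇒↭ n σ∈)) (down-unique n)

  ∈-perms-length : ∀ n {σ} → σ ∈ perms n → length σ ≡ n
  ∈-perms-length n σ∈ = ≡.trans (↭-length (∈-perms⇒↭ n σ∈)) (down-length n)

  ∈-perms-range : ∀ n {σ} → σ ∈ perms n → All (InRange n) σ
  ∈-perms-range n σ∈ = All-resp-↭ (↭-sym (∈-perms⇒↭ n σ∈)) (down-range n)

  down-↭ : ∀ n → down (suc n) ↭ 1 ∷ map suc (down n)
  down-↭ zero    = ↭-refl
  down-↭ (suc n) = trans (prep (suc (suc n)) (down-↭ n)) (swap (suc (suc n)) 1 ↭-refl)

  map-pos-self : ∀ {σ} → Unique σ → map (pos σ) σ ↭ down (length σ)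
  map-pos-self {[]}     []       = ↭-refl
  map-pos-self {x ∷ xs} (x∉ ∷ u) = trans
    (↭-reflexive (cong₂ _∷_ (cong suc (index-here x xs)) (≡.trans (shift xs x∉) (map-∘ xs))))
    (trans (prep 1 (map⁺ suc (map-pos-self u))) (↭-sym (down-↭ (length xs))))
    where
    shift : ∀ ys → All (x ≢_) ys → map (pos (x ∷ xs)) ys ≡ map (λ y → suc (pos xs y)) ys
    shift []       []        = refl
    shift (y ∷ ys) (x≢y ∷ q) = cong₂ _∷_ (cong suc (index-there xs x≢y)) (shift ys q)

  map-inverse : ∀ {f g : ℕ → ℕ} {xs} → All (λ x → f (g x) ≡ x) xs → map f (map g xs) ≡ xs
  map-inverse []       = refl
  map-inverse (e ∷ es) = cong₂ _∷_ e (map-inverse es)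

  -- In a group `σ ∘ₚ τ ≡ π` has the single solution σ⁻¹π, here `map (pos σ) π`. This turns the
  -- double sum of a convolution into a single one.
  ∑-quotient : ∀ n {σ π} → σ ∈ perms n → π ∈ perms n → ∀ F →
    ∑ (perms n) (λ τ → when ((σ ∘ₚ τ) == π) (F τ)) ≡ F (map (pos σ) π)
  ∑-quotient n {σ} {π} σ∈ π∈ F = begin
    ∑ (perms n) (λ τ → when ((σ ∘ₚ τ) == π) (F τ))
      ≡⟨ ∑-cong (perms n) (λ τ τ∈ → cong (λ b → when b (F τ))
           (⌊⌋-cong (≡-dec ℕ._≟_ (σ ∘ₚ τ) π) (≡-dec ℕ._≟_ τ t) (to τ∈) from)) ⟩
    ∑ (perms n) (λ τ → when (τ == t) (F τ))
      ≡⟨ ∑-perms n t↭ _ ⟩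
    ∑ (arrangements t) (λ τ → when (τ == t) (F τ))
      ≡⟨ ∑-arrangements-self (Unique-↭ (↭-sym t↭) (down-unique n)) F ⟩
    F t ∎
    where
    open ≡-Reasoning
    t = map (pos σ) π
    π↭σ : π ↭ σ
    π↭σ = trans (∈-perms⇒↭ n π∈) (↭-sym (∈-perms⇒↭ n σ∈))
    t↭ : t ↭ down n
    t↭ = trans (map⁺ (pos σ) π↭σ)
      (trans (map-pos-self (∈-perms-unique n σ∈)) (↭-reflexive (cong down (∈-perms-length n σ∈))))
    to : ∀ {τ} → τ ∈ perms n → σ ∘ₚ τ ≡ π → τ ≡ t
    to τ∈ refl = sym (map-inverse (All.map (λ { (k , k<n , refl) →
      cong suc (index-at (∈-perms-unique n σ∈) (ℕₚ.<-≤-trans k<n (ℕₚ.≤-reflexive (sym (∈-perms-length n σ∈))))) })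
      (∈-perms-range n τ∈)))
    from : ∀ {τ} → τ ≡ t → σ ∘ₚ τ ≡ π
    from refl = map-inverse (All.tabulate λ x∈ → at-pos σ (∈-resp-↭ π↭σ x∈))

  convolution : ℕ → (List ℕ → ℤ) → (List ℕ → ℤ) → List ℕ → ℤ
  convolution n f g π = ∑ (perms n) λ σ → ∑ (perms n) λ τ → when ((σ ∘ₚ τ) == π) (f σ * g τ)

  convolution-count : ∀ n M N {π} → π ∈ perms n →
    convolution n (count _<ᵇ_ M) (count _<ᵇ_ N) π ≡ count _<ᵇ_ (N ℕ.* M) π
  convolution-count n M N {π} π∈ = begin
    convolution n (count _<ᵇ_ M) (count _<ᵇ_ N) π
      ≡⟨ ∑-cong (perms n) (λ σ σ∈ → ∑-quotient n σ∈ π∈ (λ τ → count _<ᵇ_ M σ * count _<ᵇ_ N τ)) ⟩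
    ∑ (perms n) (λ σ → count _<ᵇ_ M σ * count _<ᵇ_ N (map (pos σ) π))
      ≡⟨ ∑-perms n (∈-perms⇒↭ n π∈) _ ⟩
    ∑ (arrangements π) (λ σ → count _<ᵇ_ M σ * count _<ᵇ_ N (map (pos σ) π))
      ≡⟨ ∑-arrangements-count M N (∈-perms-unique n π∈) ⟩
    ∑ (labelings M π) (count (prec _<ᵇ_) N)
      ≡⟨ ∑-labelings-count <ᵇ-trans M N π ⟩
    count _<ᵇ_ (N ℕ.* M) π ∎
    where open ≡-Reasoning

  -- Descents of signed lists

  ∑-signings-∷ : ∀ x xs F →
    ∑ (signings (x ∷ xs)) F ≡ ∑ (signings xs) (λ t → F (+ x ∷ t)) + ∑ (signings xs) (λ t → F (- + x ∷ t))
  ∑-signings-∷ x xs F = ≡.trans (∑-concatMap _ (signings xs) F)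
    (≡.trans (∑-ext (signings xs) λ t → cong (_+_ (F (+ x ∷ t))) (ℤₚ.+-identityʳ (F (- + x ∷ t)))) (∑-+ (signings xs) _ _))

  ∈-signings⇒abs : ∀ xs {s} → s ∈ signings xs → map ∣_∣ s ≡ xs
  ∈-signings⇒abs []       (here refl) = refl
  ∈-signings⇒abs (x ∷ xs) s∈ =
    go (signings xs) (λ t∈ → ∈-signings⇒abs xs t∈)
       (∈-concatMap⁻ (λ t → (+ x ∷ t) ∷ (- + x ∷ t) ∷ []) s∈)
    where
    go : ∀ {s} ts → (∀ {t} → t ∈ ts → map ∣_∣ t ≡ xs) →
         Any.Any (λ t → s ∈ (+ x ∷ t) ∷ (- + x ∷ t) ∷ []) ts → map ∣_∣ s ≡ x ∷ xs
    go (t ∷ ts) h (here (here refl))         = cong (x ∷_) (h (here refl))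
    go (t ∷ ts) h (here (there (here refl))) = cong₂ _∷_ (ℤₚ.∣-i∣≡∣i∣ (+ x)) (h (here refl))
    go (t ∷ ts) h (there p)                  = go ts (λ t∈ → h (there t∈)) p

  ∈-signings⇒length : ∀ xs {s} → s ∈ signings xs → length s ≡ length xs
  ∈-signings⇒length xs {s} s∈ = ≡.trans (sym (length-map ∣_∣ s)) (cong length (∈-signings⇒abs xs s∈))

  descents-< : ∀ {a b} t → b ℤ.< a → descents (a ∷ b ∷ t) ≡ suc (descents (b ∷ t))
  descents-< {a} {b} t b<a rewrite ⌊⌋-true (b ℤ.<? a) b<a = refl

  descents-≥ : ∀ {a b} t → a ℤ.≤ b → descents (a ∷ b ∷ t) ≡ descents (b ∷ t)
  descents-≥ {a} {b} t a≤b rewrite ⌊⌋-false (b ℤ.<? a) (ℤₚ.≤⇒≯ a≤b) = refl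

  descents-bound : ∀ a s → descents (a ∷ s) ≤ length s
  descents-bound a []      = z≤n
  descents-bound a (b ∷ s) with b ℤ.<? a
  ... | yes _ = s≤s (descents-bound b s)
  ... | no  _ = ℕₚ.m≤n⇒m≤1+n (descents-bound b s)

  -- The signings of `xs` behind a fixed signed entry `a`, which may be the initial 0. Three cases
  -- follow, with `a` between, above or below the two signed versions of the next entry.
  after : ℤ → List ℕ → (ℕ → ℤ) → ℤ
  after a xs f = ∑ (signings xs) (λ t → f (descents (a ∷ t)))

  desSum : List ℕ → (ℕ → ℤ) → ℤ
  desSum xs f = ∑ (signings xs) (λ s → f (#Des s))

  des⁺Sum : List ℕ → (ℕ → ℤ) → ℤ
  des⁺Sum xs f = ∑ (signings xs) (λ s → f (#Des⁺ s))

  des⁺Sum-∷ : ∀ x xs f → des⁺Sum (x ∷ xs) f ≡ after (+ x) xs f + after (- + x) xs f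
  des⁺Sum-∷ x xs f = ∑-signings-∷ x xs _

  private
    neg<pos : ∀ x y → x < y → - + y ℤ.< + x
    neg<pos x (suc y) _ = ℤ.-<+

    neg≤pos : ∀ x y → - + x ℤ.≤ + y
    neg≤pos zero    y = ℤ.+≤+ z≤n
    neg≤pos (suc x) y = ℤ.-≤+

    neg-mono : ∀ {x y} → x < y → - + y ℤ.< - + x
    neg-mono x<y = ℤₚ.neg-mono-< (ℤ.+<+ x<y)

  after-up : ∀ {a x xs} → a ℤ.≤ + x → - + x ℤ.< a → ∀ f →
    after a (x ∷ xs) f ≡ after (+ x) xs f + after (- + x) xs (f ∘ suc)
  after-up {a} {x} {xs} p q f = ≡.trans (∑-signings-∷ x xs _) (cong₂ _+_
    (∑-ext (signings xs) λ t → cong f (descents-≥ t p)) (∑-ext (signings xs) λ t → cong f (descents-< t q)))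

  after-high : ∀ {a x xs} → + x ℤ.< a → - + x ℤ.< a → ∀ f →
    after a (x ∷ xs) f ≡ des⁺Sum (x ∷ xs) (f ∘ suc)
  after-high {a} {x} {xs} p q f = ≡.trans (∑-signings-∷ x xs _) (≡.trans (cong₂ _+_
    (∑-ext (signings xs) λ t → cong f (descents-< t p)) (∑-ext (signings xs) λ t → cong f (descents-< t q)))
    (sym (des⁺Sum-∷ x xs (f ∘ suc))))

  after-low : ∀ {a x xs} → a ℤ.≤ + x → a ℤ.≤ - + x → ∀ f →
    after a (x ∷ xs) f ≡ des⁺Sum (x ∷ xs) f
  after-low {a} {x} {xs} p q f = ≡.trans (∑-signings-∷ x xs _) (≡.trans (cong₂ _+_
    (∑-ext (signings xs) λ t → cong f (descents-≥ t p)) (∑-ext (signings xs) λ t → cong f (descents-≥ t q)))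
    (sym (des⁺Sum-∷ x xs f)))

  desSum-∷ : ∀ {x} xs → 0 < x → ∀ f → desSum (x ∷ xs) f ≡ after (+ x) xs f + after (- + x) xs (f ∘ suc)
  desSum-∷ {x} xs 0<x = after-up {xs = xs} (ℤ.+≤+ z≤n) (neg<pos 0 x 0<x)

  -- Both signed versions of `x` lie between `- + y` and `+ y`, as 0 does, so the rest of the list
  -- behaves as it would at the start. The sign of `x` only decides the descent at 0.
  desSum-rise : ∀ {x y ys} → 0 < x → x < y → ∀ f →
    desSum (x ∷ y ∷ ys) f ≡ desSum (y ∷ ys) f + desSum (y ∷ ys) (f ∘ suc)
  desSum-rise {x} {y} {ys} 0<x x<y f = ≡.trans (desSum-∷ (y ∷ ys) 0<x f) (cong₂ _+_
    (≡.trans (after-up {xs = ys} (ℤ.+≤+ (ℕₚ.<⇒≤ x<y)) (neg<pos x y x<y) f) (sym (desSum-∷ ys 0<y f)))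
    (≡.trans (after-up {xs = ys} (neg≤pos x y) (neg-mono x<y) (f ∘ suc)) (sym (desSum-∷ ys 0<y (f ∘ suc)))))
    where 0<y = ℕₚ.<-trans 0<x x<y

  -- A positive `x` lies above both versions of `y` and forces a descent before `y`; a negative one
  -- lies below both and has its descent at 0 instead. Either way there is one additional descent.
  desSum-fall : ∀ {x y ys} → 0 < x → y < x → ∀ f →
    desSum (x ∷ y ∷ ys) f ≡ des⁺Sum (y ∷ ys) (f ∘ suc) + des⁺Sum (y ∷ ys) (f ∘ suc)
  desSum-fall {x} {y} {ys} 0<x y<x f = ≡.trans (desSum-∷ (y ∷ ys) 0<x f) (cong₂ _+_
    (after-high {xs = ys} (ℤ.+<+ y<x) (ℤₚ.≤-<-trans (neg≤pos y y) (ℤ.+<+ y<x)) f)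
    (after-low {xs = ys} (neg≤pos x y) (ℤₚ.<⇒≤ (neg-mono y<x)) (f ∘ suc)))

  des⁺Sum-rise : ∀ {x y ys} → 0 < x → x < y → ∀ f →
    des⁺Sum (x ∷ y ∷ ys) f ≡ desSum (y ∷ ys) f + desSum (y ∷ ys) f
  des⁺Sum-rise {x} {y} {ys} 0<x x<y f = ≡.trans (des⁺Sum-∷ x (y ∷ ys) f) (cong₂ _+_
    (≡.trans (after-up {xs = ys} (ℤ.+≤+ (ℕₚ.<⇒≤ x<y)) (neg<pos x y x<y) f) (sym (desSum-∷ ys 0<y f)))
    (≡.trans (after-up {xs = ys} (neg≤pos x y) (neg-mono x<y) f) (sym (desSum-∷ ys 0<y f))))
    where 0<y = ℕₚ.<-trans 0<x x<y

  des⁺Sum-fall : ∀ {x y ys} → 0 < x → y < x → ∀ f →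
    des⁺Sum (x ∷ y ∷ ys) f ≡ des⁺Sum (y ∷ ys) (f ∘ suc) + des⁺Sum (y ∷ ys) f
  des⁺Sum-fall {x} {y} {ys} 0<x y<x f = ≡.trans (des⁺Sum-∷ x (y ∷ ys) f) (cong₂ _+_
    (after-high {xs = ys} (ℤ.+<+ y<x) (ℤₚ.≤-<-trans (neg≤pos y y) (ℤ.+<+ y<x)) f)
    (after-low {xs = ys} (neg≤pos x y) (ℤₚ.<⇒≤ (neg-mono y<x)) f))

  -- Polynomials

  2ℤ : ℤ
  2ℤ = + 2

  -- The product t(t - 2)...(t - 2n + 2), which is 2ⁿ n! times the binomial coefficient of t/2 over
  -- n. Step 2 keeps its values at odd t integral.
  falling : ℕ → ℤ → ℤ
  falling zero    t = 1ℤ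
  falling (suc n) t = t * falling n (t - 2ℤ)

  falling-snoc : ∀ n t → falling (suc n) t ≡ falling n t * (t - 2ℤ * + n)
  falling-snoc zero    t = lemma t
    where
    lemma : ∀ t → t * 1ℤ ≡ 1ℤ * (t - 2ℤ * 0ℤ)
    lemma = solve-∀
  falling-snoc (suc n) t = ≡.trans (cong (t *_) (falling-snoc n (t - 2ℤ))) (lemma t (falling n (t - 2ℤ)) (+ n))
    where
    lemma : ∀ t f n → t * (f * (t - 2ℤ - 2ℤ * n)) ≡ t * f * (t - 2ℤ * (1ℤ + n))
    lemma = solve-∀

  -- Pascal's rule for these scaled binomial coefficients.
  falling-diff : ∀ n t → falling (suc n) (t + 2ℤ) ≡ falling (suc n) t + 2ℤ * + suc n * falling n t
  falling-diff n t = begin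
    (t + 2ℤ) * falling n (t + 2ℤ - 2ℤ)  ≡⟨ cong (λ u → (t + 2ℤ) * falling n u) (cancel t) ⟩
    (t + 2ℤ) * falling n t              ≡⟨ lemma t (falling n t) (+ n) ⟩
    falling n t * (t - 2ℤ * + n) + 2ℤ * (1ℤ + + n) * falling n t
      ≡⟨ cong (_+ 2ℤ * + suc n * falling n t) (falling-snoc n t) ⟨
    falling (suc n) t + 2ℤ * + suc n * falling n t ∎
    where
    open ≡-Reasoning
    cancel : ∀ t → t + 2ℤ - 2ℤ ≡ t
    cancel = solve-∀
    lemma : ∀ t f n → (t + 2ℤ) * f ≡ f * (t - 2ℤ * n) + 2ℤ * (1ℤ + n) * f
    lemma = solve-∀

  falling-zero : ∀ {m n} → m ≤ n → falling (suc n) (2ℤ * + m) ≡ 0ℤ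
  falling-zero {zero} {n} _ = ℤₚ.*-zeroˡ (falling n (2ℤ * 0ℤ - 2ℤ))
  falling-zero {suc m} {suc n} (s≤s m≤n) = ≡.trans
    (cong (2ℤ * + suc m *_) (≡.trans (cong (falling (suc n)) (lemma (+ m))) (falling-zero m≤n)))
    (ℤₚ.*-zeroʳ (2ℤ * + suc m))
    where
    lemma : ∀ m → 2ℤ * (1ℤ + m) - 2ℤ ≡ 2ℤ * m
    lemma = solve-∀

  rising : ℕ → ℤ → ℤ
  rising zero    t = 1ℤ
  rising (suc m) t = (t + 2ℤ * + suc m) * rising m t

  falling-rising : ∀ m d t → falling (m ℕ.+ d) (t + 2ℤ * + m) ≡ rising m t * falling d t
  falling-rising zero    d t = ≡.trans (cong (falling d) (lemma t)) (sym (ℤₚ.*-identityˡ _))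
    where
    lemma : ∀ t → t + 2ℤ * 0ℤ ≡ t
    lemma = solve-∀
  falling-rising (suc m) d t = begin
    (t + 2ℤ * + suc m) * falling (m ℕ.+ d) (t + 2ℤ * + suc m - 2ℤ)
      ≡⟨ cong (λ u → (t + 2ℤ * + suc m) * falling (m ℕ.+ d) u) (lemma t (+ m)) ⟩
    (t + 2ℤ * + suc m) * falling (m ℕ.+ d) (t + 2ℤ * + m)
      ≡⟨ cong ((t + 2ℤ * + suc m) *_) (falling-rising m d t) ⟩
    (t + 2ℤ * + suc m) * (rising m t * falling d t)
      ≡⟨ ℤₚ.*-assoc (t + 2ℤ * + suc m) _ _ ⟨
    rising (suc m) t * falling d t ∎
    where
    open ≡-Reasoning
    lemma : ∀ t m → t + 2ℤ * (1ℤ + m) - 2ℤ ≡ t + 2ℤ * m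
    lemma = solve-∀

  fallingAt : ℕ → ℤ → ℕ → ℤ
  fallingAt n t d = falling n (t - 2ℤ * + d)

  fallingAt-suc : ∀ n t d → fallingAt n (t + 2ℤ) (suc d) ≡ fallingAt n t d
  fallingAt-suc n t d = cong (falling n) (lemma t (+ d))
    where
    lemma : ∀ t d → t + 2ℤ - 2ℤ * (1ℤ + d) ≡ t - 2ℤ * d
    lemma = solve-∀

  fallingAt-diff : ∀ n t d →
    fallingAt (suc n) (t + 2ℤ) d ≡ fallingAt (suc n) t d + 2ℤ * + suc n * fallingAt n t d
  fallingAt-diff n t d = ≡.trans (cong (falling (suc n)) (lemma t (+ d))) (falling-diff n (t - 2ℤ * + d))
    where
    lemma : ∀ t d → t + 2ℤ - 2ℤ * d ≡ t - 2ℤ * d + 2ℤ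
    lemma = solve-∀

  -- Descent polynomials and their recurrences

  desPoly : List ℕ → ℤ → ℤ
  desPoly xs t = desSum xs (fallingAt (length xs) t)

  des⁺Poly : List ℕ → ℤ → ℤ
  des⁺Poly xs t = des⁺Sum xs (fallingAt (length xs) t)

  ∑-fallingAt-diff : ∀ {A : Set} (ss : List A) (g : A → ℕ) n t →
    ∑ ss (λ s → fallingAt (suc n) (t + 2ℤ) (g s)) ≡
    ∑ ss (λ s → fallingAt (suc n) t (g s)) + 2ℤ * + suc n * ∑ ss (λ s → fallingAt n t (g s))
  ∑-fallingAt-diff ss g n t = ≡.trans (∑-ext ss λ s → fallingAt-diff n t (g s))
    (≡.trans (∑-+ ss _ _) (cong (_+_ (∑ ss (λ s → fallingAt (suc n) t (g s))))
      (∑-*ˡ ss (2ℤ * + suc n) (λ s → fallingAt n t (g s)))))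

  module _ {x y : ℕ} (ys : List ℕ) (0<x : 0 < x) (t : ℤ) where
    private
      n = length (y ∷ ys)
      c = 2ℤ * + suc n
      D D⁺ : ℤ → ℤ
      D u  = desSum (y ∷ ys) (fallingAt (suc n) u)
      D⁺ u = des⁺Sum (y ∷ ys) (fallingAt (suc n) u)
      desSum-shift : ∀ u → desSum (y ∷ ys) (fallingAt (suc n) (u + 2ℤ) ∘ suc) ≡ D u
      desSum-shift u = ∑-ext (signings (y ∷ ys)) λ s → fallingAt-suc (suc n) u (#Des s)
      des⁺Sum-shift : ∀ u → des⁺Sum (y ∷ ys) (fallingAt (suc n) (u + 2ℤ) ∘ suc) ≡ D⁺ u
      des⁺Sum-shift u = ∑-ext (signings (y ∷ ys)) λ s → fallingAt-suc (suc n) u (#Des⁺ s)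
      D-diff : ∀ u → D (u + 2ℤ) ≡ D u + c * desPoly (y ∷ ys) u
      D-diff u = ∑-fallingAt-diff (signings (y ∷ ys)) #Des n u
      D⁺-diff : ∀ u → D⁺ (u + 2ℤ) ≡ D⁺ u + c * des⁺Poly (y ∷ ys) u
      D⁺-diff u = ∑-fallingAt-diff (signings (y ∷ ys)) #Des⁺ n u
      restore : t ≡ t - 2ℤ + 2ℤ
      restore = lemma t
        where
        lemma : ∀ t → t ≡ t - 2ℤ + 2ℤ
        lemma = solve-∀
      reassoc₁ : ∀ a b → (a + b) + a ≡ (a + a) + b
      reassoc₁ = solve-∀
      reassoc₂ : ∀ a b → (a + b) + (a + b) ≡ ((a + b) + a) + b
      reassoc₂ = solve-∀
      reassoc₃ : ∀ a b → a + (a + b) ≡ (a + a) + b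
      reassoc₃ = solve-∀

    -- In the sequence `des⁺Poly` at t, `desPoly` at t + 2, `des⁺Poly` at t + 2, each value exceeds
    -- the last by a multiple of a polynomial of the tail. The four identities of this kind mirror
    -- the addition of one letter to an alphabet; they combine Pascal's rule with the recurrences
    -- for rises and falls.
    desPoly-rise : x < y →
      desPoly (x ∷ y ∷ ys) (t + 2ℤ) ≡ des⁺Poly (x ∷ y ∷ ys) t + c * desPoly (y ∷ ys) t
    desPoly-rise x<y = begin
      desPoly (x ∷ y ∷ ys) (t + 2ℤ)
        ≡⟨ desSum-rise {x} {y} {ys} 0<x x<y (fallingAt (suc n) (t + 2ℤ)) ⟩
      D (t + 2ℤ) + desSum (y ∷ ys) (fallingAt (suc n) (t + 2ℤ) ∘ suc)
        ≡⟨ cong₂ _+_ (D-diff t) (desSum-shift t) ⟩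
      (D t + c * desPoly (y ∷ ys) t) + D t
        ≡⟨ reassoc₁ (D t) _ ⟩
      (D t + D t) + c * desPoly (y ∷ ys) t
        ≡⟨ cong (_+ c * desPoly (y ∷ ys) t) (des⁺Sum-rise {x} {y} {ys} 0<x x<y (fallingAt (suc n) t)) ⟨
      des⁺Poly (x ∷ y ∷ ys) t + c * desPoly (y ∷ ys) t ∎
      where open ≡-Reasoning

    des⁺Poly-rise : x < y →
      des⁺Poly (x ∷ y ∷ ys) (t + 2ℤ) ≡ desPoly (x ∷ y ∷ ys) (t + 2ℤ) + c * desPoly (y ∷ ys) t
    des⁺Poly-rise x<y = begin
      des⁺Poly (x ∷ y ∷ ys) (t + 2ℤ)
        ≡⟨ des⁺Sum-rise {x} {y} {ys} 0<x x<y (fallingAt (suc n) (t + 2ℤ)) ⟩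
      D (t + 2ℤ) + D (t + 2ℤ)
        ≡⟨ cong₂ _+_ (D-diff t) (D-diff t) ⟩
      (D t + c * desPoly (y ∷ ys) t) + (D t + c * desPoly (y ∷ ys) t)
        ≡⟨ reassoc₂ (D t) _ ⟩
      ((D t + c * desPoly (y ∷ ys) t) + D t) + c * desPoly (y ∷ ys) t
        ≡⟨ cong (_+ c * desPoly (y ∷ ys) t) (cong₂ _+_ (D-diff t) (desSum-shift t)) ⟨
      (D (t + 2ℤ) + desSum (y ∷ ys) (fallingAt (suc n) (t + 2ℤ) ∘ suc)) + c * desPoly (y ∷ ys) t
        ≡⟨ cong (_+ c * desPoly (y ∷ ys) t) (desSum-rise {x} {y} {ys} 0<x x<y (fallingAt (suc n) (t + 2ℤ))) ⟨
      desPoly (x ∷ y ∷ ys) (t + 2ℤ) + c * desPoly (y ∷ ys) t ∎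
      where open ≡-Reasoning

    desPoly-fall : y < x →
      desPoly (x ∷ y ∷ ys) (t + 2ℤ) ≡ des⁺Poly (x ∷ y ∷ ys) t + c * des⁺Poly (y ∷ ys) (t - 2ℤ)
    desPoly-fall y<x = begin
      desPoly (x ∷ y ∷ ys) (t + 2ℤ)
        ≡⟨ desSum-fall {x} {y} {ys} 0<x y<x (fallingAt (suc n) (t + 2ℤ)) ⟩
      des⁺Sum (y ∷ ys) (fallingAt (suc n) (t + 2ℤ) ∘ suc) + des⁺Sum (y ∷ ys) (fallingAt (suc n) (t + 2ℤ) ∘ suc)
        ≡⟨ cong₂ _+_ (des⁺Sum-shift t) (des⁺Sum-shift t) ⟩
      D⁺ t + D⁺ t
        ≡⟨ cong (_+ D⁺ t) low ⟩
      (D⁺ (t - 2ℤ) + e) + D⁺ t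
        ≡⟨ lemma (D⁺ (t - 2ℤ)) e (D⁺ t) ⟩
      (D⁺ (t - 2ℤ) + D⁺ t) + e
        ≡⟨ cong (λ z → (z + D⁺ t) + e) (≡.trans
             (cong (λ u → des⁺Sum (y ∷ ys) (fallingAt (suc n) u ∘ suc)) restore) (des⁺Sum-shift (t - 2ℤ))) ⟨
      (des⁺Sum (y ∷ ys) (fallingAt (suc n) t ∘ suc) + D⁺ t) + e
        ≡⟨ cong (_+ e) (des⁺Sum-fall {x} {y} {ys} 0<x y<x (fallingAt (suc n) t)) ⟨
      des⁺Poly (x ∷ y ∷ ys) t + e ∎
      where
      open ≡-Reasoning
      e = c * des⁺Poly (y ∷ ys) (t - 2ℤ)
      low : D⁺ t ≡ D⁺ (t - 2ℤ) + e
      low = ≡.trans (cong D⁺ restore) (D⁺-diff (t - 2ℤ))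
      lemma : ∀ a b d → (a + b) + d ≡ (a + d) + b
      lemma = solve-∀

    des⁺Poly-fall : y < x →
      des⁺Poly (x ∷ y ∷ ys) (t + 2ℤ) ≡ desPoly (x ∷ y ∷ ys) (t + 2ℤ) + c * des⁺Poly (y ∷ ys) t
    des⁺Poly-fall y<x = begin
      des⁺Poly (x ∷ y ∷ ys) (t + 2ℤ)
        ≡⟨ des⁺Sum-fall {x} {y} {ys} 0<x y<x (fallingAt (suc n) (t + 2ℤ)) ⟩
      des⁺Sum (y ∷ ys) (fallingAt (suc n) (t + 2ℤ) ∘ suc) + D⁺ (t + 2ℤ)
        ≡⟨ cong₂ _+_ (des⁺Sum-shift t) (D⁺-diff t) ⟩
      D⁺ t + (D⁺ t + e)
        ≡⟨ reassoc₃ (D⁺ t) e ⟩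
      (D⁺ t + D⁺ t) + e
        ≡⟨ cong (_+ e) (cong₂ _+_ (des⁺Sum-shift t) (des⁺Sum-shift t)) ⟨
      (des⁺Sum (y ∷ ys) (fallingAt (suc n) (t + 2ℤ) ∘ suc) + des⁺Sum (y ∷ ys) (fallingAt (suc n) (t + 2ℤ) ∘ suc)) + e
        ≡⟨ cong (_+ e) (desSum-fall {x} {y} {ys} 0<x y<x (fallingAt (suc n) (t + 2ℤ))) ⟨
      desPoly (x ∷ y ∷ ys) (t + 2ℤ) + e ∎
      where
      open ≡-Reasoning
      e = c * des⁺Poly (y ∷ ys) t

  -- Numbers of sorted labelings as values of descent polynomials

  Admissible : List ℕ → Set
  Admissible xs = All (0 <_) xs × Linked _≢_ xs

  double : ℕ → ℕ
  double zero    = zero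
  double (suc k) = suc (suc (double k))

  double≡2* : ∀ k → + double k ≡ 2ℤ * + k
  double≡2* zero    = refl
  double≡2* (suc k) = ≡.trans (cong (λ z → 1ℤ + (1ℤ + z)) (double≡2* k)) (lemma (+ k))
    where
    lemma : ∀ k → 1ℤ + (1ℤ + 2ℤ * k) ≡ 2ℤ * (1ℤ + k)
    lemma = solve-∀

  even-double : ∀ k → even (double k) ≡ true
  even-double zero    = refl
  even-double (suc k) = ≡.trans (not-involutive _) (even-double k)

  scale : ℕ → ℤ
  scale zero    = 1ℤ
  scale (suc n) = 2ℤ * + suc n * scale n

  -- The value for the empty alphabet, where the induction on letters starts. Each argument is 2(n -
  -- d) with 0 ≤ d ≤ n, a root of `falling (suc n)`.
  des⁺Poly-zero : ∀ x xs → des⁺Poly (x ∷ xs) (2ℤ * + length xs) ≡ 0ℤ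
  des⁺Poly-zero x xs = ≡.trans (∑-cong (signings (x ∷ xs)) vanish) (∑-zero (signings (x ∷ xs)))
    where
    n = length xs
    vanish : ∀ s → s ∈ signings (x ∷ xs) → fallingAt (suc n) (2ℤ * + n) (#Des⁺ s) ≡ 0ℤ
    vanish [] s∈ with () ← ∈-signings⇒length (x ∷ xs) s∈
    vanish (a ∷ s) s∈ = ≡.trans (cong (falling (suc n)) arg) (falling-zero (ℕₚ.m∸n≤m n d))
      where
      d = descents (a ∷ s)
      d≤n : d ≤ n
      d≤n = ℕₚ.≤-trans (descents-bound a s) (ℕₚ.≤-reflexive (ℕₚ.suc-injective (∈-signings⇒length (x ∷ xs) s∈)))
      lemma : ∀ a b → 2ℤ * (a + b) - 2ℤ * b ≡ 2ℤ * a
      lemma = solve-∀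
      arg : 2ℤ * + n - 2ℤ * + d ≡ 2ℤ * + (n ∸ d)
      arg = ≡.trans (cong (λ z → 2ℤ * + z - 2ℤ * + d) (sym (ℕₚ.m∸n+n≡m d≤n))) (lemma (+ (n ∸ d)) (+ d))

  point : ℕ → ℕ → ℤ
  point k n = 2ℤ * + k + 2ℤ * + n

  point-sucʳ : ∀ k n → point k (suc n) ≡ point k n + 2ℤ
  point-sucʳ k n = lemma (+ k) (+ n)
    where
    lemma : ∀ k n → 2ℤ * k + 2ℤ * (1ℤ + n) ≡ 2ℤ * k + 2ℤ * n + 2ℤ
    lemma = solve-∀

  point-suc-suc : ∀ k n → point (suc k) (suc n) - 2ℤ ≡ point k n + 2ℤ
  point-suc-suc k n = lemma (+ k) (+ n)
    where
    lemma : ∀ k n → 2ℤ * (1ℤ + k) + 2ℤ * (1ℤ + n) - 2ℤ ≡ 2ℤ * k + 2ℤ * n + 2ℤ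
    lemma = solve-∀

  if-true : ∀ {b} {u v : ℤ} → b ≡ true → (if b then u else v) ≡ u
  if-true refl = refl

  if-false : ∀ {b} {u v : ℤ} → b ≡ false → (if b then u else v) ≡ v
  if-false refl = refl

  firstLabel-even : ∀ x y ys k → firstLabel _<ᵇ_ x (y ∷ ys) (double k) ≡
    (if x <ᵇ y then count _<ᵇ_ (suc (double k)) (y ∷ ys) else count _<ᵇ_ (double k) (y ∷ ys))
  firstLabel-even x y ys k rewrite even-double k = refl

  firstLabel-odd : ∀ x y ys k → firstLabel _<ᵇ_ x (y ∷ ys) (suc (double k)) ≡
    (if y <ᵇ x then count _<ᵇ_ (double (suc k)) (y ∷ ys) else count _<ᵇ_ (suc (double k)) (y ∷ ys))
  firstLabel-odd x y ys k rewrite even-double k = refl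

  -- The coefficient form of two generating functions for nonempty lists of length n: the series in
  -- tᵏ of the counts for 2k + 1 letters is Σ t^#Des over (1 - t)^(n + 1), and that for 2k letters
  -- is t Σ t^#Des⁺ over the same power. The coefficients are the binomials of k + n - d and of k +
  -- n - 1 - d over n, whence `point` and the shift by 2.
  CountLaw : List ℕ → Set
  CountLaw xs = ∀ k →
    scale (length xs) * count _<ᵇ_ (suc (double k)) xs ≡ desPoly xs (point k (length xs)) ×
    scale (length xs) * count _<ᵇ_ (double k) xs ≡ des⁺Poly xs (point k (length xs) - 2ℤ)

  module _ (x : ℕ) (xs : List ℕ)
    (odd-step : ∀ k →
      desPoly (x ∷ xs) (point k (length xs) + 2ℤ) ≡
      des⁺Poly (x ∷ xs) (point k (length xs)) +
        2ℤ * + suc (length xs) * (scale (length xs) * firstLabel _<ᵇ_ x xs (double k)))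
    (even-step : ∀ k →
      des⁺Poly (x ∷ xs) (point k (length xs) + 2ℤ) ≡
      desPoly (x ∷ xs) (point k (length xs) + 2ℤ) +
        2ℤ * + suc (length xs) * (scale (length xs) * firstLabel _<ᵇ_ x xs (suc (double k))))
    where
    private
      n = length xs
      K = scale (suc n)
      C = λ m → count _<ᵇ_ m (x ∷ xs)
      cancel : ∀ t → t + 2ℤ - 2ℤ ≡ t
      cancel = solve-∀
      collect : ∀ c s f g p → c * s * g ≡ p → c * s * (f + g) ≡ p + c * (s * f)
      collect c s f g p refl = lemma c s f g
        where
        lemma : ∀ c s f g → c * s * (f + g) ≡ c * s * g + c * (s * f)
        lemma = solve-∀

      odd-case : ∀ k → K * C (double k) ≡ des⁺Poly (x ∷ xs) (point k (suc n) - 2ℤ) →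
                 K * C (suc (double k)) ≡ desPoly (x ∷ xs) (point k (suc n))
      odd-case k e = begin
        K * C (suc (double k))
          ≡⟨ collect (2ℤ * + suc n) (scale n) (firstLabel _<ᵇ_ x xs (double k)) (C (double k)) _
               (≡.trans e (cong (des⁺Poly (x ∷ xs)) (≡.trans (cong (_- 2ℤ) (point-sucʳ k n)) (cancel (point k n))))) ⟩
        des⁺Poly (x ∷ xs) (point k n) + 2ℤ * + suc n * (scale n * firstLabel _<ᵇ_ x xs (double k))
          ≡⟨ odd-step k ⟨
        desPoly (x ∷ xs) (point k n + 2ℤ)
          ≡⟨ cong (desPoly (x ∷ xs)) (point-sucʳ k n) ⟨
        desPoly (x ∷ xs) (point k (suc n)) ∎
        where open ≡-Reasoning

      even-case : ∀ k → K * C (double k) ≡ des⁺Poly (x ∷ xs) (point k (suc n) - 2ℤ)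
      even-case zero = ≡.trans (ℤₚ.*-zeroʳ K) (sym (≡.trans
        (cong (des⁺Poly (x ∷ xs)) (lemma (+ n))) (des⁺Poly-zero x xs)))
        where
        lemma : ∀ n → 2ℤ * 0ℤ + 2ℤ * (1ℤ + n) - 2ℤ ≡ 2ℤ * n
        lemma = solve-∀
      even-case (suc k) = begin
        K * C (suc (suc (double k)))
          ≡⟨ collect (2ℤ * + suc n) (scale n) (firstLabel _<ᵇ_ x xs (suc (double k))) (C (suc (double k))) _
               (≡.trans (odd-case k (even-case k)) (cong (desPoly (x ∷ xs)) (point-sucʳ k n))) ⟩
        desPoly (x ∷ xs) (point k n + 2ℤ) + 2ℤ * + suc n * (scale n * firstLabel _<ᵇ_ x xs (suc (double k)))
          ≡⟨ even-step k ⟨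
        des⁺Poly (x ∷ xs) (point k n + 2ℤ)
          ≡⟨ cong (des⁺Poly (x ∷ xs)) (point-suc-suc k n) ⟨
        des⁺Poly (x ∷ xs) (point (suc k) (suc n) - 2ℤ) ∎
        where open ≡-Reasoning

    -- Induction on the number of letters: `firstLabel` counts the labelings that begin with the
    -- newest letter, and `odd-step` and `even-step` say that the polynomials grow by the same
    -- amounts.
    countLaw-∷ : CountLaw (x ∷ xs)
    countLaw-∷ k = odd-case k (even-case k) , even-case k

  countLaw : ∀ x xs → Admissible (x ∷ xs) → CountLaw (x ∷ xs)
  countLaw x [] (0<x ∷ [] , _) = countLaw-∷ x []
    (λ k → ≡.trans (desSum-∷ [] 0<x (fallingAt 1 (point k 0 + 2ℤ))) (≡.trans (lemma₁ (point k 0))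
             (cong (_+ 2ℤ) (sym (des⁺Sum-∷ x [] (fallingAt 1 (point k 0)))))))
    (λ k → ≡.trans (des⁺Sum-∷ x [] (fallingAt 1 (point k 0 + 2ℤ))) (≡.trans (lemma₂ (point k 0))
             (cong (_+ 2ℤ) (sym (desSum-∷ [] 0<x (fallingAt 1 (point k 0 + 2ℤ)))))))
    where
    lemma₁ : ∀ t → ((t + 2ℤ - 2ℤ * 0ℤ) * 1ℤ + 0ℤ) + ((t + 2ℤ - 2ℤ * 1ℤ) * 1ℤ + 0ℤ) ≡
                   (((t - 2ℤ * 0ℤ) * 1ℤ + 0ℤ) + ((t - 2ℤ * 0ℤ) * 1ℤ + 0ℤ)) + 2ℤ
    lemma₁ = solve-∀
    lemma₂ : ∀ t → ((t + 2ℤ - 2ℤ * 0ℤ) * 1ℤ + 0ℤ) + ((t + 2ℤ - 2ℤ * 0ℤ) * 1ℤ + 0ℤ) ≡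
                   (((t + 2ℤ - 2ℤ * 0ℤ) * 1ℤ + 0ℤ) + ((t + 2ℤ - 2ℤ * 1ℤ) * 1ℤ + 0ℤ)) + 2ℤ
    lemma₂ = solve-∀
  countLaw x (y ∷ ys) (0<x ∷ 0<ys , x≢y ∷ ys≢) with ℕₚ.<-cmp x y
  ... | tri≈ _ x≡y _ = ⊥-elim (x≢y x≡y)
  ... | tri< x<y _ _ = countLaw-∷ x (y ∷ ys)
    (λ k → ≡.trans (desPoly-rise ys 0<x (point k n) x<y) (cong (λ z → des⁺Poly (x ∷ y ∷ ys) (point k n) + 2ℤ * + suc n * z) (≡.trans (sym (proj₁ (IH k)))
      (cong (scale n *_) (sym (≡.trans (firstLabel-even x y ys k) (if-true (<ᵇ-true x<y))))))))
    (λ k → ≡.trans (des⁺Poly-rise ys 0<x (point k n) x<y) (cong (λ z → desPoly (x ∷ y ∷ ys) (point k n + 2ℤ) + 2ℤ * + suc n * z) (≡.trans (sym (proj₁ (IH k)))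
      (cong (scale n *_) (sym (≡.trans (firstLabel-odd x y ys k) (if-false (<ᵇ-false (ℕₚ.<⇒≤ x<y)))))))))
    where
    n = length (y ∷ ys)
    IH = countLaw y ys (0<ys , ys≢)
  ... | tri> _ _ y<x = countLaw-∷ x (y ∷ ys)
    (λ k → ≡.trans (desPoly-fall ys 0<x (point k n) y<x) (cong (λ z → des⁺Poly (x ∷ y ∷ ys) (point k n) + 2ℤ * + suc n * z) (≡.trans (sym (proj₂ (IH k)))
      (cong (scale n *_) (sym (≡.trans (firstLabel-even x y ys k) (if-false (<ᵇ-false (ℕₚ.<⇒≤ y<x)))))))))
    (λ k → ≡.trans (des⁺Poly-fall ys 0<x (point k n) y<x) (cong (λ z → desPoly (x ∷ y ∷ ys) (point k n + 2ℤ) + 2ℤ * + suc n * z) (≡.trans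
      -- A run of an odd label may continue across a fall, so the tail may use that label as well,
      -- `double (suc k)` letters in all; hence the instance at `suc k`.
      (sym (≡.trans (proj₂ (IH (suc k))) (cong (des⁺Poly (y ∷ ys)) (lemma (+ k) (+ n)))))
      (cong (scale n *_) (sym (≡.trans (firstLabel-odd x y ys k) (if-true (<ᵇ-true y<x))))))))
    where
    n = length (y ∷ ys)
    IH = countLaw y ys (0<ys , ys≢)
    lemma : ∀ k n → 2ℤ * (1ℤ + k) + 2ℤ * n - 2ℤ ≡ 2ℤ * k + 2ℤ * n
    lemma = solve-∀

  -- Congruences

  record _≈[_]_ (a x b : ℤ) : Set where
    constructor multiple
    field
      quotient : ℤ
      equality : a ≡ b + x * quotient

  module _ {x : ℤ} where

    ≈-refl : ∀ {a} → a ≈[ x ] a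
    ≈-refl {a} = multiple 0ℤ (lemma a x)
      where
      lemma : ∀ a x → a ≡ a + x * 0ℤ
      lemma = solve-∀

    ≈-+ : ∀ {a b c d} → a ≈[ x ] b → c ≈[ x ] d → (a + c) ≈[ x ] (b + d)
    ≈-+ {b = b} {d = d} (multiple q refl) (multiple r refl) = multiple (q + r) (lemma b d q r x)
      where
      lemma : ∀ b d q r x → (b + x * q) + (d + x * r) ≡ (b + d) + x * (q + r)
      lemma = solve-∀

    ≈-* : ∀ {a b c d} → a ≈[ x ] b → c ≈[ x ] d → (a * c) ≈[ x ] (b * d)
    ≈-* {b = b} {d = d} (multiple q refl) (multiple r refl) =
      multiple (q * d + b * r + x * q * r) (lemma b d q r x)
      where
      lemma : ∀ b d q r x → (b + x * q) * (d + x * r) ≡ b * d + x * (q * d + b * r + x * q * r)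
      lemma = solve-∀

    ≈-when : ∀ t {a b} → a ≈[ x ] b → when t a ≈[ x ] when t b
    ≈-when true  a≈b = a≈b
    ≈-when false a≈b = ≈-refl

    ≈-∑ : ∀ {A : Set} (xs : List A) {f g : A → ℤ} → (∀ y → y ∈ xs → f y ≈[ x ] g y) → ∑ xs f ≈[ x ] ∑ xs g
    ≈-∑ []       h = ≈-refl
    ≈-∑ (y ∷ ys) h = ≈-+ (h y (here refl)) (≈-∑ ys λ z z∈ → h z (there z∈))

    ≈-convolution : ∀ n {f f′ g g′ : List ℕ → ℤ} → (∀ σ → σ ∈ perms n → f σ ≈[ x ] f′ σ) →
      (∀ σ → σ ∈ perms n → g σ ≈[ x ] g′ σ) → ∀ π → convolution n f g π ≈[ x ] convolution n f′ g′ π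
    ≈-convolution n f≈ g≈ π = ≈-∑ (perms n) λ σ σ∈ → ≈-∑ (perms n) λ τ τ∈ →
      ≈-when ((σ ∘ₚ τ) == π) (≈-* (f≈ σ σ∈) (g≈ τ τ∈))

    falling-≈ : ∀ n t y → falling n (t + x * y) ≈[ x ] falling n t
    falling-≈ zero    t y = ≈-refl
    falling-≈ (suc n) t y = ≈-* {b = t} (multiple y refl)
      (subst (λ u → falling n u ≈[ x ] falling n (t - 2ℤ)) (lemma t x y) (falling-≈ n (t - 2ℤ) y))
      where
      lemma : ∀ t x y → t - 2ℤ + x * y ≡ t + x * y - 2ℤ
      lemma = solve-∀

    rising-≈ : ∀ m t y → rising m (t + x * y) ≈[ x ] rising m t
    rising-≈ zero    t y = ≈-refl
    rising-≈ (suc m) t y = ≈-* {b = t + 2ℤ * + suc m} (multiple y (lemma t x y (+ suc m))) (rising-≈ m t y)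
      where
      lemma : ∀ t x y m → t + x * y + 2ℤ * m ≡ t + 2ℤ * m + x * y
      lemma = solve-∀

  convolution-cong : ∀ n {f f′ g g′ : List ℕ → ℤ} → (∀ σ → σ ∈ perms n → f σ ≡ f′ σ) →
    (∀ σ → σ ∈ perms n → g σ ≡ g′ σ) → ∀ π → convolution n f g π ≡ convolution n f′ g′ π
  convolution-cong n f≡ g≡ π = ∑-cong (perms n) λ σ σ∈ → ∑-cong (perms n) λ τ τ∈ →
    cong (when ((σ ∘ₚ τ) == π)) (cong₂ _*_ (f≡ σ σ∈) (g≡ τ τ∈))

  convolution-scale : ∀ n a f g π →
    convolution n (λ σ → a * f σ) (λ τ → a * g τ) π ≡ a * a * convolution n f g π
  convolution-scale n a f g π = begin
    convolution n (λ σ → a * f σ) (λ τ → a * g τ) π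
      ≡⟨ ∑-ext (perms n) (λ σ → ≡.trans (∑-ext (perms n) (λ τ → ≡.trans
           (cong (when ((σ ∘ₚ τ) == π)) (lemma a (f σ) (g τ))) (when-*ˡ ((σ ∘ₚ τ) == π) (a * a) (f σ * g τ))))
           (∑-*ˡ (perms n) (a * a) (λ τ → when ((σ ∘ₚ τ) == π) (f σ * g τ)))) ⟩
    ∑ (perms n) (λ σ → a * a * ∑ (perms n) (λ τ → when ((σ ∘ₚ τ) == π) (f σ * g τ)))
      ≡⟨ ∑-*ˡ (perms n) (a * a) _ ⟩
    a * a * convolution n f g π ∎
    where
    open ≡-Reasoning
    lemma : ∀ a x y → a * x * (a * y) ≡ a * a * (x * y)
    lemma = solve-∀

  multiple-small : ∀ m z q → z ≡ + m * q → ∣ z ∣ < m → z ≡ 0ℤ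
  multiple-small m z q z≡ z<m = go ∣ q ∣ refl
    where
    open ≡-Reasoning
    go : ∀ r → ∣ q ∣ ≡ r → z ≡ 0ℤ
    go zero    e = ≡.trans z≡ (≡.trans (cong (+ m *_) (ℤₚ.∣i∣≡0⇒i≡0 e)) (ℤₚ.*-zeroʳ (+ m)))
    go (suc r) e = ⊥-elim (ℕₚ.<⇒≱ z<m (ℕₚ.≤-trans (ℕₚ.m≤m*n m (suc r)) (ℕₚ.≤-reflexive (sym (begin
      ∣ z ∣           ≡⟨ cong ∣_∣ z≡ ⟩
      ∣ + m * q ∣     ≡⟨ ℤₚ.abs-* (+ m) q ⟩
      m ℕ.* ∣ q ∣     ≡⟨ cong (m ℕ.*_) e ⟩
      m ℕ.* suc r     ∎)))))

  -- A family of integer polynomials that is multiplicative at arbitrarily large arguments m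
  -- is multiplicative at 0: reduce the relation at m modulo m.
  specialise-0 : ∀ n K (f : ℤ → List ℕ → ℤ) →
    (∀ x σ → σ ∈ perms n → f x σ ≈[ x ] f 0ℤ σ) → ∀ {π} → π ∈ perms n →
    (∀ b → ∃ λ m → b < m × convolution n (f (+ m)) (f (+ m)) π ≡ K * f (+ m * + m) π) →
    convolution n (f 0ℤ) (f 0ℤ) π ≡ K * f 0ℤ π
  specialise-0 n K f f≈ {π} π∈ large with large ∣ convolution n (f 0ℤ) (f 0ℤ) π - K * f 0ℤ π ∣
  ... | m , z<m , e with ≈-convolution n (f≈ (+ m)) (f≈ (+ m)) π | f≈ (+ m * + m) π π∈
  ... | multiple q p | multiple r p′ = ℤₚ.i-j≡0⇒i≡j _ _
    -- The difference is smaller than `m` by the choice of the bound, and divisible by `m`: the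
    -- error of the product is `m * q`, and the error at the square is even a multiple of `m * m`.
    (multiple-small m _ (K * (+ m * r) - q) (lemma (convolution n (f 0ℤ) (f 0ℤ) π) (f 0ℤ π) K (+ m) q r (begin
      convolution n (f 0ℤ) (f 0ℤ) π + + m * q ≡⟨ p ⟨
      convolution n (f (+ m)) (f (+ m)) π    ≡⟨ e ⟩
      K * f (+ m * + m) π                    ≡⟨ cong (K *_) p′ ⟩
      K * (f 0ℤ π + + m * + m * r)           ∎)) z<m)
    where
    open ≡-Reasoning
    lemma : ∀ c z K m q r → c + m * q ≡ K * (z + m * m * r) → c - K * z ≡ m * (K * (m * r) - q)
    lemma c z K m q r e = begin
      c - K * z                              ≡⟨ l₁ c (K * z) (m * q) ⟩
      c + m * q - (K * z + m * q)            ≡⟨ cong (_- (K * z + m * q)) e ⟩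
      K * (z + m * m * r) - (K * z + m * q)  ≡⟨ l₂ z K m q r ⟩
      m * (K * (m * r) - q)                  ∎
      where
      l₁ : ∀ c k y → c - k ≡ c + y - (k + y)
      l₁ = solve-∀
      l₂ : ∀ z K m q r → K * (z + m * m * r) - (K * z + m * q) ≡ m * (K * (m * r) - q)
      l₂ = solve-∀

  -- Idempotents

  perm-admissible : ∀ n {σ} → σ ∈ perms n → Admissible σ
  perm-admissible n σ∈ =
    All.map (λ { (k , _ , refl) → s≤s z≤n }) (∈-perms-range n σ∈) , AllPairs⇒Linked (∈-perms-unique n σ∈)

  perm-countLaw : ∀ n {σ} → σ ∈ perms (suc n) → CountLaw σ
  perm-countLaw n {[]}     σ∈ with () ← ∈-perms-length (suc n) σ∈
  perm-countLaw n {x ∷ xs} σ∈ = countLaw x xs (perm-admissible (suc n) σ∈)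

  double-* : ∀ j m → double j ℕ.* m ≡ double (j ℕ.* m)
  double-* zero    m = refl
  double-* (suc j) m = begin
    m ℕ.+ (m ℕ.+ double j ℕ.* m)        ≡⟨ ℕₚ.+-assoc m m _ ⟨
    m ℕ.+ m ℕ.+ double j ℕ.* m          ≡⟨ cong (m ℕ.+ m ℕ.+_) (double-* j m) ⟩
    m ℕ.+ m ℕ.+ double (j ℕ.* m)        ≡⟨ n+n+double m (j ℕ.* m) ⟩
    double (suc j ℕ.* m)                ∎
    where
    open ≡-Reasoning
    n+n+double : ∀ m k → m ℕ.+ m ℕ.+ double k ≡ double (m ℕ.+ k)
    n+n+double zero    k = refl
    n+n+double (suc m) k rewrite ℕₚ.+-suc m m = cong (λ z → suc (suc z)) (n+n+double m k)

  double-+ : ∀ m k → double m ℕ.+ double k ≡ double (m ℕ.+ k)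
  double-+ zero    k = refl
  double-+ (suc m) k = cong (λ z → suc (suc z)) (double-+ m k)

  n≤double : ∀ n → n ≤ double n
  n≤double zero    = z≤n
  n≤double (suc n) = s≤s (ℕₚ.m≤n⇒m≤1+n (n≤double n))

  convolution-scaled-count : ∀ n K M {π} → π ∈ perms n →
    convolution n (λ σ → K * count _<ᵇ_ M σ) (λ σ → K * count _<ᵇ_ M σ) π ≡ K * (K * count _<ᵇ_ (M ℕ.* M) π)
  convolution-scaled-count n K M {π} π∈ = begin
    convolution n (λ σ → K * count _<ᵇ_ M σ) (λ σ → K * count _<ᵇ_ M σ) π
      ≡⟨ convolution-scale n K (count _<ᵇ_ M) (count _<ᵇ_ M) π ⟩
    K * K * convolution n (count _<ᵇ_ M) (count _<ᵇ_ M) π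
      ≡⟨ cong (K * K *_) (convolution-count n M M π∈) ⟩
    K * K * count _<ᵇ_ (M ℕ.* M) π
      ≡⟨ ℤₚ.*-assoc K K _ ⟩
    K * (K * count _<ᵇ_ (M ℕ.* M) π) ∎
    where open ≡-Reasoning

  -- (2n)!! times the coefficients of φ(e_(n))
  oddElement : ℕ → List ℕ → ℤ
  oddElement n σ = desSum σ (fallingAt n (2ℤ * + n - 1ℤ))

  -- At x = 2k + 1 the argument `point k n` is x + (2n - 1). So `f` extends the scaled odd counts to
  -- all integers x, and `oddElement` is its value at 0.
  oddElement-idempotent : ∀ N {π} → let n = suc N in π ∈ perms n →
    convolution n (oddElement n) (oddElement n) π ≡ scale n * oddElement n π
  oddElement-idempotent N {π} π∈ = begin
    convolution n (oddElement n) (oddElement n) π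
      ≡⟨ convolution-cong n at-0 at-0 π ⟩
    convolution n (f 0ℤ) (f 0ℤ) π
      ≡⟨ specialise-0 n K f f≈ π∈ (λ b → suc (double b) , s≤s (n≤double b) , multiplicative b) ⟩
    K * f 0ℤ π
      ≡⟨ cong (K *_) (at-0 π π∈) ⟨
    K * oddElement n π ∎
    where
    open ≡-Reasoning
    n = suc N
    K = scale n
    f : ℤ → List ℕ → ℤ
    f x σ = desSum σ (fallingAt n (x + (2ℤ * + n - 1ℤ)))
    at-0 : ∀ σ → σ ∈ perms n → oddElement n σ ≡ f 0ℤ σ
    at-0 σ _ = cong (λ t → desSum σ (fallingAt n t)) (sym (ℤₚ.+-identityˡ (2ℤ * + n - 1ℤ)))
    f≈ : ∀ x σ → σ ∈ perms n → f x σ ≈[ x ] f 0ℤ σ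
    f≈ x σ _ = ≈-∑ (signings σ) λ s _ →
      subst (λ u → falling n u ≈[ x ] falling n (0ℤ + (2ℤ * + n - 1ℤ) - 2ℤ * + #Des s))
            (lemma (2ℤ * + n - 1ℤ) (2ℤ * + #Des s) x)
            (falling-≈ n (0ℤ + (2ℤ * + n - 1ℤ) - 2ℤ * + #Des s) 1ℤ)
      where
      lemma : ∀ a b x → 0ℤ + a - b + x * 1ℤ ≡ x + a - b
      lemma = solve-∀
    law : ∀ k σ → σ ∈ perms n → f (+ suc (double k)) σ ≡ K * count _<ᵇ_ (suc (double k)) σ
    law k σ σ∈ = sym (≡.trans (cong (λ l → scale l * count _<ᵇ_ (suc (double k)) σ) (sym (∈-perms-length n σ∈)))
      (≡.trans (proj₁ (perm-countLaw N σ∈ k)) (≡.trans (cong (λ l → desSum σ (fallingAt l (point k l))) (∈-perms-length n σ∈))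
        (cong (λ t → desSum σ (fallingAt n t)) (≡.trans (lemma (+ k) (+ n))
          (cong (λ z → 1ℤ + z + (2ℤ * + n - 1ℤ)) (sym (double≡2* k))))))))
      where
      lemma : ∀ k n → 2ℤ * k + 2ℤ * n ≡ 1ℤ + 2ℤ * k + (2ℤ * n - 1ℤ)
      lemma = solve-∀
    multiplicative : ∀ k → let m = suc (double k) in convolution n (f (+ m)) (f (+ m)) π ≡ K * f (+ m * + m) π
    multiplicative k = begin
      convolution n (f (+ m)) (f (+ m)) π
        ≡⟨ convolution-cong n (law k) (law k) π ⟩
      convolution n (λ σ → K * count _<ᵇ_ m σ) (λ σ → K * count _<ᵇ_ m σ) π
        ≡⟨ convolution-scaled-count n K m π∈ ⟩
      K * (K * count _<ᵇ_ (m ℕ.* m) π)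
        ≡⟨ cong (λ l → K * (K * count _<ᵇ_ l π)) square ⟩
      K * (K * count _<ᵇ_ (suc (double k′)) π)
        ≡⟨ cong (K *_) (law k′ π π∈) ⟨
      K * f (+ suc (double k′)) π
        ≡⟨ cong (λ l → K * f l π) (≡.trans (cong +_ (sym square)) (ℤₚ.pos-* m m)) ⟩
      K * f (+ m * + m) π ∎
      where
      m = suc (double k)
      -- From (2k + 1)² = 2(k + k(2k + 1)) + 1.
      k′ = k ℕ.+ k ℕ.* m
      square : m ℕ.* m ≡ suc (double k′)
      square = cong suc (≡.trans (cong (double k ℕ.+_) (double-* k m)) (double-+ k (k ℕ.* m)))

  -- 2ⁿ⁻¹ n! times the coefficients of φ(e_(0,n))
  evenElement : ℕ → List ℕ → ℤ
  evenElement n σ = des⁺Sum σ (λ d → rising (n ∸ suc d) 0ℤ * falling d (- 2ℤ))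

  -- At x = 2k the scaled even count is x times `f x`, so the product formula carries a factor x² on
  -- both sides. Cancelling it leaves a relation for `f`, whose value at 0, the linear coefficient,
  -- is `evenElement`.
  evenElement-idempotent : ∀ N {π} → let n = suc N in π ∈ perms n →
    convolution n (evenElement n) (evenElement n) π ≡ scale n * evenElement n π
  evenElement-idempotent N {π} π∈ =
    specialise-0 n K f f≈ π∈ (λ b → double (suc b) , ℕₚ.<-≤-trans (ℕₚ.n<1+n b) (n≤double (suc b)) , multiplicative b)
    where
    open ≡-Reasoning
    n = suc N
    K = scale n
    f : ℤ → List ℕ → ℤ
    f x σ = des⁺Sum σ (λ d → rising (N ∸ d) x * falling d (x - 2ℤ))
    f≈ : ∀ x σ → σ ∈ perms n → f x σ ≈[ x ] f 0ℤ σ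
    f≈ x σ _ = ≈-∑ (signings σ) λ s _ → let d = #Des⁺ s in ≈-*
      (subst (λ u → rising (N ∸ d) u ≈[ x ] rising (N ∸ d) 0ℤ) (lemma₁ x) (rising-≈ (N ∸ d) 0ℤ 1ℤ))
      (subst (λ u → falling d u ≈[ x ] falling d (- 2ℤ)) (lemma₂ x) (falling-≈ d (- 2ℤ) 1ℤ))
      where
      lemma₁ : ∀ x → 0ℤ + x * 1ℤ ≡ x
      lemma₁ = solve-∀
      lemma₂ : ∀ x → - 2ℤ + x * 1ℤ ≡ x - 2ℤ
      lemma₂ = solve-∀
    bound : ∀ σ → σ ∈ perms n → ∀ s → s ∈ signings σ → #Des⁺ s ≤ N
    bound σ σ∈ []      s∈ = z≤n
    bound σ σ∈ (a ∷ s) s∈ = ℕₚ.≤-trans (descents-bound a s) (ℕₚ.≤-reflexive (ℕₚ.suc-injective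
      (≡.trans (∈-signings⇒length σ s∈) (∈-perms-length n σ∈))))
    -- The factors run from x + 2(N - d) down to x - 2d in steps of 2, and `d ≤ N` places x itself
    -- among them.
    factor : ∀ x d → d ≤ N → fallingAt n (x + 2ℤ * + N) d ≡ x * (rising (N ∸ d) x * falling d (x - 2ℤ))
    factor x d d≤N = begin
      falling n (x + 2ℤ * + N - 2ℤ * + d)
        ≡⟨ cong₂ falling (sym (≡.trans (ℕₚ.+-suc m d) (cong suc (ℕₚ.m∸n+n≡m d≤N))))
             (≡.trans (cong (λ l → x + 2ℤ * + l - 2ℤ * + d) (sym (ℕₚ.m∸n+n≡m d≤N))) (lemma x (+ m) (+ d))) ⟩
      falling (m ℕ.+ suc d) (x + 2ℤ * + m)
        ≡⟨ falling-rising m (suc d) x ⟩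
      rising m x * (x * falling d (x - 2ℤ))
        ≡⟨ swap-* (rising m x) x (falling d (x - 2ℤ)) ⟩
      x * (rising m x * falling d (x - 2ℤ)) ∎
      where
      m = N ∸ d
      lemma : ∀ x m d → x + 2ℤ * (m + d) - 2ℤ * d ≡ x + 2ℤ * m
      lemma = solve-∀
      swap-* : ∀ a b c → a * (b * c) ≡ b * (a * c)
      swap-* = solve-∀
    law : ∀ k σ → σ ∈ perms n → + double k * f (+ double k) σ ≡ K * count _<ᵇ_ (double k) σ
    law k σ σ∈ = begin
      x * f x σ
        ≡⟨ ∑-*ˡ (signings σ) x _ ⟨
      ∑ (signings σ) (λ s → x * (rising (N ∸ #Des⁺ s) x * falling (#Des⁺ s) (x - 2ℤ)))
        ≡⟨ ∑-cong (signings σ) (λ s s∈ → sym (factor x (#Des⁺ s) (bound σ σ∈ s s∈))) ⟩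
      des⁺Sum σ (fallingAt n (x + 2ℤ * + N))
        ≡⟨ cong (λ t → des⁺Sum σ (fallingAt n t)) (≡.trans (cong (_+ 2ℤ * + N) (double≡2* k)) (lemma (+ k) (+ N))) ⟩
      des⁺Sum σ (fallingAt n (point k n - 2ℤ))
        ≡⟨ cong (λ l → des⁺Sum σ (fallingAt l (point k l - 2ℤ))) (∈-perms-length n σ∈) ⟨
      des⁺Poly σ (point k (length σ) - 2ℤ)
        ≡⟨ proj₂ (perm-countLaw N σ∈ k) ⟨
      scale (length σ) * count _<ᵇ_ (double k) σ
        ≡⟨ cong (λ l → scale l * count _<ᵇ_ (double k) σ) (∈-perms-length n σ∈) ⟩
      K * count _<ᵇ_ (double k) σ ∎
      where
      x = + double k
      lemma : ∀ k N → 2ℤ * k + 2ℤ * N ≡ 2ℤ * k + 2ℤ * (1ℤ + N) - 2ℤ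
      lemma = solve-∀
    multiplicative : ∀ b → let m = double (suc b) in convolution n (f (+ m)) (f (+ m)) π ≡ K * f (+ m * + m) π
    -- The sizes are taken as `double (suc b)` so that x is nonzero here.
    multiplicative b = ℤₚ.*-cancelˡ-≡ (x * x) _ _ {{ℤₚ.i*j≢0 x x}} (begin
      x * x * convolution n (f x) (f x) π
        ≡⟨ convolution-scale n x (f x) (f x) π ⟨
      convolution n (λ σ → x * f x σ) (λ σ → x * f x σ) π
        ≡⟨ convolution-cong n (law k) (law k) π ⟩
      convolution n (λ σ → K * count _<ᵇ_ m σ) (λ σ → K * count _<ᵇ_ m σ) π
        ≡⟨ convolution-scaled-count n K m π∈ ⟩
      K * (K * count _<ᵇ_ (m ℕ.* m) π)
        ≡⟨ cong (λ l → K * (K * count _<ᵇ_ l π)) (double-* k m) ⟩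
      K * (K * count _<ᵇ_ (double (k ℕ.* m)) π)
        ≡⟨ cong (K *_) (law (k ℕ.* m) π π∈) ⟨
      K * (+ double (k ℕ.* m) * f (+ double (k ℕ.* m)) π)
        ≡⟨ cong (λ l → K * (l * f l π)) (≡.trans (cong +_ (sym (double-* k m))) (ℤₚ.pos-* m m)) ⟩
      K * (x * x * f (x * x) π)
        ≡⟨ swap-* K (x * x) _ ⟩
      x * x * (K * f (x * x) π) ∎)
      where
      k = suc b
      m = double k
      x = + m
      swap-* : ∀ a b c → a * (b * c) ≡ b * (a * c)
      swap-* = solve-∀

  -- Sums over signings in terms of peaks

  -- The linear functional tʲ ↦ `f j`, evaluated at tᵈ (1 + t)ᵐ.
  binomialSum : ℕ → (ℕ → ℤ) → ℕ → ℤ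
  binomialSum zero    f d = f d
  binomialSum (suc m) f d = binomialSum m f d + binomialSum m (f ∘ suc) d

  binomialSum-suc : ∀ m f d → binomialSum m (f ∘ suc) d ≡ binomialSum m f (suc d)
  binomialSum-suc zero    f d = refl
  binomialSum-suc (suc m) f d = cong₂ _+_ (binomialSum-suc m f d) (binomialSum-suc m (f ∘ suc) d)

  infixr 8 4^_
  4^_ : ℕ → ℤ
  4^ zero  = 1ℤ
  4^ suc p = + 4 * 4^ p

  peaks-rise₀ : ∀ {x y} ys → x < y → #Peak (x ∷ y ∷ ys) ≡ peaks (x ∷ y ∷ ys)
  peaks-rise₀ {x} {y} ys x<y
    rewrite ⌊⌋-false (y ℕ.<? x) (ℕₚ.<-asym x<y) with ⌊ 0 ℕ.<? x ⌋
  ... | true  = refl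
  ... | false = refl

  peaks-rise : ∀ {x y} ys → 0 < y → x < y → peaks (x ∷ y ∷ ys) ≡ #Peak (y ∷ ys)
  peaks-rise []       0<y x<y = refl
  peaks-rise {x} {y} (z ∷ zs) 0<y x<y
    rewrite ⌊⌋-true (x ℕ.<? y) x<y | ⌊⌋-true (0 ℕ.<? y) 0<y = refl

  peaks-fall : ∀ {x y} ys → y < x → peaks (x ∷ y ∷ ys) ≡ peaks (y ∷ ys)
  peaks-fall []       y<x = refl
  peaks-fall {x} {y} (z ∷ zs) y<x rewrite ⌊⌋-false (x ℕ.<? y) (ℕₚ.<-asym y<x) = refl

  peaks-fall₀ : ∀ {x y} ys → 0 < x → y < x → #Peak (x ∷ y ∷ ys) ≡ suc (peaks (y ∷ ys))
  peaks-fall₀ {x} {y} ys 0<x y<x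
    rewrite ⌊⌋-true (0 ℕ.<? x) 0<x | ⌊⌋-true (y ℕ.<? x) y<x = cong suc (peaks-fall ys y<x)

  -- Over all signings, Σ t^#Des = (4t)^p (1+t)^m and Σ t^#Des⁺ = 2 (4t)^p (1+t)^m.
  DesLaw DesLaw⁺ : List ℕ → ℕ → Set
  DesLaw  xs n = ∃ λ m → double (#Peak xs) ℕ.+ m ≡ n ×
                 (∀ f → desSum xs f ≡ 4^ #Peak xs * binomialSum m f (#Peak xs))
  DesLaw⁺ xs n = ∃ λ m → double (#Peak⁺ xs) ℕ.+ m ≡ n ×
                 (∀ f → des⁺Sum xs f ≡ 2ℤ * (4^ #Peak⁺ xs * binomialSum m f (#Peak⁺ xs)))

  -- A rise multiplies the first enumerator by 1 + t and makes the second twice the first one of the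
  -- tail. A fall makes the first 2t times the second one of the tail, so that a new peak
  -- contributes 4t, and multiplies the second by 1 + t.
  desLaws : ∀ x xs → Admissible (x ∷ xs) → DesLaw (x ∷ xs) (suc (length xs)) × DesLaw⁺ (x ∷ xs) (length xs)
  desLaws x [] (0<x ∷ [] , _) =
    (1 , refl , λ f → ≡.trans (desSum-∷ [] 0<x f) (lemma₁ (f 0) (f 1))) ,
    (0 , refl , λ f → ≡.trans (des⁺Sum-∷ x [] f) (lemma₂ (f 0)))
    where
    lemma₁ : ∀ a b → (a + 0ℤ) + (b + 0ℤ) ≡ 1ℤ * (a + b)
    lemma₁ = solve-∀
    lemma₂ : ∀ a → (a + 0ℤ) + (a + 0ℤ) ≡ 2ℤ * (1ℤ * a)
    lemma₂ = solve-∀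
  desLaws x (y ∷ ys) (0<x ∷ 0<y ∷ 0<ys , x≢y ∷ ys≢) with desLaws y ys (0<y ∷ 0<ys , ys≢) | ℕₚ.<-cmp x y
  ... | _ | tri≈ _ x≡y _ = ⊥-elim (x≢y x≡y)
  ... | (m , m≡ , law) , _ | tri< x<y _ _
    rewrite peaks-rise₀ ys x<y | peaks-rise ys 0<y x<y =
    (suc m , ≡.trans (ℕₚ.+-suc _ m) (cong suc m≡) , λ f →
      ≡.trans (desSum-rise {x} {y} {ys} 0<x x<y f) (≡.trans (cong₂ _+_ (law f) (law (f ∘ suc)))
        (sym (ℤₚ.*-distribˡ-+ (4^ p) (binomialSum m f p) (binomialSum m (f ∘ suc) p))))) ,
    (m , m≡ , λ f → ≡.trans (des⁺Sum-rise {x} {y} {ys} 0<x x<y f) (≡.trans (cong₂ _+_ (law f) (law f))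
      (lemma (4^ p * binomialSum m f p))))
    where
    p = #Peak (y ∷ ys)
    lemma : ∀ a → a + a ≡ 2ℤ * a
    lemma = solve-∀
  ... | _ , (m , m≡ , law) | tri> _ _ y<x
    rewrite peaks-fall₀ ys 0<x y<x | peaks-fall ys y<x =
    (m , cong (λ z → suc (suc z)) m≡ , λ f → begin
      desSum (x ∷ y ∷ ys) f
        ≡⟨ desSum-fall {x} {y} {ys} 0<x y<x f ⟩
      des⁺Sum (y ∷ ys) (f ∘ suc) + des⁺Sum (y ∷ ys) (f ∘ suc)
        ≡⟨ cong₂ _+_ (law (f ∘ suc)) (law (f ∘ suc)) ⟩
      2ℤ * (4^ p * binomialSum m (f ∘ suc) p) + 2ℤ * (4^ p * binomialSum m (f ∘ suc) p)
        ≡⟨ lemma (4^ p) (binomialSum m (f ∘ suc) p) ⟩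
      4^ suc p * binomialSum m (f ∘ suc) p
        ≡⟨ cong (4^ suc p *_) (binomialSum-suc m f p) ⟩
      4^ suc p * binomialSum m f (suc p) ∎) ,
    (suc m , ≡.trans (ℕₚ.+-suc _ m) (cong suc m≡) , λ f →
      ≡.trans (des⁺Sum-fall {x} {y} {ys} 0<x y<x f) (≡.trans (cong₂ _+_ (law (f ∘ suc)) (law f))
        (lemma₂ (4^ p) (binomialSum m (f ∘ suc) p) (binomialSum m f p))))
    where
    open ≡-Reasoning
    p = peaks (y ∷ ys)
    lemma : ∀ a b → 2ℤ * (a * b) + 2ℤ * (a * b) ≡ (+ 4 * a) * b
    lemma = solve-∀
    lemma₂ : ∀ a b c → 2ℤ * (a * b) + 2ℤ * (a * c) ≡ 2ℤ * (a * (c + b))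
    lemma₂ = solve-∀

  -- For i + k = n fixed, t^i ↦ moment s 0 i k is up to a constant the integral over [0 , 1] of
  -- (-u)^i (1-u)^k against u^(s/2-1) (1-u)^(s/2-1).  Hence moment s m i k, the value at t^i (1+t)^m for
  -- i + k + m = n, has an additional factor (1-2u)^m, and by-parts is integration by parts.

  moment : ℤ → ℕ → ℕ → ℕ → ℤ
  moment s zero    i k = falling i (- s) * rising k (s - 2ℤ)
  moment s (suc m) i k = moment s m i (suc k) + moment s m (suc i) k

  binomialSum-moment : ∀ s {n f} → (∀ d → d ≤ n → f d ≡ moment s 0 d (n ∸ d)) →
    ∀ m i k → i ℕ.+ k ℕ.+ m ≡ n → binomialSum m f i ≡ moment s m i k
  binomialSum-moment s {n} {f} f≡ zero i k e = ≡.trans (f≡ i i≤n) (cong (moment s 0 i) n∸i≡k)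
    where
    i+k≡n = ≡.trans (sym (ℕₚ.+-identityʳ (i ℕ.+ k))) e
    i≤n = ℕₚ.≤-trans (ℕₚ.m≤m+n i k) (ℕₚ.≤-reflexive i+k≡n)
    n∸i≡k = ≡.trans (cong (_∸ i) (sym i+k≡n)) (ℕₚ.m+n∸m≡n i k)
  binomialSum-moment s f≡ (suc m) i k e = cong₂ _+_
    (binomialSum-moment s f≡ m i (suc k) (≡.trans (cong (ℕ._+ m) (ℕₚ.+-suc i k)) e′))
    (≡.trans (binomialSum-suc m _ i) (binomialSum-moment s f≡ m (suc i) k e′))
    where e′ = ≡.trans (sym (ℕₚ.+-suc (i ℕ.+ k) m)) e

  by-parts-0 : ∀ s i k →
    (2ℤ * + i + s) * moment s 0 i (suc k) + (2ℤ * + k + s) * moment s 0 (suc i) k ≡ 0ℤ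
  by-parts-0 s i k = begin
    (2ℤ * + i + s) * (a * ((s - 2ℤ + 2ℤ * + suc k) * b)) + (2ℤ * + k + s) * (falling (suc i) (- s) * b)
      ≡⟨ cong (λ z → (2ℤ * + i + s) * (a * ((s - 2ℤ + 2ℤ * + suc k) * b)) + (2ℤ * + k + s) * (z * b))
              (falling-snoc i (- s)) ⟩
    (2ℤ * + i + s) * (a * ((s - 2ℤ + 2ℤ * + suc k) * b)) + (2ℤ * + k + s) * (a * (- s - 2ℤ * + i) * b)
      ≡⟨ lemma s (+ i) (+ k) a b ⟩
    0ℤ ∎
    where
    open ≡-Reasoning
    a = falling i (- s)
    b = rising k (s - 2ℤ)
    lemma : ∀ s i k a b → (2ℤ * i + s) * (a * ((s - 2ℤ + 2ℤ * (1ℤ + k)) * b)) +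
                           (2ℤ * k + s) * (a * (- s - 2ℤ * i) * b) ≡ 0ℤ
    lemma = solve-∀

  -- Induction on `m`: the instances at `i`, `suc k` and at `suc i`, `k` add up to the wanted left
  -- side plus 4 times the middle term they share. These surpluses accumulate to the factor
  -- `+ 4 * + suc m`.
  by-parts : ∀ s m i k →
    (2ℤ * + i + s) * moment s (suc m) i (suc k) + (2ℤ * + k + s) * moment s (suc m) (suc i) k ≡
    - (+ 4 * + suc m * moment s m (suc i) (suc k))
  by-parts s zero    i k =
    combine (+ i) (+ k) s (moment s 0 i (suc (suc k))) (moment s 0 (suc i) (suc k)) (moment s 0 (suc (suc i)) k)
      (by-parts-0 s i (suc k)) (by-parts-0 s (suc i) k)
    where
    combine : ∀ i k s a b c →
      (2ℤ * i + s) * a + (2ℤ * (1ℤ + k) + s) * b ≡ 0ℤ → (2ℤ * (1ℤ + i) + s) * b + (2ℤ * k + s) * c ≡ 0ℤ →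
      (2ℤ * i + s) * (a + b) + (2ℤ * k + s) * (b + c) ≡ - (+ 4 * 1ℤ * b)
    combine i k s a b c e₁ e₂ = ≡.trans (lemma₁ i k s a b c)
      (≡.trans (cong₂ (λ u v → u + v - + 4 * b) e₁ e₂) (lemma₂ b))
      where
      lemma₁ : ∀ i k s a b c → (2ℤ * i + s) * (a + b) + (2ℤ * k + s) * (b + c) ≡
        (2ℤ * i + s) * a + (2ℤ * (1ℤ + k) + s) * b + ((2ℤ * (1ℤ + i) + s) * b + (2ℤ * k + s) * c) - + 4 * b
      lemma₁ = solve-∀
      lemma₂ : ∀ b → 0ℤ + 0ℤ - + 4 * b ≡ - (+ 4 * 1ℤ * b)
      lemma₂ = solve-∀
  by-parts s (suc m) i k =
    combine (+ i) (+ k) s (+ suc m) (moment s (suc m) i (suc (suc k))) (moment s m (suc i) (suc (suc k)))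
      (moment s m (suc (suc i)) (suc k)) (moment s (suc m) (suc (suc i)) k)
      (by-parts s m i (suc k)) (by-parts s m (suc i) k)
    where
    combine : ∀ i k s m a b₁ b₂ c → let b = b₁ + b₂ in
      (2ℤ * i + s) * a + (2ℤ * (1ℤ + k) + s) * b ≡ - (+ 4 * m * b₁) →
      (2ℤ * (1ℤ + i) + s) * b + (2ℤ * k + s) * c ≡ - (+ 4 * m * b₂) →
      (2ℤ * i + s) * (a + b) + (2ℤ * k + s) * (b + c) ≡ - (+ 4 * (1ℤ + m) * b)
    combine i k s m a b₁ b₂ c e₁ e₂ = begin
      (2ℤ * i + s) * (a + b) + (2ℤ * k + s) * (b + c)
        ≡⟨ lemma₁ i k s a b c ⟩
      (2ℤ * i + s) * a + (2ℤ * (1ℤ + k) + s) * b + ((2ℤ * (1ℤ + i) + s) * b + (2ℤ * k + s) * c) - + 4 * b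
        ≡⟨ cong₂ (λ u v → u + v - + 4 * b) e₁ e₂ ⟩
      - (+ 4 * m * b₁) + - (+ 4 * m * b₂) - + 4 * b
        ≡⟨ lemma₂ m b₁ b₂ ⟩
      - (+ 4 * (1ℤ + m) * b) ∎
      where
      open ≡-Reasoning
      b = b₁ + b₂
      lemma₁ : ∀ i k s a b c → (2ℤ * i + s) * (a + b) + (2ℤ * k + s) * (b + c) ≡
        (2ℤ * i + s) * a + (2ℤ * (1ℤ + k) + s) * b + ((2ℤ * (1ℤ + i) + s) * b + (2ℤ * k + s) * c) - + 4 * b
      lemma₁ = solve-∀
      lemma₂ : ∀ m b₁ b₂ → - (+ 4 * m * b₁) + - (+ 4 * m * b₂) - + 4 * (b₁ + b₂) ≡ - (+ 4 * (1ℤ + m) * (b₁ + b₂))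
      lemma₂ = solve-∀

  -- Central moments

  module Central (r : ℕ) where

    -- A positive `s` makes every 2p + s a nonzero integer that can be cancelled. The instances are
    -- s = 1 and s = 2.
    s : ℤ
    s = + suc r

    private
      factor : ℕ → ℤ
      factor p = 2ℤ * + p + s

      factor≢0 : ∀ p → ℤ.NonZero (factor p)
      factor≢0 p = subst ℤ.NonZero (lemma p) _
        where
        lemma : ∀ p → + suc (2 ℕ.* p ℕ.+ r) ≡ factor p
        lemma p = ≡.trans (cong +_ (sym (ℕₚ.+-suc (2 ℕ.* p) r)))
                          (cong (_+ s) (ℤₚ.pos-* 2 p))

      cancel : ∀ p {a b} → factor p * a ≡ factor p * b → a ≡ b
      cancel p = ℤₚ.*-cancelˡ-≡ (factor p) _ _ {{factor≢0 p}}

      -- For i = k = p the two coefficients in `by-parts` agree, and the two moments merge into one.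
      recursion : ∀ m p → factor p * moment s (suc (suc m)) p p ≡ - (+ 4 * + suc m * moment s m (suc p) (suc p))
      recursion m p = ≡.trans (ℤₚ.*-distribˡ-+ (factor p) _ _) (by-parts s m p p)

    -- The integrand is antisymmetric under u ↦ 1 - u, the power of 1 - 2u being odd. Algebraically,
    -- the recursion lowers that power by 2 down to 1, where `by-parts-0` applies.
    central-odd : ∀ q p → moment s (suc (double q)) p p ≡ 0ℤ
    central-odd zero    p = cancel p (≡.trans (ℤₚ.*-distribˡ-+ (factor p) _ _)
      (≡.trans (by-parts-0 s p p) (sym (ℤₚ.*-zeroʳ (factor p)))))
    central-odd (suc q) p = cancel p (begin
      factor p * moment s (suc (double (suc q))) p p
        ≡⟨ recursion (suc (double q)) p ⟩
      - (+ 4 * + suc (suc (double q)) * moment s (suc (double q)) (suc p) (suc p))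
        ≡⟨ cong (λ z → - (+ 4 * + suc (suc (double q)) * z)) (central-odd q (suc p)) ⟩
      - (+ 4 * + suc (suc (double q)) * 0ℤ)
        ≡⟨ cong -_ (ℤₚ.*-zeroʳ (+ 4 * + suc (suc (double q)))) ⟩
      0ℤ
        ≡⟨ ℤₚ.*-zeroʳ (factor p) ⟨
      factor p * 0ℤ ∎)
      where open ≡-Reasoning

    -- The product s(s + 2)...(s + 2i - 2), that is (2i - 1)!! for s = 1 and (2i)!! for s = 2.
    weight : ℕ → ℤ
    weight i = rising i (s - 2ℤ)

    weight-suc : ∀ i → weight (suc i) ≡ factor i * weight i
    weight-suc i = cong (_* weight i) (lemma s (+ i))
      where
      lemma : ∀ s i → s - 2ℤ + 2ℤ * (1ℤ + i) ≡ 2ℤ * i + s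
      lemma = solve-∀

    falling-weight : ∀ i → falling i (- s) ≡ sgn i * weight i
    falling-weight zero    = refl
    falling-weight (suc i) = begin
      falling (suc i) (- s)                  ≡⟨ falling-snoc i (- s) ⟩
      falling i (- s) * (- s - 2ℤ * + i)     ≡⟨ cong (_* (- s - 2ℤ * + i)) (falling-weight i) ⟩
      sgn i * weight i * (- s - 2ℤ * + i)    ≡⟨ lemma (sgn i) (weight i) s (+ i) ⟩
      - sgn i * (factor i * weight i)        ≡⟨ cong (- sgn i *_) (weight-suc i) ⟨
      sgn (suc i) * weight (suc i)           ∎
      where
      open ≡-Reasoning
      lemma : ∀ g w s i → g * w * (- s - 2ℤ * i) ≡ - g * ((2ℤ * i + s) * w)
      lemma = solve-∀

    dfm-double : ∀ q → + dfm (double (suc q)) ≡ + suc (double q) * + dfm (double q)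
    dfm-double zero    = refl
    dfm-double (suc q) = ℤₚ.pos-* (suc (double (suc q))) (dfm (double (suc q)))

    -- The recursion trades `q` for `p` with p + q fixed until no power of 1 - 2u is left. The last
    -- factor therefore depends only on the length of the permutation; the others form the numerator
    -- of a peak coefficient.
    central-even : ∀ q p → 4^ p * moment s (double q) p p ≡
      sgn p * weight p * + dfm (double q) * (4^ (p ℕ.+ q) * weight (p ℕ.+ q))
    central-even zero    p rewrite ℕₚ.+-identityʳ p | falling-weight p = lemma (4^ p) (sgn p) (weight p)
      where
      lemma : ∀ a g w → a * (g * w * w) ≡ g * w * 1ℤ * (a * w)
      lemma = solve-∀
    central-even (suc q) p = cancel p (begin
      factor p * (4^ p * moment s (double (suc q)) p p)
        ≡⟨ swap-* (factor p) (4^ p) _ ⟩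
      4^ p * (factor p * moment s (double (suc q)) p p)
        ≡⟨ cong (4^ p *_) (recursion (double q) p) ⟩
      4^ p * - (+ 4 * D * moment s (double q) (suc p) (suc p))
        ≡⟨ lemma₁ (4^ p) D _ ⟩
      - (D * (4^ suc p * moment s (double q) (suc p) (suc p)))
        ≡⟨ cong (λ z → - (D * z)) (central-even q (suc p)) ⟩
      - (D * (sgn (suc p) * weight (suc p) * E * T))
        ≡⟨ cong (λ z → - (D * (sgn (suc p) * z * E * T))) (weight-suc p) ⟩
      - (D * (- sgn p * (factor p * weight p) * E * T))
        ≡⟨ lemma₂ D (sgn p) (factor p) (weight p) E T ⟩
      factor p * (sgn p * weight p * (D * E) * T)
        ≡⟨ cong₂ (λ z h → factor p * (sgn p * weight p * z * (4^ h * weight h)))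
             (sym (dfm-double q)) (sym (ℕₚ.+-suc p q)) ⟩
      factor p * (sgn p * weight p * + dfm (double (suc q)) * (4^ (p ℕ.+ suc q) * weight (p ℕ.+ suc q))) ∎)
      where
      open ≡-Reasoning
      D = + suc (double q)
      E = + dfm (double q)
      T = 4^ (suc p ℕ.+ q) * weight (suc p ℕ.+ q)
      swap-* : ∀ a b c → a * (b * c) ≡ b * (a * c)
      swap-* = solve-∀
      lemma₁ : ∀ a d m → a * - (+ 4 * d * m) ≡ - (d * (+ 4 * a * m))
      lemma₁ = solve-∀
      lemma₂ : ∀ d g f w e t → - (d * (- g * (f * w) * e * t)) ≡ f * (g * w * (d * e) * t)
      lemma₂ = solve-∀

  module Odd = Central 0
  module Even = Central 1

  -- Double factorials

  !!-double : ∀ k → + (double (suc k) !!) ≡ 2ℤ * + suc k * + (double k !!)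
  !!-double k = ≡.trans (ℤₚ.pos-* (double (suc k)) (double k !!)) (cong (_* + (double k !!)) (double≡2* (suc k)))

  scale≡!! : ∀ n → scale n ≡ + (double n !!)
  scale≡!! zero    = refl
  scale≡!! (suc n) = ≡.trans (cong (2ℤ * + suc n *_) (scale≡!! n)) (sym (!!-double n))

  odd-weight : ∀ i → Odd.weight i ≡ + dfm (double i)
  odd-weight zero    = refl
  odd-weight (suc i) = ≡.trans (Odd.weight-suc i) (≡.trans (cong₂ _*_ lemma (odd-weight i)) (sym (Odd.dfm-double i)))
    where
    lemma : 2ℤ * + i + 1ℤ ≡ + suc (double i)
    lemma = ≡.trans (ℤₚ.+-comm (2ℤ * + i) 1ℤ) (cong (λ z → 1ℤ + z) (sym (double≡2* i)))

  even-weight : ∀ i → Even.weight i ≡ + (double i !!)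
  even-weight zero    = refl
  even-weight (suc i) = ≡.trans (Even.weight-suc i) (≡.trans (cong₂ _*_ (lemma (+ i)) (even-weight i)) (sym (!!-double i)))
    where
    lemma : ∀ i → 2ℤ * i + 2ℤ ≡ 2ℤ * (1ℤ + i)
    lemma = solve-∀

  2^_ : ℕ → ℤ
  2^ zero  = 1ℤ
  2^ suc n = 2ℤ * 2^ n

  even-weight-! : ∀ i → Even.weight i ≡ 2^ i * + (i !)
  even-weight-! zero    = refl
  even-weight-! (suc i) = ≡.trans (Even.weight-suc i) (≡.trans (cong ((2ℤ * + i + 2ℤ) *_) (even-weight-! i))
    (≡.trans (lemma (+ i) (2^ i) (+ (i !))) (cong (2^ suc i *_) (sym (ℤₚ.pos-* (suc i) (i !))))))
    where
    lemma : ∀ i a b → (2ℤ * i + 2ℤ) * (a * b) ≡ 2ℤ * a * ((1ℤ + i) * b)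
    lemma = solve-∀

  scale-! : ∀ n → scale n ≡ 2^ n * + (n !)
  scale-! n = ≡.trans (scale≡!! n) (≡.trans (sym (even-weight n)) (even-weight-! n))

  -- From (2h - 1)!! (2h)!! = (2h)!. It identifies the constant of `central-even` with the quotient
  -- of `scale n` by n!! for n = 2h.
  odd-constant : ∀ h → 4^ h * Odd.weight h * + (double h !!) ≡ scale (double h)
  odd-constant zero    = refl
  odd-constant (suc h) = begin
    + 4 * 4^ h * Odd.weight (suc h) * + (double (suc h) !!)
      ≡⟨ cong₂ (λ a b → + 4 * 4^ h * a * b) (Odd.weight-suc h) (!!-double h) ⟩
    + 4 * 4^ h * ((2ℤ * + h + 1ℤ) * Odd.weight h) * (2ℤ * + suc h * + (double h !!))
      ≡⟨ lemma (4^ h) (Odd.weight h) (+ (double h !!)) (+ h) ⟩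
    2ℤ * (1ℤ + (1ℤ + 2ℤ * + h)) * (2ℤ * (1ℤ + 2ℤ * + h) * (4^ h * Odd.weight h * + (double h !!)))
      ≡⟨ cong₂ (λ a b → 2ℤ * (1ℤ + (1ℤ + a)) * (2ℤ * (1ℤ + a) * b)) (sym (double≡2* h)) (odd-constant h) ⟩
    scale (double (suc h)) ∎
    where
    open ≡-Reasoning
    lemma : ∀ a w d h → + 4 * a * ((2ℤ * h + 1ℤ) * w) * (2ℤ * (1ℤ + h) * d) ≡
                        2ℤ * (1ℤ + (1ℤ + 2ℤ * h)) * (2ℤ * (1ℤ + 2ℤ * h) * (a * w * d))
    lemma = solve-∀

  -- From (2h)!! (2h + 1)!! = (2h + 1)!. The leading 2 is the factor 2 in `DesLaw⁺`.
  even-constant : ∀ h → 2ℤ * (4^ h * Even.weight h) * + (suc (double h) !!) ≡ scale (suc (double h))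
  even-constant zero    = refl
  even-constant (suc h) = begin
    2ℤ * (+ 4 * 4^ h * Even.weight (suc h)) * + (suc (double (suc h)) !!)
      ≡⟨ cong₂ (λ a b → 2ℤ * (+ 4 * 4^ h * a) * b) (Even.weight-suc h)
           (≡.trans (ℤₚ.pos-* (suc (double (suc h))) (suc (double h) !!))
             (cong (λ z → (1ℤ + (1ℤ + (1ℤ + z))) * + (suc (double h) !!)) (double≡2* h))) ⟩
    2ℤ * (+ 4 * 4^ h * ((2ℤ * + h + 2ℤ) * Even.weight h)) * ((1ℤ + (1ℤ + (1ℤ + 2ℤ * + h))) * + (suc (double h) !!))
      ≡⟨ lemma (4^ h) (Even.weight h) (+ (suc (double h) !!)) (+ h) ⟩
    2ℤ * (1ℤ + (1ℤ + (1ℤ + 2ℤ * + h))) * (2ℤ * (1ℤ + (1ℤ + 2ℤ * + h)) * (2ℤ * (4^ h * Even.weight h) * + (suc (double h) !!)))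
      ≡⟨ cong₂ (λ a b → 2ℤ * (1ℤ + (1ℤ + (1ℤ + a))) * (2ℤ * (1ℤ + (1ℤ + a)) * b)) (sym (double≡2* h)) (even-constant h) ⟩
    scale (suc (double (suc h))) ∎
    where
    open ≡-Reasoning
    lemma : ∀ a w d h → 2ℤ * (+ 4 * a * ((2ℤ * h + 2ℤ) * w)) * ((1ℤ + (1ℤ + (1ℤ + 2ℤ * h))) * d) ≡
      2ℤ * (1ℤ + (1ℤ + (1ℤ + 2ℤ * h))) * (2ℤ * (1ℤ + (1ℤ + 2ℤ * h)) * (2ℤ * (a * w) * d))
    lemma = solve-∀

  -- Parity and halves

  double-2* : ∀ k → double k ≡ 2 ℕ.* k
  double-2* k = ℤₚ.+-injective (≡.trans (double≡2* k) (sym (ℤₚ.pos-* 2 k)))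

  double-*2 : ∀ k → double k ≡ k ℕ.* 2
  double-*2 k = ≡.trans (double-2* k) (ℕₚ.*-comm 2 k)

  half : ∀ n → ∃ λ h → n ≡ double h ⊎ n ≡ suc (double h)
  half zero = 0 , inj₁ refl
  half (suc n) with half n
  ... | h , inj₁ refl = h , inj₂ refl
  ... | h , inj₂ refl = suc h , inj₁ refl

  even-2∣ : ∀ {n} → 2 ∣ n → ∃ λ h → n ≡ double h
  even-2∣ (divides h e) = h , ≡.trans e (sym (double-*2 h))

  odd-2∤ : ∀ {n} → ¬ (2 ∣ n) → ∃ λ h → n ≡ suc (double h)
  odd-2∤ {n} 2∤n with half n
  ... | h , inj₁ e = ⊥-elim (2∤n (divides h (≡.trans e (double-*2 h))))
  ... | h , inj₂ e = h , e

  even-cofactor : ∀ p {m h} → double p ℕ.+ m ≡ double h → ∃ λ q → m ≡ double q × p ℕ.+ q ≡ h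
  even-cofactor zero    {h = h} e = h , e , refl
  even-cofactor (suc p) {h = suc h} e with even-cofactor p (ℕₚ.suc-injective (ℕₚ.suc-injective e))
  ... | q , m≡ , p+q≡ = q , m≡ , cong suc p+q≡

  odd-cofactor : ∀ p {m h} → double p ℕ.+ m ≡ suc (double h) → ∃ λ q → m ≡ suc (double q)
  odd-cofactor zero    {h = h} e = h , e
  odd-cofactor (suc p) {h = suc h} e = odd-cofactor p (ℕₚ.suc-injective (ℕₚ.suc-injective e))
  odd-cofactor (suc p) {h = zero} ()

  double≤⇒≤half : ∀ p m {n} → double p ℕ.+ m ≡ n → p ≤ n ℕ./ 2
  double≤⇒≤half p m {n} e = subst (_≤ n ℕ./ 2) (DivMod.m*n/n≡m p 2)
    (DivMod./-monoˡ-≤ 2 (ℕₚ.≤-trans (ℕₚ.≤-reflexive (sym (double-*2 p)))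
      (ℕₚ.≤-trans (ℕₚ.m≤m+n (double p) m) (ℕₚ.≤-reflexive e))))

  p+p+m : ∀ p m → p ℕ.+ p ℕ.+ m ≡ double p ℕ.+ m
  p+p+m p m = cong (ℕ._+ m) (≡.trans (cong (p ℕ.+_) (sym (ℕₚ.+-identityʳ p))) (sym (double-2* p)))

  double-∸ : ∀ n d → d ≤ n → double n ∸ double d ≡ double (n ∸ d)
  double-∸ n       zero    _       = refl
  double-∸ (suc n) (suc d) (s≤s p) = double-∸ n d p

  -- Numerators of the coefficients

  eNum e0Num ρNum ρ0Num : ℕ → ℕ → ℤ
  eNum  n j = sgn j * + (dfm (2 ℕ.* j) ℕ.* dfm (2 ℕ.* n ∸ 2 ℕ.* j))
  e0Num n j = sgn (j ∸ 1) * + ((j ∸ 1) ! ℕ.* (n ∸ j) !)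
  ρNum  n j = sgn j * + (dfm (2 ℕ.* j) ℕ.* dfm (n ∸ 2 ℕ.* j))
  ρ0Num n j = sgn (j ∸ 1) * + (dfm (2 ℕ.* j ∸ 1) ℕ.* dfm (suc n ∸ 2 ℕ.* j))

  -- The factors are the odd numbers from 2(n - d) - 1 down to 1 - 2d. The positive ones give (2(n -
  -- d) - 1)!! and the negative ones (-1)ᵈ (2d - 1)!!, as in the numerators of e_(n).
  oddTerm : ∀ n d → d ≤ n → fallingAt n (2ℤ * + n - 1ℤ) d ≡ moment 1ℤ 0 d (n ∸ d)
  oddTerm n d d≤n = begin
    falling n (2ℤ * + n - 1ℤ - 2ℤ * + d)
      ≡⟨ cong₂ falling (sym (ℕₚ.m∸n+n≡m d≤n))
           (≡.trans (cong (λ l → 2ℤ * + l - 1ℤ - 2ℤ * + d) (sym (ℕₚ.m∸n+n≡m d≤n))) (lemma (+ m) (+ d))) ⟩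
    falling (m ℕ.+ d) (-1ℤ + 2ℤ * + m)
      ≡⟨ falling-rising m d -1ℤ ⟩
    rising m -1ℤ * falling d -1ℤ
      ≡⟨ ℤₚ.*-comm (rising m -1ℤ) _ ⟩
    moment 1ℤ 0 d m ∎
    where
    open ≡-Reasoning
    m = n ∸ d
    lemma : ∀ m d → 2ℤ * (m + d) - 1ℤ - 2ℤ * d ≡ -1ℤ + 2ℤ * m
    lemma = solve-∀

  eNum-term : ∀ n d → d ≤ n → eNum n d ≡ fallingAt n (2ℤ * + n - 1ℤ) d
  eNum-term n d d≤n = begin
    sgn d * + (dfm (2 ℕ.* d) ℕ.* dfm (2 ℕ.* n ∸ 2 ℕ.* d))
      ≡⟨ cong₂ (λ a b → sgn d * + (dfm a ℕ.* dfm b)) (sym (double-2* d))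
           (≡.trans (cong₂ _∸_ (sym (double-2* n)) (sym (double-2* d))) (double-∸ n d d≤n)) ⟩
    sgn d * + (dfm (double d) ℕ.* dfm (double (n ∸ d)))
      ≡⟨ cong (sgn d *_) (ℤₚ.pos-* (dfm (double d)) _) ⟩
    sgn d * (+ dfm (double d) * + dfm (double (n ∸ d)))
      ≡⟨ cong₂ (λ a b → sgn d * (a * b)) (sym (odd-weight d)) (sym (odd-weight (n ∸ d))) ⟩
    sgn d * (Odd.weight d * Odd.weight (n ∸ d))
      ≡⟨ ℤₚ.*-assoc (sgn d) (Odd.weight d) _ ⟨
    sgn d * Odd.weight d * Odd.weight (n ∸ d)
      ≡⟨ cong (_* Odd.weight (n ∸ d)) (Odd.falling-weight d) ⟨
    moment 1ℤ 0 d (n ∸ d)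
      ≡⟨ oddTerm n d d≤n ⟨
    fallingAt n (2ℤ * + n - 1ℤ) d ∎
    where open ≡-Reasoning

  2^-+ : ∀ i j → 2^ (i ℕ.+ j) ≡ 2^ i * 2^ j
  2^-+ zero    j = sym (ℤₚ.*-identityˡ _)
  2^-+ (suc i) j = ≡.trans (cong (2ℤ *_) (2^-+ i j)) (sym (ℤₚ.*-assoc 2ℤ (2^ i) _))

  evenTerm : ℕ → ℕ → ℤ
  evenTerm n d = rising (n ∸ suc d) 0ℤ * falling d (- 2ℤ)

  -- Each (2i)!! is 2ⁱ i!, and the two powers of 2 multiply to `2^ N` for every `d`.
  e0Num-term : ∀ N d → d ≤ N → 2^ N * e0Num (suc N) (suc d) ≡ evenTerm (suc N) d
  e0Num-term N d d≤N = begin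
    2^ N * (sgn d * + (d ! ℕ.* (N ∸ d) !))
      ≡⟨ cong₂ (λ a b → a * (sgn d * b)) (≡.trans (cong 2^_ (sym (ℕₚ.m+[n∸m]≡n d≤N))) (2^-+ d (N ∸ d)))
           (ℤₚ.pos-* (d !) _) ⟩
    2^ d * 2^ (N ∸ d) * (sgn d * (+ (d !) * + ((N ∸ d) !)))
      ≡⟨ lemma (2^ d) (2^ (N ∸ d)) (sgn d) (+ (d !)) (+ ((N ∸ d) !)) ⟩
    2^ (N ∸ d) * + ((N ∸ d) !) * (sgn d * (2^ d * + (d !)))
      ≡⟨ cong₂ (λ a b → a * (sgn d * b)) (sym (even-weight-! (N ∸ d))) (sym (even-weight-! d)) ⟩
    Even.weight (N ∸ d) * (sgn d * Even.weight d)
      ≡⟨ cong (Even.weight (N ∸ d) *_) (Even.falling-weight d) ⟨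
    evenTerm (suc N) d ∎
    where
    open ≡-Reasoning
    lemma : ∀ a b g x y → a * b * (g * (x * y)) ≡ b * y * (g * (a * x))
    lemma = solve-∀

  perm-desLaws : ∀ N {σ} → σ ∈ perms (suc N) → DesLaw σ (suc N) × DesLaw⁺ σ N
  perm-desLaws N {[]}     σ∈ with () ← ∈-perms-length (suc N) σ∈
  perm-desLaws N {x ∷ xs} σ∈ = subst (λ l → DesLaw (x ∷ xs) (suc l) × DesLaw⁺ (x ∷ xs) l)
    (ℕₚ.suc-injective (∈-perms-length (suc N) σ∈)) (desLaws x xs (perm-admissible (suc N) σ∈))

  module _ (N : ℕ) {σ : List ℕ} (σ∈ : σ ∈ perms (suc N)) where
    private
      n = suc N
      p = #Peak σ
      p⁺ = #Peak⁺ σ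
      law = proj₁ (perm-desLaws N σ∈)
      m = proj₁ law
      2p+m≡n = proj₁ (proj₂ law)
      law⁺ = proj₂ (perm-desLaws N σ∈)
      m⁺ = proj₁ law⁺
      2p⁺+m⁺≡N = proj₁ (proj₂ law⁺)

    #Peak-bound : #Peak σ ≤ n ℕ./ 2
    #Peak-bound = double≤⇒≤half p m 2p+m≡n

    #Peak⁺-bound : suc (#Peak⁺ σ) ≤ suc n ℕ./ 2
    #Peak⁺-bound = double≤⇒≤half (suc p⁺) m⁺ (cong (λ z → suc (suc z)) 2p⁺+m⁺≡N)

    #Des-bound : ∀ {s} → s ∈ signings σ → #Des s ≤ n
    #Des-bound {s} s∈ = ℕₚ.≤-trans (descents-bound (+ 0) s)
      (ℕₚ.≤-reflexive (≡.trans (∈-signings⇒length σ s∈) (∈-perms-length n σ∈)))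

    #Des⁺-bound : ∀ {s} → s ∈ signings σ → #Des⁺ s ≤ N
    #Des⁺-bound {[]}    s∈ = z≤n
    #Des⁺-bound {a ∷ s} s∈ = ℕₚ.≤-trans (descents-bound a s)
      (ℕₚ.≤-reflexive (ℕₚ.suc-injective (≡.trans (∈-signings⇒length σ s∈) (∈-perms-length n σ∈))))

    ∑-eNum : ∑ (signings σ) (λ s → eNum n (#Des s)) ≡ oddElement n σ
    ∑-eNum = ∑-cong (signings σ) λ s s∈ → eNum-term n (#Des s) (#Des-bound s∈)

    ∑-e0Num : 2^ N * ∑ (signings σ) (λ s → e0Num n (suc (#Des⁺ s))) ≡ evenElement n σ
    ∑-e0Num = ≡.trans (sym (∑-*ˡ (signings σ) (2^ N) (λ s → e0Num n (suc (#Des⁺ s)))))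
      (∑-cong (signings σ) λ s s∈ → e0Num-term N (#Des⁺ s) (#Des⁺-bound s∈))

    private
      oddElement-moment : oddElement n σ ≡ 4^ p * moment 1ℤ m p p
      oddElement-moment = ≡.trans (proj₂ (proj₂ law) _)
        (cong (4^ p *_) (binomialSum-moment 1ℤ (oddTerm n) m p p (≡.trans (p+p+m p m) 2p+m≡n)))

      evenElement-moment : evenElement n σ ≡ 2ℤ * (4^ p⁺ * moment 2ℤ m⁺ p⁺ p⁺)
      evenElement-moment = ≡.trans (proj₂ (proj₂ law⁺) (evenTerm n))
        (cong (λ z → 2ℤ * (4^ p⁺ * z)) (binomialSum-moment 2ℤ
          (λ d _ → ℤₚ.*-comm (rising (N ∸ d) 0ℤ) _) m⁺ p⁺ p⁺ (≡.trans (p+p+m p⁺ m⁺) 2p⁺+m⁺≡N)))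

    oddElement-odd : ∀ {h} → n ≡ suc (double h) → oddElement n σ ≡ 0ℤ
    oddElement-odd n≡ with odd-cofactor p (≡.trans 2p+m≡n n≡)
    ... | q , m≡ = ≡.trans oddElement-moment (≡.trans (cong (λ z → 4^ p * moment 1ℤ z p p) m≡)
      (≡.trans (cong (4^ p *_) (Odd.central-odd q p)) (ℤₚ.*-zeroʳ (4^ p))))

    evenElement-even : ∀ {h} → n ≡ double h → evenElement n σ ≡ 0ℤ
    evenElement-even {suc h} n≡ with odd-cofactor p⁺ (≡.trans 2p⁺+m⁺≡N (ℕₚ.suc-injective n≡))
    ... | q , m≡ = ≡.trans evenElement-moment (≡.trans (cong (λ z → 2ℤ * (4^ p⁺ * moment 2ℤ z p⁺ p⁺)) m≡)
      (≡.trans (cong (λ z → 2ℤ * (4^ p⁺ * z)) (Even.central-odd q p⁺)) (cong (2ℤ *_) (ℤₚ.*-zeroʳ (4^ p⁺)))))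

    -- An equality of fractions with denominators `n !!` and `scale n`, cross-multiplied because
    -- either denominator may vanish in the field.
    oddElement-even : ∀ {h} → n ≡ double h → ρNum n p * scale n ≡ oddElement n σ * + (n !!)
    oddElement-even {h} n≡ with even-cofactor p (≡.trans 2p+m≡n n≡)
    ... | q , m≡ , p+q≡h = begin
      sgn p * + (dfm (2 ℕ.* p) ℕ.* dfm (n ∸ 2 ℕ.* p)) * scale n
        ≡⟨ cong₂ (λ a b → sgn p * + (dfm a ℕ.* dfm b) * scale n) (sym (double-2* p)) cofactor ⟩
      sgn p * + (dfm (double p) ℕ.* dfm (double q)) * scale n
        ≡⟨ cong₂ (λ a b → sgn p * a * b)
             (≡.trans (ℤₚ.pos-* (dfm (double p)) _) (cong (_* + dfm (double q)) (sym (odd-weight p))))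
             (≡.trans (cong scale n≡) (sym (odd-constant h))) ⟩
      sgn p * (w * E) * (4^ h * Odd.weight h * + (double h !!))
        ≡⟨ lemma (sgn p) w E (4^ h) (Odd.weight h) (+ (double h !!)) ⟩
      sgn p * w * E * (4^ h * Odd.weight h) * + (double h !!)
        ≡⟨ cong₂ (λ a b → sgn p * w * E * (4^ a * Odd.weight a) * + (b !!)) (sym p+q≡h) (sym n≡) ⟩
      sgn p * w * E * (4^ (p ℕ.+ q) * Odd.weight (p ℕ.+ q)) * + (n !!)
        ≡⟨ cong (_* + (n !!)) (Odd.central-even q p) ⟨
      4^ p * moment 1ℤ (double q) p p * + (n !!)
        ≡⟨ cong (_* + (n !!)) (≡.trans oddElement-moment (cong (λ z → 4^ p * moment 1ℤ z p p) m≡)) ⟨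
      oddElement n σ * + (n !!) ∎
      where
      open ≡-Reasoning
      w = Odd.weight p
      E = + dfm (double q)
      cofactor : n ∸ 2 ℕ.* p ≡ double q
      cofactor = ≡.trans (cong₂ _∸_ (sym 2p+m≡n) (sym (double-2* p))) (≡.trans (ℕₚ.m+n∸m≡n (double p) m) m≡)
      lemma : ∀ g w e a x d → g * (w * e) * (a * x * d) ≡ g * w * e * (a * x) * d
      lemma = solve-∀

    evenElement-odd : ∀ {h} → n ≡ suc (double h) → ρ0Num n (suc p⁺) * scale n ≡ evenElement n σ * + (n !!)
    evenElement-odd {h} n≡ with even-cofactor p⁺ (≡.trans 2p⁺+m⁺≡N (ℕₚ.suc-injective n≡))
    ... | q , m≡ , p+q≡h = begin
      sgn p⁺ * + (dfm (2 ℕ.* suc p⁺ ∸ 1) ℕ.* dfm (suc n ∸ 2 ℕ.* suc p⁺)) * scale n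
        ≡⟨ cong₂ (λ a b → sgn p⁺ * + (dfm a ℕ.* dfm b) * scale n)
             (cong (_∸ 1) (sym (double-2* (suc p⁺)))) cofactor ⟩
      sgn p⁺ * + (double p⁺ !! ℕ.* dfm (double q)) * scale n
        ≡⟨ cong₂ (λ a b → sgn p⁺ * a * b)
             (≡.trans (ℤₚ.pos-* (double p⁺ !!) _) (cong (_* + dfm (double q)) (sym (even-weight p⁺))))
             (≡.trans (cong scale n≡) (sym (even-constant h))) ⟩
      sgn p⁺ * (w * E) * (2ℤ * (4^ h * Even.weight h) * + (suc (double h) !!))
        ≡⟨ lemma (sgn p⁺) w E (4^ h) (Even.weight h) (+ (suc (double h) !!)) ⟩
      2ℤ * (sgn p⁺ * w * E * (4^ h * Even.weight h)) * + (suc (double h) !!)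
        ≡⟨ cong₂ (λ a b → 2ℤ * (sgn p⁺ * w * E * (4^ a * Even.weight a)) * + (b !!)) (sym p+q≡h) (sym n≡) ⟩
      2ℤ * (sgn p⁺ * w * E * (4^ (p⁺ ℕ.+ q) * Even.weight (p⁺ ℕ.+ q))) * + (n !!)
        ≡⟨ cong (λ z → 2ℤ * z * + (n !!)) (Even.central-even q p⁺) ⟨
      2ℤ * (4^ p⁺ * moment 2ℤ (double q) p⁺ p⁺) * + (n !!)
        ≡⟨ cong (_* + (n !!)) (≡.trans evenElement-moment (cong (λ z → 2ℤ * (4^ p⁺ * moment 2ℤ z p⁺ p⁺)) m≡)) ⟨
      evenElement n σ * + (n !!) ∎
      where
      open ≡-Reasoning
      w = Even.weight p⁺
      E = + dfm (double q)
      cofactor : suc n ∸ 2 ℕ.* suc p⁺ ≡ double q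
      cofactor = ≡.trans (cong₂ (λ a b → suc (suc a) ∸ b) (sym 2p⁺+m⁺≡N) (sym (double-2* (suc p⁺))))
        (≡.trans (ℕₚ.m+n∸m≡n (double p⁺) m⁺) m≡)
      lemma : ∀ g w e a x d → g * (w * e) * (2ℤ * (a * x) * d) ≡ 2ℤ * (g * w * e * (a * x)) * d
      lemma = solve-∀

module FieldTransfer where

  open IntegerIdentities
  open import Data.Bool using (true; false; if_then_else_)
  open import Data.Nat as ℕ using (ℕ; zero; suc; _≤_; z≤n; s≤s; _!)
  import Data.Nat.Properties as ℕₚ
  open import Data.Nat.Divisibility using (_∣_)
  open import Data.Integer as ℤ using (ℤ; +_; -[1+_]; 0ℤ; 1ℤ; ∣_∣)
  import Data.Integer.Properties as ℤₚ
  import Data.Rational as ℚ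
  import Data.Rational.Properties as ℚₚ
  import Data.Integer.GCD as ℤGCD
  open import Data.Integer.Tactic.RingSolver using () renaming (solve-∀ to ℤ-solve-∀)
  import Algebra.Properties.Ring as RingProperties
  import Algebra.Solver.Ring.NaturalCoefficients.Default as SemiringSolver
  open import Data.List using (List; []; _∷_; map)
  open import Data.List.Membership.Propositional using (_∈_)
  open import Data.List.Membership.Propositional.Properties using (∈-concatMap⁻)
  open import Data.List.Relation.Unary.Any using (here; there)
  import Data.List.Relation.Unary.Any as Any
  open import Data.Product using (_×_; _,_; proj₂; ∃)
  open import Relation.Nullary using (¬_)
  open import Relation.Binary.PropositionalEquality as ≡ using (_≡_; refl; sym; cong; cong₂; subst)

  -- Integers and fractions in a field

  module IntegerEmbedding {c ℓ} (F : Field c ℓ) where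
    open Field F hiding (refl; sym)
    open Field F using () renaming (refl to ≈-refl′; sym to ≈-sym)
    open FieldOps F
    open RingProperties ring using (-0#≈0#; -‿distribˡ-*; -‿+-comm; -‿involutive)

    open SemiringSolver commutativeSemiring using (solve; _:=_; _:+_; _:*_)

    open import Relation.Binary.Reasoning.Setoid setoid

    ℕ→k-+ : ∀ m n → ℕ→k (m ℕ.+ n) ≈ ℕ→k m + ℕ→k n
    ℕ→k-+ zero    n = ≈-sym (+-identityˡ _)
    ℕ→k-+ (suc m) n = trans (+-congˡ (ℕ→k-+ m n)) (≈-sym (+-assoc 1# _ _))

    ℤ→k-⊖ : ∀ m n → ℤ→k (m ℤ.⊖ n) ≈ ℕ→k m - ℕ→k n
    ℤ→k-⊖ zero    zero    = ≈-sym (-‿inverseʳ 0#)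
    ℤ→k-⊖ zero    (suc n) = ≈-sym (+-identityˡ _)
    ℤ→k-⊖ (suc m) zero    = ≈-sym (trans (+-congˡ -0#≈0#) (+-identityʳ _))
    ℤ→k-⊖ (suc m) (suc n) = begin
      ℤ→k (suc m ℤ.⊖ suc n)             ≡⟨ cong ℤ→k (ℤₚ.[1+m]⊖[1+n]≡m⊖n m n) ⟩
      ℤ→k (m ℤ.⊖ n)                     ≈⟨ ℤ→k-⊖ m n ⟩
      ℕ→k m - ℕ→k n                     ≈⟨ lemma 1# (ℕ→k m) (ℕ→k n) ⟩
      1# + ℕ→k m - (1# + ℕ→k n)         ∎
      where
      lemma : ∀ o a b → a - b ≈ o + a - (o + b)
      lemma o a b = begin
        a - b                     ≈⟨ +-identityˡ _ ⟨
        0# + (a - b)              ≈⟨ +-congʳ (-‿inverseʳ o) ⟨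
        (o - o) + (a - b)         ≈⟨ solve 4 (λ o o′ a b′ → (o :+ o′) :+ (a :+ b′) := (o :+ a) :+ (o′ :+ b′))
                                       ≈-refl′ o (- o) a (- b) ⟩
        (o + a) + (- o + - b)     ≈⟨ +-congˡ (-‿+-comm o b) ⟩
        o + a - (o + b)           ∎

    ℤ→k-+ : ∀ a b → ℤ→k (a ℤ.+ b) ≈ ℤ→k a + ℤ→k b
    ℤ→k-+ (+ m)    (+ n)    = ℕ→k-+ m n
    ℤ→k-+ (+ m)    -[1+ n ] = ℤ→k-⊖ m (suc n)
    ℤ→k-+ -[1+ m ] (+ n)    = trans (ℤ→k-⊖ n (suc m)) (+-comm _ _)
    ℤ→k-+ -[1+ m ] -[1+ n ] = begin
      - ℕ→k (suc (suc (m ℕ.+ n)))         ≡⟨ cong (λ k → - ℕ→k (suc k)) (ℕₚ.+-suc m n) ⟨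
      - ℕ→k (suc m ℕ.+ suc n)             ≈⟨ -‿cong (ℕ→k-+ (suc m) (suc n)) ⟩
      - (ℕ→k (suc m) + ℕ→k (suc n))       ≈⟨ ≈-sym (-‿+-comm _ _) ⟩
      - ℕ→k (suc m) + - ℕ→k (suc n)       ∎

    ℤ→k-neg : ∀ a → ℤ→k (ℤ.- a) ≈ - ℤ→k a
    ℤ→k-neg (+ zero)  = ≈-sym -0#≈0#
    ℤ→k-neg (+ suc m) = ≈-refl′
    ℤ→k-neg -[1+ m ]  = ≈-sym (-‿involutive (ℕ→k (suc m)))

    ℤ→k-*-+ : ∀ m b → ℤ→k (+ m ℤ.* b) ≈ ℕ→k m * ℤ→k b
    ℤ→k-*-+ zero    b = trans (reflexive (cong ℤ→k (ℤₚ.*-zeroˡ b))) (≈-sym (zeroˡ _))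
    ℤ→k-*-+ (suc m) b = begin
      ℤ→k (+ suc m ℤ.* b)            ≡⟨ cong ℤ→k (ℤₚ.suc-* (+ m) b) ⟩
      ℤ→k (b ℤ.+ + m ℤ.* b)          ≈⟨ ℤ→k-+ b _ ⟩
      ℤ→k b + ℤ→k (+ m ℤ.* b)        ≈⟨ +-cong (≈-sym (*-identityˡ _)) (ℤ→k-*-+ m b) ⟩
      1# * ℤ→k b + ℕ→k m * ℤ→k b     ≈⟨ ≈-sym (distribʳ _ _ _) ⟩
      ℕ→k (suc m) * ℤ→k b            ∎

    ℤ→k-* : ∀ a b → ℤ→k (a ℤ.* b) ≈ ℤ→k a * ℤ→k b
    ℤ→k-* (+ m)    b = ℤ→k-*-+ m b
    ℤ→k-* -[1+ m ] b = begin
      ℤ→k (-[1+ m ] ℤ.* b)           ≡⟨ cong ℤ→k (ℤₚ.neg-distribˡ-* (+ suc m) b) ⟨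
      ℤ→k (ℤ.- (+ suc m ℤ.* b))      ≈⟨ ℤ→k-neg (+ suc m ℤ.* b) ⟩
      - ℤ→k (+ suc m ℤ.* b)          ≈⟨ -‿cong (ℤ→k-*-+ (suc m) b) ⟩
      - (ℕ→k (suc m) * ℤ→k b)        ≈⟨ -‿distribˡ-* _ _ ⟩
      - ℕ→k (suc m) * ℤ→k b          ∎

    *-cancelʳ-nonzero : ∀ {x y z} → ¬ (z ≈ 0#) → x * z ≈ y * z → x ≈ y
    *-cancelʳ-nonzero {x} {y} {z} z≉0 e = trans (insert x) (trans (*-congʳ e) (≈-sym (insert y)))
      where
      insert : ∀ x → x ≈ x * z * z ⁻¹
      insert x = ≈-sym (trans (*-assoc x z _) (trans (*-congˡ (⁻¹-inverse z z≉0)) (*-identityʳ x)))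

    *-nonzero : ∀ {x y} → ¬ (x ≈ 0#) → ¬ (y ≈ 0#) → ¬ (x * y ≈ 0#)
    *-nonzero x≉0 y≉0 xy≈0 = x≉0 (*-cancelʳ-nonzero y≉0 (trans xy≈0 (≈-sym (zeroˡ _))))

    ≉0-* : ∀ a b → ¬ (ℤ→k a ≈ 0#) → ¬ (ℤ→k b ≈ 0#) → ¬ (ℤ→k (a ℤ.* b) ≈ 0#)
    ≉0-* a b a≉0 b≉0 e = *-nonzero a≉0 b≉0 (trans (≈-sym (ℤ→k-* a b)) e)

    -- x is the value in k of the rational number a / D.  The fraction a / D itself need not make
    -- sense in k; some equal fraction with denominator nonzero in k does.
    record Represents (x : Carrier) (a D : ℤ) : Set ℓ where
      field
        num den : ℤ
        den≉0   : ¬ (ℤ→k den ≈ 0#)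
        value   : x * ℤ→k den ≈ ℤ→k num
        ratio   : num ℤ.* D ≡ a ℤ.* den

    open Represents

    represents-integer : ∀ {x} a → x ≈ ℤ→k a → ∀ D → Represents x (a ℤ.* D) D
    represents-integer a x≈ D = record
      { num = a ; den = 1ℤ ; den≉0 = λ e → 1≉0 (trans (≈-sym (+-identityʳ 1#)) e)
      ; value = trans (*-congˡ (+-identityʳ 1#)) (trans (*-identityʳ _) x≈) ; ratio = sym (ℤₚ.*-identityʳ (a ℤ.* D)) }

    represents-0 : ∀ D → Represents 0# 0ℤ D
    represents-0 D = subst (λ a → Represents 0# a D) (ℤₚ.*-zeroˡ D) (represents-integer 0ℤ ≈-refl′ D)

    represents-+ : ∀ {x y a b D} → Represents x a D → Represents y b D → Represents (x + y) (a ℤ.+ b) D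
    represents-+ {x} {y} {a} {b} {D} X Y = record
      { num = num X ℤ.* den Y ℤ.+ num Y ℤ.* den X
      ; den = den X ℤ.* den Y
      ; den≉0 = ≉0-* (den X) (den Y) (den≉0 X) (den≉0 Y)
      ; value = begin
          (x + y) * ℤ→k (den X ℤ.* den Y)
            ≈⟨ *-congˡ (ℤ→k-* (den X) (den Y)) ⟩
          (x + y) * (ℤ→k (den X) * ℤ→k (den Y))
            ≈⟨ lemma x y (ℤ→k (den X)) (ℤ→k (den Y)) ⟩
          x * ℤ→k (den X) * ℤ→k (den Y) + y * ℤ→k (den Y) * ℤ→k (den X)
            ≈⟨ +-cong (*-congʳ (value X)) (*-congʳ (value Y)) ⟩
          ℤ→k (num X) * ℤ→k (den Y) + ℤ→k (num Y) * ℤ→k (den X)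
            ≈⟨ +-cong (≈-sym (ℤ→k-* (num X) (den Y))) (≈-sym (ℤ→k-* (num Y) (den X))) ⟩
          ℤ→k (num X ℤ.* den Y) + ℤ→k (num Y ℤ.* den X)
            ≈⟨ ≈-sym (ℤ→k-+ (num X ℤ.* den Y) _) ⟩
          ℤ→k (num X ℤ.* den Y ℤ.+ num Y ℤ.* den X) ∎
      ; ratio = combine (num X) (den X) (num Y) (den Y) a b D (ratio X) (ratio Y) }
      where
      lemma : ∀ x y v w → (x + y) * (v * w) ≈ x * v * w + y * w * v
      lemma = solve 4 (λ x y v w → (x :+ y) :* (v :* w) := x :* v :* w :+ y :* w :* v) ≈-refl′
      combine : ∀ u v u′ v′ a b D → u ℤ.* D ≡ a ℤ.* v → u′ ℤ.* D ≡ b ℤ.* v′ →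
        (u ℤ.* v′ ℤ.+ u′ ℤ.* v) ℤ.* D ≡ (a ℤ.+ b) ℤ.* (v ℤ.* v′)
      combine u v u′ v′ a b D e e′ = ≡.trans (l₁ u v u′ v′ D) (≡.trans
        (cong₂ (λ p q → p ℤ.* v′ ℤ.+ q ℤ.* v) e e′) (l₂ a b v v′))
        where
        l₁ : ∀ u v u′ v′ D → (u ℤ.* v′ ℤ.+ u′ ℤ.* v) ℤ.* D ≡ u ℤ.* D ℤ.* v′ ℤ.+ u′ ℤ.* D ℤ.* v
        l₁ = ℤ-solve-∀
        l₂ : ∀ a b v v′ → a ℤ.* v ℤ.* v′ ℤ.+ b ℤ.* v′ ℤ.* v ≡ (a ℤ.+ b) ℤ.* (v ℤ.* v′)
        l₂ = ℤ-solve-∀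

    represents-* : ∀ {x y a b D E} → Represents x a D → Represents y b E → Represents (x * y) (a ℤ.* b) (D ℤ.* E)
    represents-* {x} {y} {a} {b} {D} {E} X Y = record
      { num = num X ℤ.* num Y
      ; den = den X ℤ.* den Y
      ; den≉0 = ≉0-* (den X) (den Y) (den≉0 X) (den≉0 Y)
      ; value = begin
          x * y * ℤ→k (den X ℤ.* den Y)                 ≈⟨ *-congˡ (ℤ→k-* (den X) (den Y)) ⟩
          x * y * (ℤ→k (den X) * ℤ→k (den Y))           ≈⟨ lemma x y (ℤ→k (den X)) (ℤ→k (den Y)) ⟩
          (x * ℤ→k (den X)) * (y * ℤ→k (den Y))         ≈⟨ *-cong (value X) (value Y) ⟩
          ℤ→k (num X) * ℤ→k (num Y)                     ≈⟨ ≈-sym (ℤ→k-* (num X) (num Y)) ⟩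
          ℤ→k (num X ℤ.* num Y)                         ∎
      ; ratio = ≡.trans (interchange (num X) (num Y) D E)
          (≡.trans (cong₂ ℤ._*_ (ratio X) (ratio Y)) (interchange a (den X) b (den Y))) }
      where
      lemma : ∀ x y v w → x * y * (v * w) ≈ (x * v) * (y * w)
      lemma = solve 4 (λ x y v w → x :* y :* (v :* w) := (x :* v) :* (y :* w)) ≈-refl′
      interchange : ∀ a b c d → (a ℤ.* b) ℤ.* (c ℤ.* d) ≡ (a ℤ.* c) ℤ.* (b ℤ.* d)
      interchange = ℤ-solve-∀

    -- The integers `D` and `E` are cancelled in ℤ, where they are nonzero although their images may
    -- vanish. Only the resulting equation between `num` and `den` is mapped to the field, where the
    -- `den` can be cancelled.
    represents-≈ : ∀ {x y a b D E} .{{_ : ℤ.NonZero D}} .{{_ : ℤ.NonZero E}} →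
      Represents x a D → Represents y b E → a ℤ.* E ≡ b ℤ.* D → x ≈ y
    represents-≈ {x} {y} {a} {b} {D} {E} X Y aE≡bD =
      *-cancelʳ-nonzero (*-nonzero (den≉0 X) (den≉0 Y)) (begin
        x * (ℤ→k (den X) * ℤ→k (den Y))       ≈⟨ ≈-sym (*-assoc x _ _) ⟩
        x * ℤ→k (den X) * ℤ→k (den Y)         ≈⟨ *-congʳ (value X) ⟩
        ℤ→k (num X) * ℤ→k (den Y)             ≈⟨ ≈-sym (ℤ→k-* (num X) (den Y)) ⟩
        ℤ→k (num X ℤ.* den Y)                 ≡⟨ cong ℤ→k cross ⟩
        ℤ→k (num Y ℤ.* den X)                 ≈⟨ ℤ→k-* (num Y) (den X) ⟩
        ℤ→k (num Y) * ℤ→k (den X)             ≈⟨ *-congʳ (≈-sym (value Y)) ⟩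
        y * ℤ→k (den Y) * ℤ→k (den X)         ≈⟨ lemma y (ℤ→k (den Y)) (ℤ→k (den X)) ⟩
        y * (ℤ→k (den X) * ℤ→k (den Y))       ∎)
      where
      lemma : ∀ y v w → y * v * w ≈ y * (w * v)
      lemma = solve 3 (λ y v w → y :* v :* w := y :* (w :* v)) ≈-refl′
      interchange : ∀ u v D E → u ℤ.* v ℤ.* (D ℤ.* E) ≡ u ℤ.* D ℤ.* (v ℤ.* E)
      interchange = ℤ-solve-∀
      middle : ∀ a v w E → a ℤ.* v ℤ.* (w ℤ.* E) ≡ a ℤ.* E ℤ.* (v ℤ.* w)
      middle = ℤ-solve-∀
      middle′ : ∀ b D v w → b ℤ.* D ℤ.* (v ℤ.* w) ≡ b ℤ.* w ℤ.* (v ℤ.* D)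
      middle′ = ℤ-solve-∀
      last : ∀ u E v D → u ℤ.* E ℤ.* (v ℤ.* D) ≡ u ℤ.* v ℤ.* (D ℤ.* E)
      last = ℤ-solve-∀
      cross : num X ℤ.* den Y ≡ num Y ℤ.* den X
      cross = ℤₚ.*-cancelʳ-≡ _ _ (D ℤ.* E) {{ℤₚ.i*j≢0 D E}}
        (≡.trans (interchange (num X) (den Y) D E) (≡.trans (cong (ℤ._* (den Y ℤ.* E)) (ratio X))
          (≡.trans (middle a (den X) (den Y) E) (≡.trans (cong (ℤ._* (den X ℤ.* den Y)) aE≡bD)
            (≡.trans (middle′ b D (den X) (den Y)) (≡.trans (cong (ℤ._* (den X ℤ.* D)) (sym (ratio Y)))
              (last (num Y) E (den X) D)))))))

    represents-cross : ∀ {x a b D E} .{{_ : ℤ.NonZero D}} → Represents x a D → a ℤ.* E ≡ b ℤ.* D → Represents x b E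
    represents-cross {x} {a} {b} {D} {E} X aE≡bD = record
      { num = num X ; den = den X ; den≉0 = den≉0 X ; value = value X
      ; ratio = ℤₚ.*-cancelʳ-≡ _ _ D (≡.trans (swapʳ (num X) E D) (≡.trans (cong (ℤ._* E) (ratio X))
          (≡.trans (swapʳ a (den X) E) (≡.trans (cong (ℤ._* den X) aE≡bD) (swapʳ b D (den X)))))) }
      where
      swapʳ : ∀ a b c → a ℤ.* b ℤ.* c ≡ a ℤ.* c ℤ.* b
      swapʳ = ℤ-solve-∀

    -- The reduced fraction is the witness: `Interpretable` says that its denominator is nonzero in
    -- the field, while `d` may vanish there.
    represents-⟦⟧ : ∀ a d .{{_ : ℕ.NonZero d}} → Interpretable (a ℚ./ d) → Represents ⟦ a ℚ./ d ⟧ a (+ d)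
    represents-⟦⟧ a d ok = record
      { num = ℚ.↥ q ; den = ℚ.↧ q ; den≉0 = ok
      ; value = trans (*-assoc _ _ _) (trans (*-congˡ (trans (*-comm _ _) (⁻¹-inverse _ ok))) (*-identityʳ _))
      ; ratio = ratio-q }
      where
      q = a ℚ./ d
      g = ℤGCD.gcd a (+ d)
      lemma : ∀ n m g → n ℤ.* (m ℤ.* g) ≡ n ℤ.* g ℤ.* m
      lemma = ℤ-solve-∀
      ratio-q : ℚ.↥ q ℤ.* + d ≡ a ℤ.* ℚ.↧ q
      ratio-q = ≡.trans (cong (ℚ.↥ q ℤ.*_) (sym (ℚₚ.↧-/ a d)))
        (≡.trans (lemma (ℚ.↥ q) (ℚ.↧ q) g) (cong (ℤ._* ℚ.↧ q) (ℚₚ.↥-/ a d)))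

    represents-Σ : ∀ {A : Set} (xs : List A) {f : A → Carrier} {a : A → ℤ} {D} →
      (∀ x → x ∈ xs → Represents (f x) (a x) D) → Represents (Σ[ xs ] f) (∑ xs a) D
    represents-Σ []       {D = D} h = represents-0 D
    represents-Σ (x ∷ xs) h = represents-+ (h x (here refl)) (represents-Σ xs λ y y∈ → h y (there y∈))

    represents-if : ∀ b {x a D} → Represents x a D → Represents (if b then x else 0#) (when b a) D
    represents-if true      X = X
    represents-if false {D = D} X = represents-0 D

    represents-zero : ∀ {x D} .{{_ : ℤ.NonZero D}} → Represents x 0ℤ D → x ≈ 0#
    represents-zero {D = D} X = represents-≈ X (represents-0 D) refl

  -- Transfer to the group algebras

  module GroupAlgebraTransfer {c ℓ} (F : Field c ℓ) (N : ℕ) where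
    open Field F hiding (refl; sym)
    open FieldOps F
    open IntegerEmbedding F

    n : ℕ
    n = suc N

    open GroupAlgebra F n

    ∈-sperms⇒perm : ∀ {s} → s ∈ sperms n → ∃ λ σ → σ ∈ perms n × s ∈ signings σ
    ∈-sperms⇒perm s∈ = go (perms n) (λ σ∈ → σ∈) (∈-concatMap⁻ signings s∈)
      where
      go : ∀ {s} σs → (∀ {σ} → σ ∈ σs → σ ∈ perms n) → Any.Any (λ σ → s ∈ signings σ) σs →
           ∃ λ σ → σ ∈ perms n × s ∈ signings σ
      go (σ ∷ σs) h (here p)  = σ , h (here refl) , p
      go (σ ∷ σs) h (there p) = go σs (λ σ∈ → h (there σ∈)) p

    -- Forgetting signs divides the signed permutations into the fibres `signings σ`; the indicator
    -- in `φ` leaves the fibre over `π`, which occurs exactly once.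
    represents-φ : ∀ {E : kB} {a : List ℤ → ℤ} {D} →
      (∀ σ s → σ ∈ perms n → s ∈ signings σ → Represents (E s) (a s) D) →
      ∀ {π} → π ∈ perms n → Represents (φ E π) (∑ (signings π) a) D
    represents-φ {E} {a} {D} h {π} π∈ = subst (λ z → Represents (φ E π) z D) sum-over-fibre
      (represents-Σ (sperms n) λ s s∈ → let σ , σ∈ , s∈σ = ∈-sperms⇒perm s∈ in
        represents-if (map ∣_∣ s == π) (h σ s σ∈ s∈σ))
      where
      open ≡.≡-Reasoning
      sum-over-fibre : ∑ (sperms n) (λ s → when (map ∣_∣ s == π) (a s)) ≡ ∑ (signings π) a
      sum-over-fibre = begin
        ∑ (sperms n) (λ s → when (map ∣_∣ s == π) (a s))
          ≡⟨ ∑-concatMap signings (perms n) _ ⟩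
        ∑ (perms n) (λ σ → ∑ (signings σ) (λ s → when (map ∣_∣ s == π) (a s)))
          ≡⟨ ∑-ext (perms n) (λ σ → ≡.trans (∑-cong (signings σ) (λ s s∈ →
               cong (λ τ → when (τ == π) (a s)) (∈-signings⇒abs σ s∈))) (∑-when (signings σ) (σ == π) a)) ⟩
        ∑ (perms n) (λ σ → when (σ == π) (∑ (signings σ) a))
          ≡⟨ ∑-perms n (∈-perms⇒↭ n π∈) _ ⟩
        ∑ (arrangements π) (λ σ → when (σ == π) (∑ (signings σ) a))
          ≡⟨ ∑-arrangements-self (∈-perms-unique n π∈) (λ σ → ∑ (signings σ) a) ⟩
        ∑ (signings π) a ∎

    represents-⋆ : ∀ {f g : kS} {a b : List ℕ → ℤ} {D E} →
      (∀ σ → σ ∈ perms n → Represents (f σ) (a σ) D) → (∀ σ → σ ∈ perms n → Represents (g σ) (b σ) E) →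
      ∀ π → Represents ((f ⋆ g) π) (convolution n a b π) (D ℤ.* E)
    represents-⋆ hf hg π = represents-Σ (perms n) λ σ σ∈ → represents-Σ (perms n) λ τ τ∈ →
      represents-if ((σ ∘ₚ τ) == π) (represents-* (hf σ σ∈) (hg τ τ∈))

    private instance
      n!≢0 : ℕ.NonZero (n !)
      n!≢0 = n ℕₚ.!≢0
      n!!≢0 : ℕ.NonZero (n !!)
      n!!≢0 = !!≢0 n
      2n!!≢0 : ℕ.NonZero ((2 ℕ.* n) !!)
      2n!!≢0 = !!≢0 (2 ℕ.* n)
      scale≢0 : ℤ.NonZero (scale n)
      scale≢0 = subst ℤ.NonZero (≡.trans (cong (λ k → + (k !!)) (sym (double-2* n))) (sym (scale≡!! n))) 2n!!≢0

    scale-2n!! : + ((2 ℕ.* n) !!) ≡ scale n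
    scale-2n!! = ≡.trans (cong (λ k → + (k !!)) (sym (double-2* n))) (sym (scale≡!! n))

    -- The same numerator `evenElement` belongs to φ(e_(0,n)) over `half-scale` and, for odd n, to
    -- ρ_(0,n) over `scale n`, which is the origin of the factor 2 between them.
    half-scale : ℤ
    half-scale = 2^ N ℤ.* + (n !)

    scale-half : scale n ≡ 2ℤ ℤ.* half-scale
    scale-half = ≡.trans (scale-! n) (ℤₚ.*-assoc 2ℤ (2^ N) (+ (n !)))

    instance
      half-scale≢0 : ℤ.NonZero half-scale
      half-scale≢0 = ℤ.≢-nonZero λ e → ℕ.≢-nonZero⁻¹ ∣ scale n ∣
        (cong ∣_∣ (≡.trans scale-half (cong (2ℤ ℤ.*_) e)))

    represents-φe : e-ok → ∀ {π} → π ∈ perms n → Represents (φ e π) (oddElement n π) (scale n)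
    represents-φe ok {π} π∈ = ≡.subst₂ (Represents (φ e π)) (∑-eNum N π∈) scale-2n!!
      (represents-φ (λ σ s σ∈ s∈ → represents-⟦⟧ (eNum n (#Des s)) ((2 ℕ.* n) !!)
        (ok (#Des s) (#Des-bound N σ∈ s∈))) π∈)

    represents-φe0 : e0-ok → ∀ {π} → π ∈ perms n → Represents (φ e0 π) (evenElement n π) half-scale
    represents-φe0 ok {π} π∈ = represents-cross
      (represents-φ {a = λ s → e0Num n (suc (#Des⁺ s))}
        (λ σ s σ∈ s∈ → represents-⟦⟧ (e0Num n (suc (#Des⁺ s))) (n !)
        (ok (suc (#Des⁺ s)) (s≤s z≤n) (s≤s (#Des⁺-bound N σ∈ s∈)))) π∈)
      (≡.trans (rotate (∑ (signings π) (λ s → e0Num n (suc (#Des⁺ s)))) (2^ N) (+ (n !)))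
               (cong (ℤ._* + (n !)) (∑-e0Num N π∈)))
      where
      rotate : ∀ a b c → a ℤ.* (b ℤ.* c) ≡ b ℤ.* a ℤ.* c
      rotate = ℤ-solve-∀

    represents-ρ : ∀ {h} → n ≡ double h → ρ-ok → ∀ σ → σ ∈ perms n → Represents (ρ σ) (oddElement n σ) (scale n)
    represents-ρ n≡ ok σ σ∈ = represents-cross
      (represents-⟦⟧ (ρNum n (#Peak σ)) (n !!) (ok (#Peak σ) (#Peak-bound N σ∈))) (oddElement-even N σ∈ n≡)

    represents-ρ0 : ∀ {h} → n ≡ suc (double h) → ρ0-ok → ∀ σ → σ ∈ perms n →
      Represents (ρ0 σ) (evenElement n σ) (scale n)
    represents-ρ0 n≡ ok σ σ∈ = represents-cross
      (represents-⟦⟧ (ρ0Num n (suc (#Peak⁺ σ))) (n !!) (ok (suc (#Peak⁺ σ)) (s≤s z≤n) (#Peak⁺-bound N σ∈)))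
      (evenElement-odd N σ∈ n≡)

    φe≋ρ : 2 ∣ n → e-ok → ρ-ok → φ e ≋ ρ
    φe≋ρ 2∣n e-ok ρ-ok π π∈ =
      represents-≈ (represents-φe e-ok π∈) (represents-ρ (proj₂ (even-2∣ 2∣n)) ρ-ok π π∈) refl

    φe≋0 : ¬ (2 ∣ n) → e-ok → φ e ≋ 0ₛ
    φe≋0 2∤n e-ok π π∈ = represents-zero
      (subst (λ a → Represents (φ e π) a (scale n)) (oddElement-odd N π∈ (proj₂ (odd-2∤ 2∤n))) (represents-φe e-ok π∈))

    φe0≋0 : 2 ∣ n → e0-ok → φ e0 ≋ 0ₛ
    φe0≋0 2∣n e0-ok π π∈ = represents-zero
      (subst (λ a → Represents (φ e0 π) a half-scale) (evenElement-even N π∈ (proj₂ (even-2∣ 2∣n))) (represents-φe0 e0-ok π∈))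

    φe0≋2ρ0 : ¬ (2 ∣ n) → e0-ok → ρ0-ok → φ e0 ≋ ((1# + 1#) · ρ0)
    φe0≋2ρ0 2∤n e0-ok ρ0-ok π π∈ = represents-≈ {{half-scale≢0}} {{ℤₚ.i*j≢0 1ℤ (scale n)}} (represents-φe0 e0-ok π∈)
      (represents-* (represents-integer 2ℤ (+-congˡ (≈-sym′ (+-identityʳ 1#))) 1ℤ)
                    (represents-ρ0 (proj₂ (odd-2∤ 2∤n)) ρ0-ok π π∈))
      (≡.trans (cong (λ z → evenElement n π ℤ.* (1ℤ ℤ.* z)) scale-half) (lemma (evenElement n π) half-scale))
      where
      ≈-sym′ = Field.sym F
      lemma : ∀ a b → a ℤ.* (1ℤ ℤ.* (2ℤ ℤ.* b)) ≡ 2ℤ ℤ.* 1ℤ ℤ.* a ℤ.* b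
      lemma = ℤ-solve-∀

    -- A product of two elements over `scale n` has the denominator `scale n` squared, so the
    -- integral law with one factor `scale n` is the idempotent law.
    idempotent : ∀ {f : kS} (a : List ℕ → ℤ) → (∀ σ → σ ∈ perms n → Represents (f σ) (a σ) (scale n)) →
      (∀ {π} → π ∈ perms n → convolution n a a π ≡ scale n ℤ.* a π) → (f ⋆ f) ≋ f
    idempotent a rep law π π∈ = represents-≈ {{ℤₚ.i*j≢0 (scale n) (scale n)}} (represents-⋆ rep rep π) (rep π π∈)
      (≡.trans (cong (ℤ._* scale n) (law π∈)) (rotate (scale n) (a π)))
      where
      rotate : ∀ k x → k ℤ.* x ℤ.* k ≡ x ℤ.* (k ℤ.* k)
      rotate = ℤ-solve-∀

    ρ-idempotent : 2 ∣ n → ρ-ok → (ρ ⋆ ρ) ≋ ρ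
    ρ-idempotent 2∣n ok =
      idempotent (oddElement n) (represents-ρ (proj₂ (even-2∣ 2∣n)) ok) (oddElement-idempotent N)

    ρ0-idempotent : ¬ (2 ∣ n) → ρ0-ok → (ρ0 ⋆ ρ0) ≋ ρ0
    ρ0-idempotent 2∤n ok =
      idempotent (evenElement n) (represents-ρ0 (proj₂ (odd-2∤ 2∤n)) ok) (evenElement-idempotent N)

theorem6p2 : ∀ {c ℓ} (F : Field c ℓ) → FieldOps.CharNot2 F →
  (n : ℕ) → 1 ≤ n →
  let open Field F
      open GroupAlgebra F n
  in ((2 ∣ n → e-ok → ρ-ok → φ e ≋ ρ)
      × (¬ (2 ∣ n) → e-ok → φ e ≋ 0ₛ))
     × ((2 ∣ n → e0-ok → φ e0 ≋ 0ₛ)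
      × (¬ (2 ∣ n) → e0-ok → ρ0-ok → φ e0 ≋ ((1# + 1#) · ρ0)))
     × ((2 ∣ n → ρ-ok → (ρ ⋆ ρ) ≋ ρ)
      × (¬ (2 ∣ n) → ρ0-ok → (ρ0 ⋆ ρ0) ≋ ρ0))
theorem6p2 F _ (suc N) _ =
  (φe≋ρ , φe≋0) , (φe0≋0 , φe0≋2ρ0) , (ρ-idempotent , ρ0-idempotent)
  where open FieldTransfer.GroupAlgebraTransfer F N
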